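{- Let $p>5$ be a prime. Then for every integer $a\in\mathbb{Z}$, $$\sum_{k=0}^{p-1}(-1)^{ak}\binom{p-1}{k}^a\equiv \frac{(a-1)p}{ap-1}\left(1+\frac{a(a+1)(3a-2)}{6}\,p^3 X_p\right)\pmod{p^6},$$ where $X_p=\frac{B_{p-3}}{p-3}-\frac{B_{2p-4}}{4p-8}$ and $B_n$ denotes the $n$-th Bernoulli number.
   Context: For negative $a$, $\binom{p-1}{k}^a$ means $1/\binom{p-1}{k}^{|a|}$. A congruence between rational numbers modulo $p^6$ means that their difference is a rational number whose $p$-adic valuation is at least $6$ (all quantities involved have denominators prime to $p$). -}

module Defs where

open import Data.Nat as ℕ using (ℕ; zero; suc)
open import Data.Nat.Combinatorics using (_C_)
open import Data.Nat.Divisibility as ℕD using ()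
open import Data.Integer as ℤ using (ℤ; +_; -[1+_])
open import Data.Integer.Divisibility as ℤD using ()
open import Data.Rational as ℚ using (ℚ; 0ℚ; 1ℚ; _+_; _*_; -_; _-_; ↥_; _÷_)
open import Data.Rational.Properties using (_≟_)
open import Data.List using (List; []; _∷_; _++_; map; foldr; upTo)
open import Relation.Nullary using (yes; no)

ℤ→ℚ : ℤ → ℚ
ℤ→ℚ z = z ℚ./ 1

ℕ→ℚ : ℕ → ℚ
ℕ→ℚ n = ℤ→ℚ (+ n)

-- total division on ℚ (x / 0 := 0); only ever used with nonzero divisors
_÷'_ : ℚ → ℚ → ℚ
x ÷' y with y ≟ 0ℚ
... | yes _ = 0ℚ
... | no y≢0 = _÷_ x y {{ℚ.≢-nonZero y≢0}}

_^ℚ_ : ℚ → ℕ → ℚ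
x ^ℚ zero = 1ℚ
x ^ℚ suc n = x * (x ^ℚ n)

_^ℤ_ : ℚ → ℤ → ℚ
x ^ℤ (+ n) = x ^ℚ n
x ^ℤ -[1+ n ] = 1ℚ ÷' (x ^ℚ suc n)

Σ< : ℕ → (ℕ → ℚ) → ℚ
Σ< n f = foldr _+_ 0ℚ (map f (upTo n))

nth : List ℚ → ℕ → ℚ
nth [] _ = 0ℚ
nth (x ∷ xs) zero = x
nth (x ∷ xs) (suc n) = nth xs n

-- Bernoulli numbers via the standard recurrence
--   B_0 = 1,   Σ_{k=0}^{m} C(m+1,k) B_k = 0  (m ≥ 1),  i.e. B_1 = -1/2.
-- bernList n = [B_0, …, B_n]
bernList : ℕ → List ℚ
bernList zero = 1ℚ ∷ []
bernList (suc n) = prev ++ (next ∷ [])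
  where
  prev = bernList n
  next = - (Σ< (suc n) (λ k → ℕ→ℚ ((suc (suc n)) C k) * nth prev k) ÷' ℕ→ℚ (suc (suc n)))

bernoulli : ℕ → ℚ
bernoulli n = nth (bernList n) n

-- p-adic congruence of rationals: x ≡ y (mod p^e) iff v_p(x - y) ≥ e,
-- i.e. p^e divides the numerator of the reduced fraction x - y
-- (for reduced n/d with p^e ∣ n, e ≥ 1, automatically p ∤ d).
_≡_[modℚ_^_] : ℚ → ℚ → ℕ → ℕ → Set
x ≡ y [modℚ p ^ e ] = (+ (p ℕ.^ e)) ℤD.∣ (↥ (x - y))

Xp : ℕ → ℚ
Xp p = (bernoulli (p ℕ.∸ 3) ÷' ℕ→ℚ (p ℕ.∸ 3))
     - (bernoulli (2 ℕ.* p ℕ.∸ 4) ÷' ℕ→ℚ (4 ℕ.* p ℕ.∸ 8))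

lhsSum : ℕ → ℤ → ℚ
lhsSum p a = Σ< p (λ k → ((- 1ℚ) ^ℤ (a ℤ.* + k)) * (ℕ→ℚ ((p ℕ.∸ 1) C k) ^ℤ a))

rhsExpr : ℕ → ℤ → ℚ
rhsExpr p a =
  (ℤ→ℚ ((a ℤ.- + 1) ℤ.* + p) ÷' ℤ→ℚ (a ℤ.* + p ℤ.- + 1))
  * (1ℚ + ((ℤ→ℚ (a ℤ.* (a ℤ.+ + 1) ℤ.* (+ 3 ℤ.* a ℤ.- + 2)) ÷' ℕ→ℚ 6)
           * (ℕ→ℚ p ^ℚ 3) * Xp p))

{-# OPTIONS --safe #-}
-- Put u k = (-1)ᵏ C(p-1,k) = ∏_{j≤k} (1 - p/j), so that the sum is T = Σ_{k<p} (u k)ᵃ, and write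
-- Sᵢ = Σ_{0<k<p} (u (k-1))ᵃ/kⁱ, H = Σ_{0<k<p} 1/k, m = (p-1)/2.
-- Abel summation of (k + p(a-1)/2)((u k)ᵃ - (u (k-1))ᵃ), with (1 - p/k)ᵃ expanded modulo p⁶, gives
--   (1 - ap) T ≡ p(1-a) - (a³-a)/12 · p³ S₂  (mod p⁶),
-- because the reflection k ↦ p-k shows S₃ ≡ 0 (mod p²) and S₄ ≡ 0 (mod p).
-- Modulo p³, S₂ is a quadratic polynomial in a. Its values at a = 0, 1, 2 come from reflection, from
-- Σ (-1)ᵏ⁻¹ C(p,k)/k = Σ 1/k, and from Vandermonde's identity for C(2p,p); hence p S₂ ≡ (3a-2) H (mod p⁴).
-- Pairing k with p-k, and 2k with p-2k, gives 6H ≡ p² Σ_{k≤m} 1/k³ (mod p⁴). The last sum is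
-- 4 Σ (-1)ᵏ/k³ modulo p². By Fermat it is a combination of alternating power sums, which the Genocchi
-- numbers 2(1-2ⁿ)Bₙ evaluate, so that H ≡ 2p² X_p (mod p⁴).
module Submission where

open import Defs
open import Data.Nat as ℕ using (ℕ; zero; suc; _≤_; _<_; s≤s; z≤n)
import Data.Nat.Properties as ℕ
open import Data.Nat.Combinatorics using (_C_; nCk+nC[k+1]≡[n+1]C[k+1]; k>n⇒nCk≡0; nCn≡1; nC1≡n; nCk≡nC[n∸k])
open import Data.Nat.Divisibility as ℕ∣ using (_∣_; divides)
open import Data.Nat.Primality as ℕ using (Prime; euclidsLemma)
open import Data.Integer as ℤ using (ℤ; -[1+_])
import Data.Integer.Properties as ℤ
import Data.Integer.Divisibility as ℤ∣
import Data.Integer.Divisibility.Signed as ℤ±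
open import Data.Rational as ℚ using (ℚ; 0ℚ; 1ℚ; _+_; _*_; -_; _-_; ↥_; ↧_)
import Data.Rational.Properties as ℚ
open import Data.Rational.Unnormalised as ℚᵘ using (mkℚᵘ)
import Data.Rational.Unnormalised.Properties as ℚᵘ
open import Data.List using ([]; _∷_; _++_; length; foldr; applyUpTo)
import Data.List.Properties as List
open import Data.Product using (∃; _×_; _,_; proj₁; proj₂)
open import Data.Sum using (_⊎_; inj₁; inj₂; [_,_]′)
open import Function using (_∘_)
open import Level using (0ℓ)
open import Relation.Nullary using (¬_; yes; no; contradiction)
open import Relation.Nullary.Decidable using (dec⇒maybe)
open import Relation.Binary.PropositionalEquality
open import Tactic.RingSolver using (solve-∀)
open import Tactic.RingSolver.Core.AlmostCommutativeRing using (AlmostCommutativeRing; fromCommutativeRing)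
open import Data.Integer.Tactic.RingSolver renaming (solve-∀ to solveℤ-∀)
open import Data.Nat.Tactic.RingSolver renaming (solve-∀ to solveℕ-∀)

-- Bernoulli numbers can have p in their denominators. The Genocchi recurrence divides only by 2, so
-- its numbers are p-integral for odd p, and the integrality of B_(p-3)/(p-3) and B_(2p-4)/(2p-4)
-- comes out of the power sums instead of being put in. The combination X_p reflects Fermat's
-- theorem squared: (k^(p-1) - 1)² ≡ 0 (mod p²) expresses 1/k³ by positive powers of k with
-- coefficients 2 and -1, and 2 X_p carries the same coefficients. The factors 1 - 2ⁿ threaten to
-- leave a Fermat quotient of 2; it disappears because the two Bernoulli quotients agree modulo p.
-- S₂ is quadratic in a modulo p³ because every u k is 1 modulo p. The three values -2H, H, 4H of p
-- S₂ lie on a line, whence the linear factor 3a-2. The proof divides by 5! and by 15, both prime to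
-- p because p > 5.

ℚ-ring : AlmostCommutativeRing 0ℓ 0ℓ
ℚ-ring = fromCommutativeRing ℚ.+-*-commutativeRing (λ x → dec⇒maybe (0ℚ ℚ.≟ x))

-- Arithmetic of the embeddings of ℕ and ℤ in ℚ, of powers and of division

ℤ→ℚ-+ : ∀ a b → ℤ→ℚ (a ℤ.+ b) ≡ ℤ→ℚ a + ℤ→ℚ b
ℤ→ℚ-+ a b = ℚ.toℚᵘ-injective (begin
  ℚ.toℚᵘ (ℤ→ℚ (a ℤ.+ b))              ≈⟨ ℚ.toℚᵘ-fromℚᵘ (mkℚᵘ (a ℤ.+ b) 0) ⟩
  mkℚᵘ (a ℤ.+ b) 0                     ≈⟨ ℚᵘ.*≡* (lemma a b) ⟩
  mkℚᵘ a 0 ℚᵘ.+ mkℚᵘ b 0              ≈⟨ ℚᵘ.+-cong (ℚ.toℚᵘ-fromℚᵘ (mkℚᵘ a 0)) (ℚ.toℚᵘ-fromℚᵘ (mkℚᵘ b 0)) ⟨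
  ℚ.toℚᵘ (ℤ→ℚ a) ℚᵘ.+ ℚ.toℚᵘ (ℤ→ℚ b) ≈⟨ ℚ.toℚᵘ-homo-+ (ℤ→ℚ a) (ℤ→ℚ b) ⟨
  ℚ.toℚᵘ (ℤ→ℚ a + ℤ→ℚ b)             ∎)
  where
  open ℚᵘ.≃-Reasoning
  lemma : ∀ a b → (a ℤ.+ b) ℤ.* ℤ.1ℤ ≡ (a ℤ.* ℤ.1ℤ ℤ.+ b ℤ.* ℤ.1ℤ) ℤ.* ℤ.1ℤ
  lemma = solveℤ-∀

ℤ→ℚ-* : ∀ a b → ℤ→ℚ (a ℤ.* b) ≡ ℤ→ℚ a * ℤ→ℚ b
ℤ→ℚ-* a b = ℚ.toℚᵘ-injective (begin
  ℚ.toℚᵘ (ℤ→ℚ (a ℤ.* b))              ≈⟨ ℚ.toℚᵘ-fromℚᵘ (mkℚᵘ (a ℤ.* b) 0) ⟩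
  mkℚᵘ a 0 ℚᵘ.* mkℚᵘ b 0              ≈⟨ ℚᵘ.*-cong (ℚ.toℚᵘ-fromℚᵘ (mkℚᵘ a 0)) (ℚ.toℚᵘ-fromℚᵘ (mkℚᵘ b 0)) ⟨
  ℚ.toℚᵘ (ℤ→ℚ a) ℚᵘ.* ℚ.toℚᵘ (ℤ→ℚ b) ≈⟨ ℚ.toℚᵘ-homo-* (ℤ→ℚ a) (ℤ→ℚ b) ⟨
  ℚ.toℚᵘ (ℤ→ℚ a * ℤ→ℚ b)             ∎)
  where open ℚᵘ.≃-Reasoning

ℤ→ℚ-injective : ∀ {a b} → ℤ→ℚ a ≡ ℤ→ℚ b → a ≡ b
ℤ→ℚ-injective {a} {b} eq with ℚᵘ.≃-trans (ℚᵘ.≃-sym (ℚ.toℚᵘ-fromℚᵘ (mkℚᵘ a 0)))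
                               (ℚᵘ.≃-trans (ℚᵘ.≃-reflexive (cong ℚ.toℚᵘ eq)) (ℚ.toℚᵘ-fromℚᵘ (mkℚᵘ b 0)))
... | ℚᵘ.*≡* e = trans (sym (ℤ.*-identityʳ a)) (trans e (ℤ.*-identityʳ b))

ℕ→ℚ-+ : ∀ m n → ℕ→ℚ (m ℕ.+ n) ≡ ℕ→ℚ m + ℕ→ℚ n
ℕ→ℚ-+ m n = ℤ→ℚ-+ (ℤ.+ m) (ℤ.+ n)

ℕ→ℚ-* : ∀ m n → ℕ→ℚ (m ℕ.* n) ≡ ℕ→ℚ m * ℕ→ℚ n
ℕ→ℚ-* m n = trans (cong ℤ→ℚ (ℤ.pos-* m n)) (ℤ→ℚ-* (ℤ.+ m) (ℤ.+ n))

ℕ→ℚ-suc : ∀ n → ℕ→ℚ (suc n) ≡ ℕ→ℚ n + 1ℚ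
ℕ→ℚ-suc n = trans (cong ℕ→ℚ (ℕ.+-comm 1 n)) (ℕ→ℚ-+ n 1)

ℕ→ℚ-^ : ∀ m n → ℕ→ℚ (m ℕ.^ n) ≡ ℕ→ℚ m ^ℚ n
ℕ→ℚ-^ m zero = refl
ℕ→ℚ-^ m (suc n) = trans (ℕ→ℚ-* m (m ℕ.^ n)) (cong (ℕ→ℚ m *_) (ℕ→ℚ-^ m n))

ℕ→ℚ-injective : ∀ {m n} → ℕ→ℚ m ≡ ℕ→ℚ n → m ≡ n
ℕ→ℚ-injective = ℤ.+-injective ∘ ℤ→ℚ-injective

ℕ→ℚ-suc≢0 : ∀ n → ℕ→ℚ (suc n) ≢ 0ℚ
ℕ→ℚ-suc≢0 n eq with () ← ℕ→ℚ-injective {suc n} {0} eq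

^ℚ-+ : ∀ x m n → x ^ℚ (m ℕ.+ n) ≡ x ^ℚ m * x ^ℚ n
^ℚ-+ x zero n = sym (ℚ.*-identityˡ _)
^ℚ-+ x (suc m) n = trans (cong (x *_) (^ℚ-+ x m n)) (sym (ℚ.*-assoc x (x ^ℚ m) (x ^ℚ n)))

^ℚ-* : ∀ x y n → (x * y) ^ℚ n ≡ x ^ℚ n * y ^ℚ n
^ℚ-* x y zero = refl
^ℚ-* x y (suc n) = trans (cong (x * y *_) (^ℚ-* x y n)) (interchange x y (x ^ℚ n) (y ^ℚ n))
  where
  interchange : ∀ a b c d → (a * b) * (c * d) ≡ (a * c) * (b * d)
  interchange = solve-∀ ℚ-ring

x-y≡0⇒x≡y : ∀ {x y} → x - y ≡ 0ℚ → x ≡ y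
x-y≡0⇒x≡y {x} {y} eq = trans (lemma x y) (trans (cong (_+ y) eq) (ℚ.+-identityˡ y))
  where
  lemma : ∀ x y → x ≡ (x - y) + y
  lemma = solve-∀ ℚ-ring

*-cancelˡ-≢0 : ∀ {z x y} → z ≢ 0ℚ → z * x ≡ z * y → x ≡ y
*-cancelˡ-≢0 {z} {x} {y} z≢0 eq = trans (sym (lemma x)) (trans (cong (ℚ.1/ z *_) eq) (lemma y))
  where
  instance _ = ℚ.≢-nonZero z≢0
  lemma : ∀ w → ℚ.1/ z * (z * w) ≡ w
  lemma w = trans (sym (ℚ.*-assoc (ℚ.1/ z) z w)) (trans (cong (_* w) (ℚ.*-inverseˡ z)) (ℚ.*-identityˡ w))

÷'-cancel : ∀ x {y} → y ≢ 0ℚ → y * (x ÷' y) ≡ x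
÷'-cancel x {y} y≢0 with y ℚ.≟ 0ℚ
... | yes y≡0 = contradiction y≡0 y≢0
... | no y≢0′ = trans (lemma y x (ℚ.1/ y)) (trans (cong (x *_) (ℚ.*-inverseʳ y)) (ℚ.*-identityʳ x))
  where
  instance _ = ℚ.≢-nonZero y≢0′
  lemma : ∀ y x z → y * (x * z) ≡ x * (y * z)
  lemma = solve-∀ ℚ-ring

≢0-* : ∀ {x y} → x ≢ 0ℚ → y ≢ 0ℚ → x * y ≢ 0ℚ
≢0-* {x} {y} x≢0 y≢0 eq = y≢0 (*-cancelˡ-≢0 x≢0 (trans eq (sym (ℚ.*-zeroʳ x))))

ℤ→ℚ-neg : ∀ a → - ℤ→ℚ a ≡ ℤ→ℚ (ℤ.- a)
ℤ→ℚ-neg a = x-y≡0⇒x≡y (trans (cong (λ x → - ℤ→ℚ a + - x) (sym eq)) (lemma (ℤ→ℚ a)))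
  where
  lemma : ∀ x → - x + - (- 1ℚ * x) ≡ 0ℚ
  lemma = solve-∀ ℚ-ring
  eq : - 1ℚ * ℤ→ℚ a ≡ ℤ→ℚ (ℤ.- a)
  eq = trans (sym (ℤ→ℚ-* -[1+ 0 ] a)) (cong ℤ→ℚ (ℤ.-1*i≡-i a))

↧*x≡↥ : ∀ x → ℤ→ℚ (ℚ.↧ x) * x ≡ ℤ→ℚ (ℚ.↥ x)
↧*x≡↥ x@record{} = ℚ.toℚᵘ-injective (begin
  ℚ.toℚᵘ (ℤ→ℚ (ℚ.↧ x) * x)               ≈⟨ ℚ.toℚᵘ-homo-* (ℤ→ℚ (ℚ.↧ x)) x ⟩
  ℚ.toℚᵘ (ℤ→ℚ (ℚ.↧ x)) ℚᵘ.* ℚ.toℚᵘ x     ≈⟨ ℚᵘ.*-cong (ℚ.toℚᵘ-fromℚᵘ (mkℚᵘ (ℚ.↧ x) 0)) ℚᵘ.≃-refl ⟩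
  mkℚᵘ (ℚ.↧ x) 0 ℚᵘ.* ℚ.toℚᵘ x           ≈⟨ ℚᵘ.*≡* (lemma (ℚ.↧ x) (ℚ.↥ x)) ⟩
  mkℚᵘ (ℚ.↥ x) 0                          ≈⟨ ℚ.toℚᵘ-fromℚᵘ (mkℚᵘ (ℚ.↥ x) 0) ⟨
  ℚ.toℚᵘ (ℤ→ℚ (ℚ.↥ x))                   ∎)
  where
  open ℚᵘ.≃-Reasoning
  lemma : ∀ d n → (d ℤ.* n) ℤ.* ℤ.1ℤ ≡ n ℤ.* (ℤ.1ℤ ℤ.* d)
  lemma = solveℤ-∀

ℤ→ℚ-- : ∀ x y → ℤ→ℚ (x ℤ.- y) ≡ ℤ→ℚ x - ℤ→ℚ y
ℤ→ℚ-- x y = trans (ℤ→ℚ-+ x (ℤ.- y)) (cong (λ z → ℤ→ℚ x + z) (sym (ℤ→ℚ-neg y)))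

-- Fractions with denominator prime to `p`, and congruences modulo powers of `p`

module Localization (p : ℕ) (p-prime : Prime p) where

  P : ℚ
  P = ℕ→ℚ p

  P≢0 : P ≢ 0ℚ
  P≢0 eq = ℕ.≢-nonZero⁻¹ p {{ℕ.prime⇒nonZero p-prime}} (ℕ→ℚ-injective {p} {0} eq)

  -- Membership in the localization of ℤ at p. The fraction need not be reduced, so sums and
  -- products only multiply denominators.
  record Integral (x : ℚ) : Set where
    constructor integral
    field
      num   : ℤ
      den   : ℕ
      p∤den : ¬ (p ∣ den)
      eq    : ℕ→ℚ den * x ≡ ℤ→ℚ num

  p∤1 : ¬ (p ∣ 1)
  p∤1 p∣1 = contradiction (subst Prime (ℕ∣.∣1⇒≡1 p∣1) p-prime) ℕ.¬prime[1]

  p∤* : ∀ {m n} → ¬ (p ∣ m) → ¬ (p ∣ n) → ¬ (p ∣ m ℕ.* n)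
  p∤* {m} {n} p∤m p∤n = [ p∤m , p∤n ]′ ∘ euclidsLemma m n p-prime

  ℤ-int : ∀ z → Integral (ℤ→ℚ z)
  ℤ-int z = integral z 1 p∤1 (ℚ.*-identityˡ _)

  ℕ-int : ∀ n → Integral (ℕ→ℚ n)
  ℕ-int n = ℤ-int (ℤ.+ n)

  infixl 6 _+ᴵ_ _-ᴵ_
  infixl 7 _*ᴵ_

  _+ᴵ_ : ∀ {x y} → Integral x → Integral y → Integral (x + y)
  _+ᴵ_ {x} {y} (integral n d p∤d e) (integral n′ d′ p∤d′ e′) =
    integral (ℤ.+ d′ ℤ.* n ℤ.+ ℤ.+ d ℤ.* n′) (d ℕ.* d′) (p∤* p∤d p∤d′) (begin
      ℕ→ℚ (d ℕ.* d′) * (x + y)                        ≡⟨ cong (_* (x + y)) (ℕ→ℚ-* d d′) ⟩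
      ℕ→ℚ d * ℕ→ℚ d′ * (x + y)                        ≡⟨ lemma (ℕ→ℚ d) (ℕ→ℚ d′) x y ⟩
      ℕ→ℚ d′ * (ℕ→ℚ d * x) + ℕ→ℚ d * (ℕ→ℚ d′ * y)     ≡⟨ cong₂ (λ u v → ℕ→ℚ d′ * u + ℕ→ℚ d * v) e e′ ⟩
      ℕ→ℚ d′ * ℤ→ℚ n + ℕ→ℚ d * ℤ→ℚ n′                 ≡⟨ cong₂ _+_ (ℤ→ℚ-* (ℤ.+ d′) n) (ℤ→ℚ-* (ℤ.+ d) n′) ⟨
      ℤ→ℚ (ℤ.+ d′ ℤ.* n) + ℤ→ℚ (ℤ.+ d ℤ.* n′)             ≡⟨ ℤ→ℚ-+ (ℤ.+ d′ ℤ.* n) (ℤ.+ d ℤ.* n′) ⟨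
      ℤ→ℚ (ℤ.+ d′ ℤ.* n ℤ.+ ℤ.+ d ℤ.* n′)                 ∎)
    where
    open ≡-Reasoning
    lemma : ∀ a b x y → a * b * (x + y) ≡ b * (a * x) + a * (b * y)
    lemma = solve-∀ ℚ-ring

  _*ᴵ_ : ∀ {x y} → Integral x → Integral y → Integral (x * y)
  _*ᴵ_ {x} {y} (integral n d p∤d e) (integral n′ d′ p∤d′ e′) =
    integral (n ℤ.* n′) (d ℕ.* d′) (p∤* p∤d p∤d′) (begin
      ℕ→ℚ (d ℕ.* d′) * (x * y)          ≡⟨ cong (_* (x * y)) (ℕ→ℚ-* d d′) ⟩
      ℕ→ℚ d * ℕ→ℚ d′ * (x * y)          ≡⟨ lemma (ℕ→ℚ d) (ℕ→ℚ d′) x y ⟩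
      (ℕ→ℚ d * x) * (ℕ→ℚ d′ * y)        ≡⟨ cong₂ _*_ e e′ ⟩
      ℤ→ℚ n * ℤ→ℚ n′                    ≡⟨ ℤ→ℚ-* n n′ ⟨
      ℤ→ℚ (n ℤ.* n′)                    ∎)
    where
    open ≡-Reasoning
    lemma : ∀ a b x y → a * b * (x * y) ≡ (a * x) * (b * y)
    lemma = solve-∀ ℚ-ring

  -ᴵ_ : ∀ {x} → Integral x → Integral (- x)
  -ᴵ_ {x} i = subst Integral (lemma x) (ℤ-int (-[1+ 0 ]) *ᴵ i)
    where
    lemma : ∀ x → - 1ℚ * x ≡ - x
    lemma = solve-∀ ℚ-ring

  _-ᴵ_ : ∀ {x y} → Integral x → Integral y → Integral (x - y)
  i -ᴵ j = i +ᴵ (-ᴵ j)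

  ^-int : ∀ {x} n → Integral x → Integral (x ^ℚ n)
  ^-int zero    i = ℕ-int 1
  ^-int (suc n) i = i *ᴵ ^-int n i

  P-int : Integral P
  P-int = ℕ-int p

  -- Integrality is asked of the inverse: the valuation of `x` is at most 0, which is what
  -- cancelling `x` from a congruence requires.
  record Unit (x : ℚ) : Set where
    constructor unit
    field
      inverse     : ℚ
      inverse-int : Integral inverse
      inverseʳ    : x * inverse ≡ 1ℚ

  ℕ-unit : ∀ {n} → ¬ (p ∣ n) → Unit (ℕ→ℚ n)
  ℕ-unit {zero} p∤n = contradiction (p ℕ∣.∣0) p∤n
  ℕ-unit {suc n} p∤n = unit (1ℚ ÷' ℕ→ℚ (suc n)) (integral (ℤ.+ 1) (suc n) p∤n eq) eq
    where eq = ÷'-cancel 1ℚ (ℕ→ℚ-suc≢0 n)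

  infix 4 _∈𝔭^_ _≈_[_]

  record _∈𝔭^_ (x : ℚ) (e : ℕ) : Set where
    constructor multiple
    field
      quotient     : ℚ
      quotient-int : Integral quotient
      eq           : x ≡ P ^ℚ e * quotient

  -- A record instead of a synonym for `x - y ∈𝔭^ e`, so that both sides can be inferred from the
  -- type of a congruence.
  record _≈_[_] (x y : ℚ) (e : ℕ) : Set where
    constructor ∈⇒≈
    field
      ≈⇒∈ : x - y ∈𝔭^ e
  open _≈_[_] public

  ∈-resp : ∀ {x y e} → x ≡ y → x ∈𝔭^ e → y ∈𝔭^ e
  ∈-resp eq = subst (_∈𝔭^ _) eq

  int⇒∈ : ∀ {x} → Integral x → x ∈𝔭^ 0
  int⇒∈ {x} i = multiple x i (sym (ℚ.*-identityˡ x))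

  ∈⇒int : ∀ {x e} → x ∈𝔭^ e → Integral x
  ∈⇒int {e = e} (multiple q i eq) = subst Integral (sym eq) (^-int e P-int *ᴵ i)

  P^∈ : ∀ e → P ^ℚ e ∈𝔭^ e
  P^∈ e = multiple 1ℚ (ℕ-int 1) (sym (ℚ.*-identityʳ _))

  P∈ : P ∈𝔭^ 1
  P∈ = ∈-resp (ℚ.*-identityʳ P) (P^∈ 1)

  0∈ : ∀ {e} → 0ℚ ∈𝔭^ e
  0∈ {e} = multiple 0ℚ (ℕ-int 0) (sym (ℚ.*-zeroʳ (P ^ℚ e)))

  infixl 6 _+∈_ _-∈_
  infixl 7 _*∈_ _·∈_

  _+∈_ : ∀ {x y e} → x ∈𝔭^ e → y ∈𝔭^ e → x + y ∈𝔭^ e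
  _+∈_ {e = e} (multiple q i eq) (multiple q′ i′ eq′) =
    multiple (q + q′) (i +ᴵ i′) (trans (cong₂ _+_ eq eq′) (sym (ℚ.*-distribˡ-+ (P ^ℚ e) q q′)))

  _*∈_ : ∀ {x y e f} → x ∈𝔭^ e → y ∈𝔭^ f → x * y ∈𝔭^ (e ℕ.+ f)
  _*∈_ {e = e} {f} (multiple q i eq) (multiple q′ i′ eq′) =
    multiple (q * q′) (i *ᴵ i′) (trans (cong₂ _*_ eq eq′)
      (trans (lemma (P ^ℚ e) q (P ^ℚ f) q′) (cong (_* (q * q′)) (sym (^ℚ-+ P e f)))))
    where
    lemma : ∀ a b c d → (a * b) * (c * d) ≡ (a * c) * (b * d)
    lemma = solve-∀ ℚ-ring

  _·∈_ : ∀ {x y e} → Integral x → y ∈𝔭^ e → x * y ∈𝔭^ e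
  i ·∈ y∈ = int⇒∈ i *∈ y∈

  -∈_ : ∀ {x e} → x ∈𝔭^ e → - x ∈𝔭^ e
  -∈_ {x} x∈ = ∈-resp (lemma x) (ℤ-int -[1+ 0 ] ·∈ x∈)
    where
    lemma : ∀ x → - 1ℚ * x ≡ - x
    lemma = solve-∀ ℚ-ring

  _-∈_ : ∀ {x y e} → x ∈𝔭^ e → y ∈𝔭^ e → x - y ∈𝔭^ e
  x∈ -∈ y∈ = x∈ +∈ (-∈ y∈)

  ∈-weaken : ∀ {x} e f → x ∈𝔭^ (e ℕ.+ f) → x ∈𝔭^ f
  ∈-weaken e f (multiple q i eq) =
    multiple (P ^ℚ e * q) (^-int e P-int *ᴵ i)
      (trans eq (trans (cong (_* q) (^ℚ-+ P e f)) (lemma (P ^ℚ e) (P ^ℚ f) q)))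
    where
    lemma : ∀ a b c → a * b * c ≡ b * (a * c)
    lemma = solve-∀ ℚ-ring

  ∈-cancelP : ∀ {x e} → P * x ∈𝔭^ suc e → x ∈𝔭^ e
  ∈-cancelP {e = e} (multiple q i eq) =
    multiple q i (*-cancelˡ-≢0 P≢0 (trans eq (ℚ.*-assoc P (P ^ℚ e) q)))

  ∈-cancel : ∀ {u x e} → Unit u → u * x ∈𝔭^ e → x ∈𝔭^ e
  ∈-cancel {u} {x} (unit v v-int uv≡1) ux∈ =
    ∈-resp (trans (lemma u v x) (trans (cong (_* x) uv≡1) (ℚ.*-identityˡ x))) (v-int ·∈ ux∈)
    where
    lemma : ∀ u v x → v * (u * x) ≡ u * v * x
    lemma = solve-∀ ℚ-ring

  ≈-refl : ∀ {x e} → x ≈ x [ e ]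
  ≈-refl {x} = ∈⇒≈ (∈-resp (sym (ℚ.+-inverseʳ x)) 0∈)

  ≈-reflexive : ∀ {x y e} → x ≡ y → x ≈ y [ e ]
  ≈-reflexive refl = ≈-refl

  ≈-sym : ∀ {x y e} → x ≈ y [ e ] → y ≈ x [ e ]
  ≈-sym {x} {y} (∈⇒≈ x≈y) = ∈⇒≈ (∈-resp (lemma x y) (-∈ x≈y))
    where
    lemma : ∀ x y → - (x - y) ≡ y - x
    lemma = solve-∀ ℚ-ring

  ≈-trans : ∀ {x y z e} → x ≈ y [ e ] → y ≈ z [ e ] → x ≈ z [ e ]
  ≈-trans {x} {y} {z} (∈⇒≈ x≈y) (∈⇒≈ y≈z) = ∈⇒≈ (∈-resp (lemma x y z) (x≈y +∈ y≈z))
    where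
    lemma : ∀ x y z → (x - y) + (y - z) ≡ x - z
    lemma = solve-∀ ℚ-ring

  +-cong-≈ : ∀ {x x′ y y′ e} → x ≈ x′ [ e ] → y ≈ y′ [ e ] → x + y ≈ x′ + y′ [ e ]
  +-cong-≈ {x} {x′} {y} {y′} (∈⇒≈ x≈) (∈⇒≈ y≈) = ∈⇒≈ (∈-resp (lemma x x′ y y′) (x≈ +∈ y≈))
    where
    lemma : ∀ x x′ y y′ → (x - x′) + (y - y′) ≡ (x + y) - (x′ + y′)
    lemma = solve-∀ ℚ-ring

  +-congˡ-≈ : ∀ x {y y′ e} → y ≈ y′ [ e ] → x + y ≈ x + y′ [ e ]
  +-congˡ-≈ x y≈ = +-cong-≈ (≈-refl {x}) y≈

  -‿cong-≈ : ∀ {x x′ e} → x ≈ x′ [ e ] → - x ≈ - x′ [ e ]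
  -‿cong-≈ {x} {x′} (∈⇒≈ x≈) = ∈⇒≈ (∈-resp (lemma x x′) (-∈ x≈))
    where
    lemma : ∀ x x′ → - (x - x′) ≡ - x - - x′
    lemma = solve-∀ ℚ-ring

  *-congˡ-≈ : ∀ {c x y e f} → c ∈𝔭^ e → x ≈ y [ f ] → c * x ≈ c * y [ e ℕ.+ f ]
  *-congˡ-≈ {c} {x} {y} c∈ (∈⇒≈ x≈y) = ∈⇒≈ (∈-resp (lemma c x y) (c∈ *∈ x≈y))
    where
    lemma : ∀ c x y → c * (x - y) ≡ c * x - c * y
    lemma = solve-∀ ℚ-ring

  *-cong-≈ : ∀ {x x′ y y′ e} → Integral x → Integral y′ → x ≈ x′ [ e ] → y ≈ y′ [ e ] → x * y ≈ x′ * y′ [ e ]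
  *-cong-≈ {x} {x′} {y} {y′} x-int y′-int (∈⇒≈ x≈) (∈⇒≈ y≈) =
    ∈⇒≈ (∈-resp (lemma x x′ y y′) (x-int ·∈ y≈ +∈ y′-int ·∈ x≈))
    where
    lemma : ∀ x x′ y y′ → x * (y - y′) + y′ * (x - x′) ≡ x * y - x′ * y′
    lemma = solve-∀ ℚ-ring

  ^-cong-≈ : ∀ {x y e} n → Integral x → Integral y → x ≈ y [ e ] → x ^ℚ n ≈ y ^ℚ n [ e ]
  ^-cong-≈ zero    x-int y-int x≈y = ≈-refl
  ^-cong-≈ (suc n) x-int y-int x≈y = *-cong-≈ x-int (^-int n y-int) x≈y (^-cong-≈ n x-int y-int x≈y)

  ∈⇒≈0 : ∀ {x e} → x ∈𝔭^ e → x ≈ 0ℚ [ e ]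
  ∈⇒≈0 {x} x∈ = ∈⇒≈ (∈-resp (sym (ℚ.+-identityʳ x)) x∈)

  ∈-≈ : ∀ {x y e} → x ≈ y [ e ] → y ∈𝔭^ e → x ∈𝔭^ e
  ∈-≈ {x} {y} (∈⇒≈ x≈y) y∈ = ∈-resp (lemma x y) (x≈y +∈ y∈)
    where
    lemma : ∀ x y → (x - y) + y ≡ x
    lemma = solve-∀ ℚ-ring

  ≈-weaken : ∀ {x y} e f → x ≈ y [ e ℕ.+ f ] → x ≈ y [ f ]
  ≈-weaken e f (∈⇒≈ x≈y) = ∈⇒≈ (∈-weaken e f x≈y)

  ≈-cancel : ∀ {u x y e} → Unit u → u * x ≈ u * y [ e ] → x ≈ y [ e ]
  ≈-cancel {u} {x} {y} u-unit (∈⇒≈ ux≈uy) = ∈⇒≈ (∈-cancel u-unit (∈-resp (lemma u x y) ux≈uy))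
    where
    lemma : ∀ u x y → u * x - u * y ≡ u * (x - y)
    lemma = solve-∀ ℚ-ring

  ≈-cancelP : ∀ {x y e} → P * x ≈ P * y [ suc e ] → x ≈ y [ e ]
  ≈-cancelP {x} {y} (∈⇒≈ ux≈uy) = ∈⇒≈ (∈-cancelP (∈-resp (lemma P x y) ux≈uy))
    where
    lemma : ∀ u x y → u * x - u * y ≡ u * (x - y)
    lemma = solve-∀ ℚ-ring

  -- Euclid's lemma extracts one factor `p` from `o` at a time, which is then cancelled from both
  -- sides of the divisibility.
  p^∣-cancel : ∀ e {d o} → ¬ (p ∣ d) → p ℕ.^ e ∣ d ℕ.* o → p ℕ.^ e ∣ o
  p^∣-cancel zero    p∤d _ = ℕ∣.1∣ _
  p^∣-cancel (suc e) {d} {o} p∤d p^e∣do with euclidsLemma d o p-prime (ℕ∣.∣-trans (ℕ∣.m∣m*n (p ℕ.^ e)) p^e∣do)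
  ... | inj₁ p∣d = contradiction p∣d p∤d
  ... | inj₂ (divides o′ refl) =
    subst (p ℕ.^ suc e ∣_) (ℕ.*-comm p o′) (ℕ∣.*-monoʳ-∣ p (p^∣-cancel e p∤d
      (ℕ∣.*-cancelˡ-∣ p (subst (p ℕ.^ suc e ∣_) eq p^e∣do))))
    where
    instance _ = ℕ.prime⇒nonZero p-prime
    eq : d ℕ.* (o′ ℕ.* p) ≡ p ℕ.* (d ℕ.* o′)
    eq = trans (sym (ℕ.*-assoc d o′ p)) (ℕ.*-comm (d ℕ.* o′) p)

  -- Clearing denominators in `x ≡ P ^ℚ e * q` gives d · ↥x = n · ↧x · pᵉ in ℤ with p ∤ d. This is
  -- the passage back to the congruence of the statement.
  ∈⇒∣↥ : ∀ {x e} → x ∈𝔭^ e → (ℤ.+ (p ℕ.^ e)) ℤ∣.∣ (↥ x)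
  ∈⇒∣↥ {x} {e} (multiple q (integral n d p∤d dq≡n) x≡) =
    p^∣-cancel e p∤d (divides ℤ.∣ n ℤ.* ↧ x ∣ (begin
      d ℕ.* ℤ.∣ ↥ x ∣                        ≡⟨ ℤ.∣i*j∣≡∣i∣*∣j∣ (ℤ.+ d) (↥ x) ⟨
      ℤ.∣ ℤ.+ d ℤ.* ↥ x ∣                      ≡⟨ cong ℤ.∣_∣ (ℤ→ℚ-injective {ℤ.+ d ℤ.* ↥ x} {n ℤ.* ↧ x ℤ.* ℤ.+ (p ℕ.^ e)} numerators) ⟩
      ℤ.∣ n ℤ.* ↧ x ℤ.* ℤ.+ (p ℕ.^ e) ∣        ≡⟨ ℤ.∣i*j∣≡∣i∣*∣j∣ (n ℤ.* ↧ x) (ℤ.+ (p ℕ.^ e)) ⟩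
      ℤ.∣ n ℤ.* ↧ x ∣ ℕ.* p ℕ.^ e            ∎))
    where
    open ≡-Reasoning
    lemma : ∀ d D P q → d * (D * (P * q)) ≡ d * q * D * P
    lemma = solve-∀ ℚ-ring
    numerators : ℤ→ℚ (ℤ.+ d ℤ.* ↥ x) ≡ ℤ→ℚ (n ℤ.* ↧ x ℤ.* ℤ.+ (p ℕ.^ e))
    numerators = begin
      ℤ→ℚ (ℤ.+ d ℤ.* ↥ x)                       ≡⟨ ℤ→ℚ-* (ℤ.+ d) (↥ x) ⟩
      ℕ→ℚ d * ℤ→ℚ (↥ x)                       ≡⟨ cong (ℕ→ℚ d *_) (↧*x≡↥ x) ⟨
      ℕ→ℚ d * (ℤ→ℚ (↧ x) * x)                 ≡⟨ cong (λ y → ℕ→ℚ d * (ℤ→ℚ (↧ x) * y)) x≡ ⟩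
      ℕ→ℚ d * (ℤ→ℚ (↧ x) * (P ^ℚ e * q))      ≡⟨ lemma (ℕ→ℚ d) (ℤ→ℚ (↧ x)) (P ^ℚ e) q ⟩
      ℕ→ℚ d * q * ℤ→ℚ (↧ x) * P ^ℚ e          ≡⟨ cong₂ (λ y z → y * ℤ→ℚ (↧ x) * z) dq≡n (sym (ℕ→ℚ-^ p e)) ⟩
      ℤ→ℚ n * ℤ→ℚ (↧ x) * ℕ→ℚ (p ℕ.^ e)       ≡⟨ cong (_* ℕ→ℚ (p ℕ.^ e)) (ℤ→ℚ-* n (↧ x)) ⟨
      ℤ→ℚ (n ℤ.* ↧ x) * ℕ→ℚ (p ℕ.^ e)         ≡⟨ ℤ→ℚ-* (n ℤ.* ↧ x) (ℤ.+ (p ℕ.^ e)) ⟨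
      ℤ→ℚ (n ℤ.* ↧ x ℤ.* ℤ.+ (p ℕ.^ e))         ∎

  ≈⇒modℚ : ∀ x y e → x ≈ y [ e ] → x ≡ y [modℚ p ^ e ]
  ≈⇒modℚ x y e (∈⇒≈ x-y∈) = ∈⇒∣↥ {x - y} {e} x-y∈

  1∉𝔭 : ¬ (1ℚ ∈𝔭^ 1)
  1∉𝔭 1∈ = p∤1 (subst (_∣ 1) (ℕ.*-identityʳ p) (∈⇒∣↥ 1∈))

  ℤ-unit : ∀ {z} → ¬ (p ∣ ℤ.∣ z ∣) → Unit (ℤ→ℚ z)
  ℤ-unit {ℤ.+ n} p∤n = ℕ-unit p∤n
  ℤ-unit { -[1+ n ]} p∤n with ℕ-unit p∤n
  ... | unit y y-int eq = unit (- y) (-ᴵ y-int) (trans (cong (_* - y) (lemma₁ (suc n))) (trans (lemma₂ (ℕ→ℚ (suc n)) y) eq))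
    where
    lemma₁ : ∀ n → ℤ→ℚ (ℤ.- (ℤ.+ n)) ≡ - ℕ→ℚ n
    lemma₁ n = sym (ℤ→ℚ-neg (ℤ.+ n))
    lemma₂ : ∀ x y → - x * - y ≡ x * y
    lemma₂ = solve-∀ ℚ-ring

  -- If `p` divided the numerator of `v`, then `v`, hence `u`, hence 1 = `w * u` would be divisible
  -- by p.
  unit-≈ : ∀ {u v} → Unit u → Integral v → v ≈ u [ 1 ] → Unit v
  unit-≈ {u} {v} (unit w w-int uw≡1) (integral n d p∤d dv≡n) v≈u with p ℕ∣.∣? ℤ.∣ n ∣
  ... | yes p∣n = contradiction (∈-resp (trans (ℚ.*-comm w u) uw≡1) (w-int ·∈ ∈-≈ (≈-sym v≈u) v∈)) 1∉𝔭
    where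
    v∈ : v ∈𝔭^ 1
    v∈ with ℤ±.∣ᵤ⇒∣ {ℤ.+ p} {n} p∣n
    ... | ℤ±.divides n′ n≡ = ∈-cancel (ℕ-unit p∤d) (multiple (ℤ→ℚ n′) (ℤ-int n′) (begin
      ℕ→ℚ d * v             ≡⟨ dv≡n ⟩
      ℤ→ℚ n                 ≡⟨ cong ℤ→ℚ n≡ ⟩
      ℤ→ℚ (n′ ℤ.* ℤ.+ p)      ≡⟨ ℤ→ℚ-* n′ (ℤ.+ p) ⟩
      ℤ→ℚ n′ * P            ≡⟨ ℚ.*-comm _ P ⟩
      P * ℤ→ℚ n′            ≡⟨ cong (_* ℤ→ℚ n′) (ℚ.*-identityʳ P) ⟨
      P ^ℚ 1 * ℤ→ℚ n′       ∎))
      where open ≡-Reasoning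
  ... | no p∤n with ℤ-unit {n} p∤n
  ...   | unit y y-int ny≡1 = unit (ℕ→ℚ d * y) (ℕ-int d *ᴵ y-int) (begin
    v * (ℕ→ℚ d * y)   ≡⟨ lemma v (ℕ→ℚ d) y ⟩
    ℕ→ℚ d * v * y     ≡⟨ cong (_* y) dv≡n ⟩
    ℤ→ℚ n * y         ≡⟨ ny≡1 ⟩
    1ℚ                ∎)
    where
    open ≡-Reasoning
    lemma : ∀ a b c → a * (b * c) ≡ b * a * c
    lemma = solve-∀ ℚ-ring

-- Finite sums over 1, ..., n: telescoping, reversal and pairing

Σ₁ : ℕ → (ℕ → ℚ) → ℚ
Σ₁ zero    f = 0ℚ
Σ₁ (suc n) f = Σ₁ n f + f (suc n)

_∈[1,_] : ℕ → ℕ → Set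
k ∈[1, n ] = 1 ≤ k × k ≤ n

+-interchange : ∀ a b c d → (a + b) + (c + d) ≡ (a + c) + (b + d)
+-interchange = solve-∀ ℚ-ring

Σ₁-cong : ∀ n {f g} → (∀ k → k ∈[1, n ] → f k ≡ g k) → Σ₁ n f ≡ Σ₁ n g
Σ₁-cong zero    f≡g = refl
Σ₁-cong (suc n) f≡g = cong₂ _+_ (Σ₁-cong n (λ { k (1≤k , k≤n) → f≡g k (1≤k , ℕ.m≤n⇒m≤1+n k≤n) })) (f≡g (suc n) (s≤s z≤n , ℕ.≤-refl))

Σ₁-+ : ∀ n f g → Σ₁ n (λ k → f k + g k) ≡ Σ₁ n f + Σ₁ n g
Σ₁-+ zero    f g = refl
Σ₁-+ (suc n) f g = trans (cong (_+ (f (suc n) + g (suc n))) (Σ₁-+ n f g)) (+-interchange (Σ₁ n f) (Σ₁ n g) (f (suc n)) (g (suc n)))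

Σ₁-* : ∀ n c f → Σ₁ n (λ k → c * f k) ≡ c * Σ₁ n f
Σ₁-* zero    c f = sym (ℚ.*-zeroʳ c)
Σ₁-* (suc n) c f = trans (cong (_+ c * f (suc n)) (Σ₁-* n c f)) (sym (ℚ.*-distribˡ-+ c (Σ₁ n f) (f (suc n))))

Σ₁-- : ∀ n f g → Σ₁ n (λ k → f k - g k) ≡ Σ₁ n f - Σ₁ n g
Σ₁-- zero    f g = refl
Σ₁-- (suc n) f g = trans (cong (_+ (f (suc n) - g (suc n))) (Σ₁-- n f g)) (lemma (Σ₁ n f) (Σ₁ n g) (f (suc n)) (g (suc n)))
  where
  lemma : ∀ a b c d → (a - b) + (c - d) ≡ (a + c) - (b + d)
  lemma = solve-∀ ℚ-ring

Σ₁-zero : ∀ n {f} → (∀ k → k ∈[1, n ] → f k ≡ 0ℚ) → Σ₁ n f ≡ 0ℚ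
Σ₁-zero zero    f≡0 = refl
Σ₁-zero (suc n) f≡0 = cong₂ _+_ (Σ₁-zero n λ { k (1≤k , k≤n) → f≡0 k (1≤k , ℕ.m≤n⇒m≤1+n k≤n) }) (f≡0 (suc n) (s≤s z≤n , ℕ.≤-refl))

Σ₁-linear : ∀ n a b c f g h → Σ₁ n (λ k → a * f k + b * g k + c * h k) ≡ a * Σ₁ n f + b * Σ₁ n g + c * Σ₁ n h
Σ₁-linear n a b c f g h =
  trans (Σ₁-+ n (λ k → a * f k + b * g k) (λ k → c * h k))
    (cong₂ _+_ (trans (Σ₁-+ n (λ k → a * f k) (λ k → b * g k)) (cong₂ _+_ (Σ₁-* n a f) (Σ₁-* n b g))) (Σ₁-* n c h))

Σ₁-first : ∀ n f → Σ₁ (suc n) f ≡ f 1 + Σ₁ n (f ∘ suc)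
Σ₁-first zero    f = ℚ.+-comm 0ℚ (f 1)
Σ₁-first (suc n) f = trans (cong (_+ f (suc (suc n))) (Σ₁-first n f)) (ℚ.+-assoc (f 1) (Σ₁ n (f ∘ suc)) (f (suc (suc n))))

Σ₁-telescope : ∀ n (f : ℕ → ℚ) → Σ₁ n (λ k → f k - f (ℕ.pred k)) ≡ f n - f 0
Σ₁-telescope zero    f = sym (ℚ.+-inverseʳ (f 0))
Σ₁-telescope (suc n) f = trans (cong (_+ (f (suc n) - f n)) (Σ₁-telescope n f)) (lemma (f n) (f 0) (f (suc n)))
  where
  lemma : ∀ a b c → (a - b) + (c - a) ≡ c - b
  lemma = solve-∀ ℚ-ring

Σ₁-reverse : ∀ n f → Σ₁ n f ≡ Σ₁ n (λ k → f (suc n ℕ.∸ k))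
Σ₁-reverse zero    f = refl
Σ₁-reverse (suc n) f = begin
  Σ₁ n f + f (suc n)                          ≡⟨ cong (_+ f (suc n)) (Σ₁-reverse n f) ⟩
  Σ₁ n (λ k → f (suc n ℕ.∸ k)) + f (suc n)    ≡⟨ ℚ.+-comm _ (f (suc n)) ⟩
  f (suc n) + Σ₁ n (λ k → f (suc n ℕ.∸ k))    ≡⟨ Σ₁-first n (λ k → f (suc (suc n) ℕ.∸ k)) ⟨
  Σ₁ (suc n) (λ k → f (suc (suc n) ℕ.∸ k))    ∎
  where open ≡-Reasoning

Σ₁-append : ∀ m n f → Σ₁ (m ℕ.+ n) f ≡ Σ₁ m f + Σ₁ n (λ k → f (m ℕ.+ k))
Σ₁-append m zero    f = trans (cong (λ l → Σ₁ l f) (ℕ.+-identityʳ m)) (sym (ℚ.+-identityʳ (Σ₁ m f)))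
Σ₁-append m (suc n) f = begin
  Σ₁ (m ℕ.+ suc n) f                                           ≡⟨ cong (λ l → Σ₁ l f) (ℕ.+-suc m n) ⟩
  Σ₁ (m ℕ.+ n) f + f (suc (m ℕ.+ n))                           ≡⟨ cong₂ _+_ (Σ₁-append m n f) (cong f (sym (ℕ.+-suc m n))) ⟩
  Σ₁ m f + Σ₁ n (λ k → f (m ℕ.+ k)) + f (m ℕ.+ suc n)          ≡⟨ ℚ.+-assoc (Σ₁ m f) _ _ ⟩
  Σ₁ m f + (Σ₁ n (λ k → f (m ℕ.+ k)) + f (m ℕ.+ suc n))        ∎
  where open ≡-Reasoning

-- With p = 2m+1 these are the pairs {k, p-k} for k ≤ m, each met once.
Σ₁-fold : ∀ m f → Σ₁ (m ℕ.+ m) f ≡ Σ₁ m (λ k → f k + f (suc (m ℕ.+ m) ℕ.∸ k))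
Σ₁-fold m f = begin
  Σ₁ (m ℕ.+ m) f                                                     ≡⟨ Σ₁-append m m f ⟩
  Σ₁ m f + Σ₁ m (λ k → f (m ℕ.+ k))                                  ≡⟨ cong (Σ₁ m f +_) (Σ₁-reverse m (λ k → f (m ℕ.+ k))) ⟩
  Σ₁ m f + Σ₁ m (λ k → f (m ℕ.+ (suc m ℕ.∸ k)))                      ≡⟨ cong (Σ₁ m f +_) (Σ₁-cong m index) ⟩
  Σ₁ m f + Σ₁ m (λ k → f (suc (m ℕ.+ m) ℕ.∸ k))                      ≡⟨ Σ₁-+ m f _ ⟨
  Σ₁ m (λ k → f k + f (suc (m ℕ.+ m) ℕ.∸ k))                         ∎
  where
  open ≡-Reasoning
  index : ∀ k → k ∈[1, m ] → f (m ℕ.+ (suc m ℕ.∸ k)) ≡ f (suc (m ℕ.+ m) ℕ.∸ k)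
  index k (_ , k≤m) = cong f (trans (sym (ℕ.+-∸-assoc m (ℕ.m≤n⇒m≤1+n k≤m))) (cong (ℕ._∸ k) (ℕ.+-suc m m)))

Σ₁-even-odd : ∀ m f → Σ₁ (m ℕ.+ m) f ≡ Σ₁ m (λ k → f (k ℕ.+ k) + f (ℕ.pred (k ℕ.+ k)))
Σ₁-even-odd zero    f = refl
Σ₁-even-odd (suc m) f = begin
  Σ₁ (m ℕ.+ suc m) f + f (suc m ℕ.+ suc m)                            ≡⟨ cong (λ l → Σ₁ l f + f (suc m ℕ.+ suc m)) (ℕ.+-suc m m) ⟩
  Σ₁ (m ℕ.+ m) f + f (suc (m ℕ.+ m)) + f (suc m ℕ.+ suc m)            ≡⟨ cong₂ (λ x y → x + y + f (suc m ℕ.+ suc m)) (Σ₁-even-odd m f) (cong f (sym (ℕ.+-suc m m))) ⟩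
  Σ₁ m (λ k → f (k ℕ.+ k) + f (ℕ.pred (k ℕ.+ k))) + f (m ℕ.+ suc m) + f (suc m ℕ.+ suc m)
    ≡⟨ lemma (Σ₁ m (λ k → f (k ℕ.+ k) + f (ℕ.pred (k ℕ.+ k)))) (f (m ℕ.+ suc m)) (f (suc m ℕ.+ suc m)) ⟩
  Σ₁ m (λ k → f (k ℕ.+ k) + f (ℕ.pred (k ℕ.+ k))) + (f (suc m ℕ.+ suc m) + f (m ℕ.+ suc m)) ∎
  where
  open ≡-Reasoning
  lemma : ∀ a b c → a + b + c ≡ a + (c + b)
  lemma = solve-∀ ℚ-ring

-- The same pairs listed by their even member: as 2m+1 is odd, the mirrors of 2, 4, ..., 2m are the
-- odd indices in decreasing order.
Σ₁-fold-even : ∀ m f → Σ₁ (m ℕ.+ m) f ≡ Σ₁ m (λ k → f (k ℕ.+ k) + f (suc (m ℕ.+ m) ℕ.∸ (k ℕ.+ k)))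
Σ₁-fold-even m f = begin
  Σ₁ (m ℕ.+ m) f                                           ≡⟨ Σ₁-even-odd m f ⟩
  Σ₁ m (λ k → f (k ℕ.+ k) + f (ℕ.pred (k ℕ.+ k)))          ≡⟨ Σ₁-+ m (λ k → f (k ℕ.+ k)) _ ⟩
  evens + Σ₁ m (λ k → f (ℕ.pred (k ℕ.+ k)))                ≡⟨ cong (evens +_) (Σ₁-reverse m _) ⟩
  evens + Σ₁ m (λ k → f (ℕ.pred ((suc m ℕ.∸ k) ℕ.+ (suc m ℕ.∸ k))))  ≡⟨ cong (evens +_) (Σ₁-cong m index) ⟩
  evens + Σ₁ m (λ k → f (suc (m ℕ.+ m) ℕ.∸ (k ℕ.+ k)))     ≡⟨ Σ₁-+ m (λ k → f (k ℕ.+ k)) _ ⟨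
  Σ₁ m (λ k → f (k ℕ.+ k) + f (suc (m ℕ.+ m) ℕ.∸ (k ℕ.+ k))) ∎
  where
  open ≡-Reasoning
  evens = Σ₁ m (λ k → f (k ℕ.+ k))
  double : ∀ d j → suc (suc j ℕ.+ d ℕ.+ (suc j ℕ.+ d)) ≡ (d ℕ.+ suc d) ℕ.+ (suc j ℕ.+ suc j)
  double = solveℕ-∀
  index : ∀ k → k ∈[1, m ] → f (ℕ.pred ((suc m ℕ.∸ k) ℕ.+ (suc m ℕ.∸ k))) ≡ f (suc (m ℕ.+ m) ℕ.∸ (k ℕ.+ k))
  index (suc j) (_ , k≤m) with d , refl ← ℕ.m≤n⇒∃[o]m+o≡n k≤m = cong f (begin
    ℕ.pred ((suc j ℕ.+ d ℕ.∸ j) ℕ.+ (suc j ℕ.+ d ℕ.∸ j)) ≡⟨ cong (λ x → ℕ.pred (x ℕ.+ x)) (trans (cong (ℕ._∸ j) (sym (ℕ.+-suc j d))) (ℕ.m+n∸m≡n j (suc d))) ⟩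
    d ℕ.+ suc d                                           ≡⟨ ℕ.m+n∸n≡m (d ℕ.+ suc d) (suc j ℕ.+ suc j) ⟨
    (d ℕ.+ suc d) ℕ.+ (suc j ℕ.+ suc j) ℕ.∸ (suc j ℕ.+ suc j) ≡⟨ cong (ℕ._∸ (suc j ℕ.+ suc j)) (double d j) ⟨
    suc (suc j ℕ.+ d ℕ.+ (suc j ℕ.+ d)) ℕ.∸ (suc j ℕ.+ suc j) ∎)

Σ<≡Σ₁ : ∀ n f → Σ< (suc n) f ≡ f 0 + Σ₁ n f
Σ<≡Σ₁ n f = cong (f 0 +_) (trans (cong (foldr _+_ 0ℚ) (List.map-applyUpTo suc f n)) (sym (lemma n f)))
  where
  lemma : ∀ n f → Σ₁ n f ≡ foldr _+_ 0ℚ (applyUpTo (f ∘ suc) n)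
  lemma zero    f = refl
  lemma (suc n) f = trans (Σ₁-first n f) (cong (f 1 +_) (lemma n (f ∘ suc)))

module LocalSums (p : ℕ) (p-prime : Prime p) where
  open Localization p p-prime

  Σ₁-int : ∀ n {f} → (∀ k → k ∈[1, n ] → Integral (f k)) → Integral (Σ₁ n f)
  Σ₁-int zero    f-int = ℕ-int 0
  Σ₁-int (suc n) f-int =
    Σ₁-int n (λ { k (1≤k , k≤n) → f-int k (1≤k , ℕ.m≤n⇒m≤1+n k≤n) }) +ᴵ f-int (suc n) (s≤s z≤n , ℕ.≤-refl)

  Σ₁-≈ : ∀ n {f g e} → (∀ k → k ∈[1, n ] → f k ≈ g k [ e ]) → Σ₁ n f ≈ Σ₁ n g [ e ]
  Σ₁-≈ zero    f≈g = ≈-refl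
  Σ₁-≈ (suc n) f≈g =
    +-cong-≈ (Σ₁-≈ n (λ { k (1≤k , k≤n) → f≈g k (1≤k , ℕ.m≤n⇒m≤1+n k≤n) })) (f≈g (suc n) (s≤s z≤n , ℕ.≤-refl))

  ∈-Σ₁ : ∀ n {f e} → (∀ j → j ∈[1, n ] → f j ∈𝔭^ e) → Σ₁ n f ∈𝔭^ e
  ∈-Σ₁ zero    f∈ = 0∈
  ∈-Σ₁ (suc n) f∈ = ∈-Σ₁ n (λ { j (1≤j , j≤n) → f∈ j (1≤j , ℕ.m≤n⇒m≤1+n j≤n) }) +∈ f∈ (suc n) (s≤s z≤n , ℕ.≤-refl)

-- Harmonic sums modulo powers of p

inv inv² inv³ inv⁴ : ℕ → ℚ
inv  zero = 0ℚ
inv  k@(suc _) = 1ℚ ÷' ℕ→ℚ k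
inv² k = inv k * inv k
inv³ k = inv k * inv k * inv k
inv⁴ k = inv k * inv k * inv k * inv k

inv-inverse : ∀ k → 1 ≤ k → ℕ→ℚ k * inv k ≡ 1ℚ
inv-inverse (suc k) _ = ÷'-cancel 1ℚ (ℕ→ℚ-suc≢0 k)

-- The parameter is `m` with p = 2m+1: then p - 1 is literally `m ℕ.+ m`, the form in which sums are
-- folded.
module Harmonic (m : ℕ) (p-prime : Prime (suc (m ℕ.+ m))) (5<p : 5 < suc (m ℕ.+ m)) where

  q p : ℕ
  q = m ℕ.+ m
  p = suc q

  open Localization p p-prime public
  open LocalSums p p-prime public

  p∤small : ∀ k → .{{ℕ.NonZero k}} → k ≤ 5 → ¬ (p ∣ k)
  p∤small k k≤5 = ℕ∣.>⇒∤ (ℕ.≤-<-trans k≤5 5<p)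

  p∤2 : ¬ (p ∣ 2)
  p∤2 = p∤small 2 (ℕ.≤ᵇ⇒≤ 2 5 _)

  p∤3 : ¬ (p ∣ 3)
  p∤3 = p∤small 3 (ℕ.≤ᵇ⇒≤ 3 5 _)

  p∤5 : ¬ (p ∣ 5)
  p∤5 = p∤small 5 (ℕ.≤ᵇ⇒≤ 5 5 _)

  p∤6 : ¬ (p ∣ 6)
  p∤6 = p∤* {2} {3} p∤2 p∤3

  p∤index : ∀ k → k ∈[1, q ] → ¬ (p ∣ k)
  p∤index (suc k) (_ , k≤q) = ℕ∣.>⇒∤ (s≤s k≤q)

  mirror-index : ∀ k → k ∈[1, q ] → (p ℕ.∸ k) ∈[1, q ]
  mirror-index (suc k) (_ , k≤q) = ℕ.m<n⇒0<n∸m k≤q , ℕ.m∸n≤m q k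

  half⊆ : ∀ k → k ∈[1, m ] → k ∈[1, q ]
  half⊆ k (1≤k , k≤m) = 1≤k , ℕ.≤-trans k≤m (ℕ.m≤m+n m m)

  double⊆ : ∀ k → k ∈[1, m ] → (k ℕ.+ k) ∈[1, q ]
  double⊆ k (1≤k , k≤m) = ℕ.≤-trans 1≤k (ℕ.m≤m+n k k) , ℕ.+-mono-≤ k≤m k≤m

  inv-int : ∀ k → k ∈[1, q ] → Integral (inv k)
  inv-int k@(suc _) k∈ = Unit.inverse-int (ℕ-unit (p∤index k k∈))

  inv-mirror : ∀ k → k ∈[1, q ] → inv k + inv (p ℕ.∸ k) ≡ P * inv k * inv (p ℕ.∸ k)
  inv-mirror k k∈@(1≤k , k≤q) = begin
    inv k + inv k′                                              ≡⟨ cong₂ _+_ (ℚ.*-identityʳ (inv k)) (ℚ.*-identityʳ (inv k′)) ⟨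
    inv k * 1ℚ + inv k′ * 1ℚ                                    ≡⟨ cong₂ (λ x y → inv k * x + inv k′ * y) (inv-inverse k′ (proj₁ (mirror-index k k∈))) (inv-inverse k 1≤k) ⟨
    inv k * (ℕ→ℚ k′ * inv k′) + inv k′ * (ℕ→ℚ k * inv k)        ≡⟨ lemma (inv k) (inv k′) (ℕ→ℚ k) (ℕ→ℚ k′) ⟩
    (ℕ→ℚ k + ℕ→ℚ k′) * inv k * inv k′                           ≡⟨ cong (λ x → x * inv k * inv k′) (ℕ→ℚ-+ k k′) ⟨
    ℕ→ℚ (k ℕ.+ k′) * inv k * inv k′                             ≡⟨ cong (λ x → ℕ→ℚ x * inv k * inv k′) (ℕ.m+[n∸m]≡n (ℕ.m≤n⇒m≤1+n k≤q)) ⟩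
    P * inv k * inv k′                                          ∎
    where
    open ≡-Reasoning
    k′ = p ℕ.∸ k
    lemma : ∀ i j a b → i * (b * j) + j * (a * i) ≡ (a + b) * i * j
    lemma = solve-∀ ℚ-ring

  inv-double : ∀ k → 1 ≤ k → inv k ≡ ℕ→ℚ 2 * inv (k ℕ.+ k)
  inv-double k 1≤k = *-cancelˡ-≢0 (k≢0 k 1≤k) (begin
    ℕ→ℚ k * inv k                          ≡⟨ inv-inverse k 1≤k ⟩
    1ℚ                                     ≡⟨ inv-inverse (k ℕ.+ k) (ℕ.≤-trans 1≤k (ℕ.m≤m+n k k)) ⟨
    ℕ→ℚ (k ℕ.+ k) * inv (k ℕ.+ k)          ≡⟨ cong (_* inv (k ℕ.+ k)) (ℕ→ℚ-+ k k) ⟩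
    (ℕ→ℚ k + ℕ→ℚ k) * inv (k ℕ.+ k)        ≡⟨ lemma (ℕ→ℚ k) (inv (k ℕ.+ k)) ⟩
    ℕ→ℚ k * (ℕ→ℚ 2 * inv (k ℕ.+ k))        ∎)
    where
    open ≡-Reasoning
    k≢0 : ∀ k → 1 ≤ k → ℕ→ℚ k ≢ 0ℚ
    k≢0 (suc k) _ = ℕ→ℚ-suc≢0 k
    lemma : ∀ a b → (a + a) * b ≡ a * (ℕ→ℚ 2 * b)
    lemma = solve-∀ ℚ-ring

  -- This is 1/(p-k) = -(1/k)/(1 - p/k) with the geometric series cut off. Multiplying `inv-mirror`
  -- by 1 + p/k + p²/k² + p³/k³ leaves the exact remainder p⁴/(k⁴(p-k)).
  inv-mirror-expand : ∀ k → k ∈[1, q ] →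
    inv k + inv (p ℕ.∸ k) ≈ - P * inv² k + - (P * P) * inv³ k + - (P * P * P) * inv⁴ k [ 4 ]
  inv-mirror-expand k k∈ = ∈⇒≈ (∈-resp (sym (trans (lemma P i j) (trans (cong (λ x → P * (P * (P * (P * 1ℚ))) * (i * i * i * i * j) + (i + j - x) * (1ℚ + P * i + P * P * i * i + P * P * P * i * i * i)) (sym (inv-mirror k k∈))) (lemma′ _ _ (i + j)))))
    (P^∈ 4 *∈ int⇒∈ (i-int *ᴵ i-int *ᴵ i-int *ᴵ i-int *ᴵ inv-int _ (mirror-index k k∈))))
    where
    i = inv k
    j = inv (p ℕ.∸ k)
    i-int = inv-int k k∈
    lemma′ : ∀ a b c → a + (c - c) * b ≡ a
    lemma′ = solve-∀ ℚ-ring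
    lemma : ∀ P i j → (i + j) - (- P * (i * i) + - (P * P) * (i * i * i) + - (P * P * P) * (i * i * i * i))
      ≡ P * (P * (P * (P * 1ℚ))) * (i * i * i * i * j) + (i + j - P * i * j) * (1ℚ + P * i + P * P * i * i + P * P * P * i * i * i)
    lemma = solve-∀ ℚ-ring

  inv-mirror-≈ : ∀ k → k ∈[1, q ] → inv (p ℕ.∸ k) ≈ - inv k [ 1 ]
  inv-mirror-≈ k k∈ = ∈⇒≈ (∈-resp (trans (sym (trans (inv-mirror k k∈) (ℚ.*-assoc P (inv k) (inv (p ℕ.∸ k))))) (lemma (inv k) (inv (p ℕ.∸ k))))
    (P∈ *∈ int⇒∈ (inv-int k k∈ *ᴵ inv-int _ (mirror-index k k∈)))) 
    where
    lemma : ∀ i j → i + j ≡ j - - i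
    lemma = solve-∀ ℚ-ring

  inv⁴-mirror-≈ : ∀ k → k ∈[1, q ] → inv⁴ (p ℕ.∸ k) ≈ inv⁴ k [ 1 ]
  inv⁴-mirror-≈ k k∈ = ≈-trans (*-cong-≈ (j *ᴵ j *ᴵ j) (-ᴵ i) (*-cong-≈ (j *ᴵ j) (-ᴵ i) (*-cong-≈ j (-ᴵ i) j≈ j≈) j≈) j≈) (≈-reflexive (lemma (inv k)))
    where
    i = inv-int k k∈
    j = inv-int _ (mirror-index k k∈)
    j≈ = inv-mirror-≈ k k∈
    lemma : ∀ i → - i * - i * - i * - i ≡ i * i * i * i
    lemma = solve-∀ ℚ-ring

  H h₂ h₃ h₄ : ℚ
  H  = Σ₁ q inv
  h₂ = Σ₁ m inv²
  h₃ = Σ₁ m inv³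
  h₄ = Σ₁ m inv⁴

  h₃-int : Integral h₃
  h₃-int = Σ₁-int m λ k k∈ → let i = inv-int k (half⊆ k k∈) in i *ᴵ i *ᴵ i

  private
    H₄≈2h₄ : Σ₁ q inv⁴ ≈ ℕ→ℚ 2 * h₄ [ 1 ]
    H₄≈2h₄ = ≈-trans (≈-reflexive (Σ₁-fold m inv⁴)) (≈-trans
      (Σ₁-≈ m λ k k∈ → ≈-trans (+-congˡ-≈ (inv⁴ k) (inv⁴-mirror-≈ k (half⊆ k k∈))) (≈-reflexive (lemma (inv⁴ k))))
      (≈-reflexive (Σ₁-* m (ℕ→ℚ 2) inv⁴)))
      where
      lemma : ∀ x → x + x ≡ ℕ→ℚ 2 * x
      lemma = solve-∀ ℚ-ring

    -- Each pair {2k, p-2k} contributes 2/(2k)⁴ modulo p, and 8 · 2/(2k)⁴ = 1/k⁴.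
    8H₄≈h₄ : ℕ→ℚ 8 * Σ₁ q inv⁴ ≈ h₄ [ 1 ]
    8H₄≈h₄ = ≈-trans (≈-reflexive (trans (cong (ℕ→ℚ 8 *_) (Σ₁-fold-even m inv⁴)) (sym (Σ₁-* m (ℕ→ℚ 8) _))))
      (Σ₁-≈ m λ k k∈ → ≈-trans (*-congˡ-≈ (int⇒∈ (ℕ-int 8)) (+-congˡ-≈ (inv⁴ (k ℕ.+ k)) (inv⁴-mirror-≈ (k ℕ.+ k) (double⊆ k k∈))))
        (≈-reflexive (trans (lemma (inv (k ℕ.+ k))) (cong (λ x → x * x * x * x) (sym (inv-double k (proj₁ k∈)))))))
      where
      lemma : ∀ x → ℕ→ℚ 8 * (x * x * x * x + x * x * x * x) ≡ (ℕ→ℚ 2 * x) * (ℕ→ℚ 2 * x) * (ℕ→ℚ 2 * x) * (ℕ→ℚ 2 * x)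
      lemma = solve-∀ ℚ-ring

  -- Eliminating Σ 1/k⁴ over k < p from the two foldings leaves 15 h₄ ≡ 0 (mod p), and 15 is prime
  -- to p.
  h₄∈ : h₄ ∈𝔭^ 1
  h₄∈ = ∈-cancel (ℕ-unit (p∤* {3} {5} p∤3 p∤5)) (∈-resp (lemma (Σ₁ q inv⁴) h₄) (≈⇒∈ 8H₄≈h₄ -∈ (ℕ-int 8 ·∈ ≈⇒∈ H₄≈2h₄)))
    where
    lemma : ∀ H h → (ℕ→ℚ 8 * H - h) - ℕ→ℚ 8 * (H - ℕ→ℚ 2 * h) ≡ ℕ→ℚ 15 * h
    lemma = solve-∀ ℚ-ring

  H₄∈ : Σ₁ q inv⁴ ∈𝔭^ 1
  H₄∈ = ∈-≈ H₄≈2h₄ (ℕ-int 2 ·∈ h₄∈)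

  private
    H≈ : H ≈ - P * h₂ + - (P * P) * h₃ + - (P * P * P) * h₄ [ 4 ]
    H≈ = ≈-trans (≈-reflexive (Σ₁-fold m inv)) (≈-trans
      (Σ₁-≈ m λ k k∈ → inv-mirror-expand k (half⊆ k k∈))
      (≈-reflexive (Σ₁-linear m (- P) (- (P * P)) (- (P * P * P)) inv² inv³ inv⁴)))

    16H≈ : ℕ→ℚ 16 * H ≈ - (ℕ→ℚ 4 * P) * h₂ + - (ℕ→ℚ 2 * (P * P)) * h₃ + - (P * P * P) * h₄ [ 4 ]
    16H≈ = ≈-trans (≈-reflexive (trans (cong (ℕ→ℚ 16 *_) (Σ₁-fold-even m inv)) (sym (Σ₁-* m (ℕ→ℚ 16) _)))) (≈-trans
      (Σ₁-≈ m λ k k∈ → ≈-trans (*-congˡ-≈ (int⇒∈ (ℕ-int 16)) (inv-mirror-expand (k ℕ.+ k) (double⊆ k k∈)))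
        (≈-reflexive (trans (lemma P (inv (k ℕ.+ k)))
          (cong (λ x → - (ℕ→ℚ 4 * P) * (x * x) + - (ℕ→ℚ 2 * (P * P)) * (x * x * x) + - (P * P * P) * (x * x * x * x)) (sym (inv-double k (proj₁ k∈)))))))
      (≈-reflexive (Σ₁-linear m (- (ℕ→ℚ 4 * P)) (- (ℕ→ℚ 2 * (P * P))) (- (P * P * P)) inv² inv³ inv⁴)))
      where
      lemma : ∀ P x → ℕ→ℚ 16 * (- P * (x * x) + - (P * P) * (x * x * x) + - (P * P * P) * (x * x * x * x))
        ≡ - (ℕ→ℚ 4 * P) * ((ℕ→ℚ 2 * x) * (ℕ→ℚ 2 * x)) + - (ℕ→ℚ 2 * (P * P)) * ((ℕ→ℚ 2 * x) * (ℕ→ℚ 2 * x) * (ℕ→ℚ 2 * x))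
          + - (P * P * P) * ((ℕ→ℚ 2 * x) * (ℕ→ℚ 2 * x) * (ℕ→ℚ 2 * x) * (ℕ→ℚ 2 * x))
      lemma = solve-∀ ℚ-ring

  -- Subtracting four times the plain folding from the even one removes h₂: 12H ≡ 2p²h₃ + 3p³h₄ (mod
  -- p⁴), whose last term vanishes because p divides h₄.
  6H≈P²h₃ : ℕ→ℚ 6 * H ≈ P * P * h₃ [ 4 ]
  6H≈P²h₃ = ∈⇒≈ (∈-cancel (ℕ-unit p∤2) (∈-resp (lemma P H h₂ h₃ h₄)
    (≈⇒∈ 16H≈ -∈ (ℕ-int 4 ·∈ ≈⇒∈ H≈) +∈ (ℕ-int 3 ·∈ (P^∈ 3 *∈ h₄∈)))))
    where
    lemma : ∀ P H h₂ h₃ h₄ →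
      (ℕ→ℚ 16 * H - (- (ℕ→ℚ 4 * P) * h₂ + - (ℕ→ℚ 2 * (P * P)) * h₃ + - (P * P * P) * h₄))
      - ℕ→ℚ 4 * (H - (- P * h₂ + - (P * P) * h₃ + - (P * P * P) * h₄))
      + ℕ→ℚ 3 * (P * (P * (P * 1ℚ)) * h₄)
      ≡ ℕ→ℚ 2 * (ℕ→ℚ 6 * H - P * P * h₃)
    lemma = solve-∀ ℚ-ring

  -- This is Wolstenholme's theorem.
  H∈ : H ∈𝔭^ 2
  H∈ = ∈-cancel (ℕ-unit p∤6) (∈-≈ (≈-weaken 2 2 6H≈P²h₃) (∈-resp (cong (_* h₃) (cong (P *_) (ℚ.*-identityʳ P))) (P^∈ 2 *∈ int⇒∈ h₃-int)))

-- Binomial identities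

ℕ→ℚ-pascal : ∀ n k → ℕ→ℚ (suc n C suc k) ≡ ℕ→ℚ (n C k) + ℕ→ℚ (n C suc k)
ℕ→ℚ-pascal n k = trans (cong ℕ→ℚ (sym (nCk+nC[k+1]≡[n+1]C[k+1] n k))) (ℕ→ℚ-+ (n C k) (n C suc k))

ℕ→ℚ-nC[1+n] : ∀ n → ℕ→ℚ (n C suc n) ≡ 0ℚ
ℕ→ℚ-nC[1+n] n = cong ℕ→ℚ (k>n⇒nCk≡0 (ℕ.n<1+n n))

[1+n]Cn≡1+n : ∀ n → suc n C n ≡ suc n
[1+n]Cn≡1+n n = trans (nCk≡nC[n∸k] (ℕ.n≤1+n n)) (trans (cong (suc n C_) (ℕ.m+n∸n≡m 1 n)) (nC1≡n (suc n)))

ℕ→ℚ-absorb : ∀ n k → ℕ→ℚ (suc k) * ℕ→ℚ (suc n C suc k) ≡ ℕ→ℚ (suc n) * ℕ→ℚ (n C k)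
ℕ→ℚ-absorb zero zero = refl
ℕ→ℚ-absorb zero (suc k) = trans (cong (λ x → ℕ→ℚ (suc (suc k)) * ℕ→ℚ x) (k>n⇒nCk≡0 {1} {suc (suc k)} (s≤s (s≤s z≤n))))
  (trans (ℚ.*-zeroʳ (ℕ→ℚ (suc (suc k)))) (sym (cong (λ x → 1ℚ * ℕ→ℚ x) (k>n⇒nCk≡0 {0} {suc k} (s≤s z≤n)))))
ℕ→ℚ-absorb (suc n) zero = begin
  1ℚ * ℕ→ℚ (suc (suc n) C 1)                        ≡⟨ cong (1ℚ *_) (ℕ→ℚ-pascal (suc n) 0) ⟩
  1ℚ * (1ℚ + ℕ→ℚ (suc n C 1))                       ≡⟨ lemma (ℕ→ℚ (suc n C 1)) ⟩
  1ℚ * ℕ→ℚ (suc n C 1) + 1ℚ                         ≡⟨ cong (_+ 1ℚ) (ℕ→ℚ-absorb n 0) ⟩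
  ℕ→ℚ (suc n) * 1ℚ + 1ℚ                             ≡⟨ lemma′ (ℕ→ℚ (suc n)) ⟩
  (ℕ→ℚ (suc n) + 1ℚ) * 1ℚ                           ≡⟨ cong (_* 1ℚ) (ℕ→ℚ-suc (suc n)) ⟨
  ℕ→ℚ (suc (suc n)) * 1ℚ                            ∎
  where
  open ≡-Reasoning
  lemma : ∀ x → 1ℚ * (1ℚ + x) ≡ 1ℚ * x + 1ℚ
  lemma = solve-∀ ℚ-ring
  lemma′ : ∀ x → x * 1ℚ + 1ℚ ≡ (x + 1ℚ) * 1ℚ
  lemma′ = solve-∀ ℚ-ring
ℕ→ℚ-absorb (suc n) (suc k) = begin
  κ * ℕ→ℚ (suc (suc n) C suc (suc k))               ≡⟨ cong₂ _*_ (ℕ→ℚ-suc (suc k)) (ℕ→ℚ-pascal (suc n) (suc k)) ⟩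
  (κ′ + 1ℚ) * (b + c)                               ≡⟨ lemma κ′ b c ⟩
  κ′ * b + b + (κ′ + 1ℚ) * c                        ≡⟨ cong₂ (λ x y → x + b + y) (ℕ→ℚ-absorb n k) (trans (cong (_* c) (sym (ℕ→ℚ-suc (suc k)))) (ℕ→ℚ-absorb n (suc k))) ⟩
  ν * ℕ→ℚ (n C k) + b + ν * ℕ→ℚ (n C suc k)         ≡⟨ lemma′ ν (ℕ→ℚ (n C k)) b (ℕ→ℚ (n C suc k)) ⟩
  ν * (ℕ→ℚ (n C k) + ℕ→ℚ (n C suc k)) + b           ≡⟨ cong (λ x → ν * x + b) (ℕ→ℚ-pascal n k) ⟨
  ν * b + b                                         ≡⟨ lemma″ ν b ⟩
  (ν + 1ℚ) * b                                      ≡⟨ cong (_* b) (ℕ→ℚ-suc (suc n)) ⟨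
  ℕ→ℚ (suc (suc n)) * b                             ∎
  where
  open ≡-Reasoning
  κ = ℕ→ℚ (suc (suc k))
  κ′ = ℕ→ℚ (suc k)
  ν = ℕ→ℚ (suc n)
  b = ℕ→ℚ (suc n C suc k)
  c = ℕ→ℚ (suc n C suc (suc k))
  lemma : ∀ κ b c → (κ + 1ℚ) * (b + c) ≡ κ * b + b + (κ + 1ℚ) * c
  lemma = solve-∀ ℚ-ring
  lemma′ : ∀ ν x b y → ν * x + b + ν * y ≡ ν * (x + y) + b
  lemma′ = solve-∀ ℚ-ring
  lemma″ : ∀ ν b → ν * b + b ≡ (ν + 1ℚ) * b
  lemma″ = solve-∀ ℚ-ring

ℕ→ℚ-absorb-inv : ∀ n k → ℕ→ℚ (suc n C suc k) ≡ ℕ→ℚ (suc n) * inv (suc k) * ℕ→ℚ (n C k)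
ℕ→ℚ-absorb-inv n k = *-cancelˡ-≢0 (ℕ→ℚ-suc≢0 k) (begin
  κ * ℕ→ℚ (suc n C suc k)                         ≡⟨ ℕ→ℚ-absorb n k ⟩
  ℕ→ℚ (suc n) * ℕ→ℚ (n C k)                       ≡⟨ ℚ.*-identityˡ _ ⟨
  1ℚ * (ℕ→ℚ (suc n) * ℕ→ℚ (n C k))                ≡⟨ cong (_* (ℕ→ℚ (suc n) * ℕ→ℚ (n C k))) (inv-inverse (suc k) (s≤s z≤n)) ⟨
  κ * inv (suc k) * (ℕ→ℚ (suc n) * ℕ→ℚ (n C k))   ≡⟨ lemma κ (inv (suc k)) (ℕ→ℚ (suc n)) (ℕ→ℚ (n C k)) ⟩
  κ * (ℕ→ℚ (suc n) * inv (suc k) * ℕ→ℚ (n C k))   ∎)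
  where
  open ≡-Reasoning
  κ = ℕ→ℚ (suc k)
  lemma : ∀ a b c d → a * b * (c * d) ≡ a * (c * b * d)
  lemma = solve-∀ ℚ-ring

-- On exponential generating functions, multiplication by e^t. The term k = 0 stands apart because
-- `Σ₁` starts at 1.
binomialTransform : (ℕ → ℚ) → ℕ → ℚ
binomialTransform c n = c 0 + Σ₁ n (λ k → ℕ→ℚ (n C k) * c k)

-- The product rule (e^t c)′ = e^t c + e^t c′, since differentiation shifts coefficients; in terms
-- of sums it is Pascal's rule.
binomialTransform-suc : ∀ c n →
  binomialTransform c (suc n) ≡ binomialTransform c n + binomialTransform (c ∘ suc) n
binomialTransform-suc c n = begin
  c 0 + Σ₁ (suc n) (λ k → ℕ→ℚ (suc n C k) * c k)
    ≡⟨ cong (c 0 +_) (trans (Σ₁-cong (suc n) pascal) (Σ₁-+ (suc n) (λ k → ℕ→ℚ (n C k) * c k) _)) ⟩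
  c 0 + (Σ₁ (suc n) (λ k → ℕ→ℚ (n C k) * c k) + Σ₁ (suc n) (λ k → ℕ→ℚ (n C ℕ.pred k) * c k))
    ≡⟨ cong₂ (λ x y → c 0 + (x + y)) dropLast (Σ₁-first n _) ⟩
  c 0 + (Σ₁ n (λ k → ℕ→ℚ (n C k) * c k) + (1ℚ * c 1 + Σ₁ n (λ k → ℕ→ℚ (n C k) * c (suc k))))
    ≡⟨ lemma (c 0) (Σ₁ n (λ k → ℕ→ℚ (n C k) * c k)) (c 1) (Σ₁ n (λ k → ℕ→ℚ (n C k) * c (suc k))) ⟩
  (c 0 + Σ₁ n (λ k → ℕ→ℚ (n C k) * c k)) + (c 1 + Σ₁ n (λ k → ℕ→ℚ (n C k) * c (suc k))) ∎
  where
  open ≡-Reasoning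
  pascal : ∀ k → k ∈[1, suc n ] → ℕ→ℚ (suc n C k) * c k ≡ ℕ→ℚ (n C k) * c k + ℕ→ℚ (n C ℕ.pred k) * c k
  pascal (suc k) _ = trans (cong (_* c (suc k)) (ℕ→ℚ-pascal n k)) (distrib (ℕ→ℚ (n C k)) (ℕ→ℚ (n C suc k)) (c (suc k)))
    where
    distrib : ∀ x y z → (x + y) * z ≡ y * z + x * z
    distrib = solve-∀ ℚ-ring
  dropLast : Σ₁ (suc n) (λ k → ℕ→ℚ (n C k) * c k) ≡ Σ₁ n (λ k → ℕ→ℚ (n C k) * c k)
  dropLast = trans (cong (λ x → Σ₁ n (λ k → ℕ→ℚ (n C k) * c k) + x * c (suc n)) (ℕ→ℚ-nC[1+n] n))
    (lemma₀ (Σ₁ n (λ k → ℕ→ℚ (n C k) * c k)) (c (suc n)))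
    where
    lemma₀ : ∀ x y → x + 0ℚ * y ≡ x
    lemma₀ = solve-∀ ℚ-ring
  lemma : ∀ a b c d → a + (b + (1ℚ * c + d)) ≡ (a + b) + (c + d)
  lemma = solve-∀ ℚ-ring

binomialTransform-cong : ∀ {c d} n → (∀ k → c k ≡ d k) → binomialTransform c n ≡ binomialTransform d n
binomialTransform-cong n c≡d = cong₂ _+_ (c≡d 0) (Σ₁-cong n λ k _ → cong (ℕ→ℚ (n C k) *_) (c≡d k))

-- The shift `s` serves the induction on `n`: Pascal's rule splits the sum into the cases `s` and
-- `s + 1`. The application has s = 0 and x = n = p.
vandermonde : ∀ x s n → binomialTransform (λ k → ℕ→ℚ (x C (s ℕ.+ k))) n ≡ ℕ→ℚ ((x ℕ.+ n) C (s ℕ.+ n))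
vandermonde x s zero = trans (ℚ.+-identityʳ _) (cong (λ y → ℕ→ℚ (y C (s ℕ.+ 0))) (sym (ℕ.+-identityʳ x)))
vandermonde x s (suc n) = begin
  binomialTransform c (suc n)                                          ≡⟨ binomialTransform-suc c n ⟩
  binomialTransform c n + binomialTransform (c ∘ suc) n                ≡⟨ cong₂ _+_ (vandermonde x s n) (trans (binomialTransform-cong n (λ k → cong (λ y → ℕ→ℚ (x C y)) (ℕ.+-suc s k))) (vandermonde x (suc s) n)) ⟩
  ℕ→ℚ ((x ℕ.+ n) C (s ℕ.+ n)) + ℕ→ℚ ((x ℕ.+ n) C suc (s ℕ.+ n))        ≡⟨ ℕ→ℚ-pascal (x ℕ.+ n) (s ℕ.+ n) ⟨
  ℕ→ℚ (suc (x ℕ.+ n) C suc (s ℕ.+ n))                                  ≡⟨ cong₂ (λ y z → ℕ→ℚ (y C z)) (ℕ.+-suc x n) (ℕ.+-suc s n) ⟨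
  ℕ→ℚ ((x ℕ.+ suc n) C (s ℕ.+ suc n))                                  ∎
  where
  open ≡-Reasoning
  c = λ k → ℕ→ℚ (x C (s ℕ.+ k))

sgn : ℕ → ℚ
sgn k = (- 1ℚ) ^ℚ k

-- By Pascal's rule the summand is a difference of consecutive values of -(-1)ᵏ C(n,k), which is -1
-- at k = 0 and 0 at k = n+1.
Σ-alternating-binomial : ∀ n → Σ₁ (suc n) (λ k → sgn (ℕ.pred k) * ℕ→ℚ (suc n C k)) ≡ 1ℚ
Σ-alternating-binomial n = begin
  Σ₁ (suc n) (λ k → sgn (ℕ.pred k) * ℕ→ℚ (suc n C k))   ≡⟨ Σ₁-cong (suc n) difference ⟩
  Σ₁ (suc n) (λ k → v k - v (ℕ.pred k))                 ≡⟨ Σ₁-telescope (suc n) v ⟩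
  - sgn (suc n) * ℕ→ℚ (n C suc n) - (- 1ℚ * 1ℚ)         ≡⟨ cong (λ x → - sgn (suc n) * x - (- 1ℚ * 1ℚ)) (ℕ→ℚ-nC[1+n] n) ⟩
  - sgn (suc n) * 0ℚ - (- 1ℚ * 1ℚ)                      ≡⟨ cong (_- (- 1ℚ * 1ℚ)) (ℚ.*-zeroʳ (- sgn (suc n))) ⟩
  1ℚ                                                    ∎
  where
  open ≡-Reasoning
  v : ℕ → ℚ
  v k = - sgn k * ℕ→ℚ (n C k)
  lemma : ∀ s x y → s * (x + y) ≡ - (- 1ℚ * s) * y - (- s * x)
  lemma = solve-∀ ℚ-ring
  difference : ∀ k → k ∈[1, suc n ] → sgn (ℕ.pred k) * ℕ→ℚ (suc n C k) ≡ v k - v (ℕ.pred k)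
  difference (suc k) _ = trans (cong (sgn k *_) (ℕ→ℚ-pascal n k)) (lemma (sgn k) (ℕ→ℚ (n C k)) (ℕ→ℚ (n C suc k)))

-- Passing from n to n+1 adds Σ (-1)ᵏ⁻¹ C(n,k-1)/k. Since C(n,k-1)/k = C(n+1,k)/(n+1), this is
-- 1/(n+1) times the preceding alternating sum, which is 1.
Σ-alternating-binomial/k : ∀ n → Σ₁ n (λ k → sgn (ℕ.pred k) * ℕ→ℚ (n C k) * inv k) ≡ Σ₁ n inv
Σ-alternating-binomial/k zero = refl
Σ-alternating-binomial/k (suc n) = begin
  Σ₁ (suc n) (λ k → sgn (ℕ.pred k) * ℕ→ℚ (suc n C k) * inv k)
    ≡⟨ trans (Σ₁-cong (suc n) split) (Σ₁-+ (suc n) f _) ⟩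
  Σ₁ (suc n) f + Σ₁ (suc n) (λ k → inv (suc n) * (sgn (ℕ.pred k) * ℕ→ℚ (suc n C k)))
    ≡⟨ cong₂ _+_ dropLast (trans (Σ₁-* (suc n) (inv (suc n)) _) (cong (inv (suc n) *_) (Σ-alternating-binomial n))) ⟩
  Σ₁ n f + inv (suc n) * 1ℚ
    ≡⟨ cong₂ _+_ (Σ-alternating-binomial/k n) (ℚ.*-identityʳ (inv (suc n))) ⟩
  Σ₁ n inv + inv (suc n) ∎
  where
  open ≡-Reasoning
  f : ℕ → ℚ
  f k = sgn (ℕ.pred k) * ℕ→ℚ (n C k) * inv k
  dropLast : Σ₁ (suc n) f ≡ Σ₁ n f
  dropLast = trans (cong (λ x → Σ₁ n f + sgn n * x * inv (suc n)) (ℕ→ℚ-nC[1+n] n)) (lemma₀ (Σ₁ n f) (sgn n) (inv (suc n)))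
    where
    lemma₀ : ∀ x y z → x + y * 0ℚ * z ≡ x
    lemma₀ = solve-∀ ℚ-ring
  lemma : ∀ s x y i j ν → s * (x + y) * i + s * x * i * (j * ν - 1ℚ) ≡ s * y * i + j * (s * (ν * i * x))
  lemma = solve-∀ ℚ-ring
  split : ∀ k → k ∈[1, suc n ] → sgn (ℕ.pred k) * ℕ→ℚ (suc n C k) * inv k ≡ f k + inv (suc n) * (sgn (ℕ.pred k) * ℕ→ℚ (suc n C k))
  split (suc k) _ = begin
    s * ℕ→ℚ (suc n C suc k) * i          ≡⟨ cong (λ z → s * z * i) (ℕ→ℚ-pascal n k) ⟩
    s * (x + y) * i                      ≡⟨ lemma₁ (s * (x + y) * i) (s * x * i) ⟩
    s * (x + y) * i + s * x * i * (1ℚ - 1ℚ)     ≡⟨ cong (λ z → s * (x + y) * i + s * x * i * (z - 1ℚ)) (trans (ℚ.*-comm j ν) (inv-inverse (suc n) (s≤s z≤n))) ⟨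
    s * (x + y) * i + s * x * i * (j * ν - 1ℚ)  ≡⟨ lemma s x y i j ν ⟩
    s * y * i + j * (s * (ν * i * x))    ≡⟨ cong (λ z → s * y * i + j * (s * z)) (ℕ→ℚ-absorb-inv n k) ⟨
    s * y * i + j * (s * ℕ→ℚ (suc n C suc k)) ∎
    where
    s = sgn k
    x = ℕ→ℚ (n C k)
    y = ℕ→ℚ (n C suc k)
    i = inv (suc k)
    j = inv (suc n)
    ν = ℕ→ℚ (suc n)
    lemma₁ : ∀ x y → x ≡ x + y * (1ℚ - 1ℚ)
    lemma₁ = solve-∀ ℚ-ring

-- Powers with integer exponents

-- The downward step starts from a + 1, so the one recursion x^(a+1) = x · x^a with x invertible
-- serves both directions.
ℤ-induction : (Q : ℤ → Set) → Q ℤ.0ℤ → (∀ a → Q a → Q (ℤ.suc a)) → (∀ a → Q (ℤ.suc a) → Q a) → ∀ a → Q a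
ℤ-induction Q base up down (ℤ.+ zero)       = base
ℤ-induction Q base up down (ℤ.+ suc n)      = up (ℤ.+ n) (ℤ-induction Q base up down (ℤ.+ n))
ℤ-induction Q base up down -[1+ zero ]      = down -[1+ zero ] base
ℤ-induction Q base up down -[1+ suc n ]     = down -[1+ suc n ] (ℤ-induction Q base up down -[1+ n ])

ℤ→ℚ-suc : ∀ a → ℤ→ℚ (ℤ.suc a) ≡ ℤ→ℚ a + 1ℚ
ℤ→ℚ-suc a = trans (ℤ→ℚ-+ ℤ.1ℤ a) (ℚ.+-comm 1ℚ (ℤ→ℚ a))

^ℚ-≢0 : ∀ {x} → x ≢ 0ℚ → ∀ n → x ^ℚ n ≢ 0ℚ
^ℚ-≢0 x≢0 zero    ()
^ℚ-≢0 x≢0 (suc n) = ≢0-* x≢0 (^ℚ-≢0 x≢0 n)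

^ℤ-suc : ∀ {x} → x ≢ 0ℚ → ∀ a → x ^ℤ ℤ.suc a ≡ x * (x ^ℤ a)
^ℤ-suc     x≢0 (ℤ.+ n)      = refl
^ℤ-suc {x} x≢0 -[1+ zero ]  = sym (trans (cong (_* (1ℚ ÷' (x * 1ℚ))) (sym (ℚ.*-identityʳ x))) (÷'-cancel 1ℚ (^ℚ-≢0 x≢0 1)))
^ℤ-suc {x} x≢0 -[1+ suc n ] = *-cancelˡ-≢0 (^ℚ-≢0 x≢0 (suc n)) (begin
  x ^ℚ suc n * (1ℚ ÷' (x ^ℚ suc n))              ≡⟨ ÷'-cancel 1ℚ (^ℚ-≢0 x≢0 (suc n)) ⟩
  1ℚ                                             ≡⟨ ÷'-cancel 1ℚ (^ℚ-≢0 x≢0 (suc (suc n))) ⟨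
  x ^ℚ suc (suc n) * (1ℚ ÷' (x ^ℚ suc (suc n)))  ≡⟨ lemma x (x ^ℚ suc n) (1ℚ ÷' (x ^ℚ suc (suc n))) ⟩
  x ^ℚ suc n * (x * (1ℚ ÷' (x ^ℚ suc (suc n))))  ∎)
  where
  open ≡-Reasoning
  lemma : ∀ x y z → x * y * z ≡ y * (x * z)
  lemma = solve-∀ ℚ-ring

-- The value at 0 and the recursion characterise a ↦ xᵃ, so a power law follows once its other side
-- is seen to satisfy both.
^ℤ-unique : ∀ {x} → x ≢ 0ℚ → (f : ℤ → ℚ) → f ℤ.0ℤ ≡ 1ℚ → (∀ a → f (ℤ.suc a) ≡ x * f a) → ∀ a → f a ≡ x ^ℤ a
^ℤ-unique {x} x≢0 f f0 f-suc = ℤ-induction (λ a → f a ≡ x ^ℤ a) f0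
  (λ a eq → trans (f-suc a) (trans (cong (x *_) eq) (sym (^ℤ-suc x≢0 a))))
  (λ a eq → *-cancelˡ-≢0 x≢0 (trans (sym (f-suc a)) (trans eq (^ℤ-suc x≢0 a))))

^ℤ-distrib-* : ∀ {x y} → x ≢ 0ℚ → y ≢ 0ℚ → ∀ a → (x * y) ^ℤ a ≡ x ^ℤ a * y ^ℤ a
^ℤ-distrib-* {x} {y} x≢0 y≢0 a = sym (^ℤ-unique (≢0-* x≢0 y≢0) (λ b → x ^ℤ b * y ^ℤ b) refl
  (λ b → trans (cong₂ _*_ (^ℤ-suc x≢0 b) (^ℤ-suc y≢0 b)) (interchange x (x ^ℤ b) y (y ^ℤ b))) a)
  where
  interchange : ∀ a b c d → (a * b) * (c * d) ≡ (a * c) * (b * d)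
  interchange = solve-∀ ℚ-ring

^ℤ-+ : ∀ {x} → x ≢ 0ℚ → ∀ a n → x ^ℤ (a ℤ.+ ℤ.+ n) ≡ x ^ℚ n * x ^ℤ a
^ℤ-+ {x} x≢0 a zero    = trans (cong (x ^ℤ_) (ℤ.+-identityʳ a)) (sym (ℚ.*-identityˡ (x ^ℤ a)))
^ℤ-+ {x} x≢0 a (suc n) = begin
  x ^ℤ (a ℤ.+ ℤ.+ suc n)         ≡⟨ cong (x ^ℤ_) (trans (ℤ.+-comm a (ℤ.+ suc n)) (trans (ℤ.+-assoc ℤ.1ℤ (ℤ.+ n) a) (cong ℤ.suc (ℤ.+-comm (ℤ.+ n) a)))) ⟩
  x ^ℤ ℤ.suc (a ℤ.+ ℤ.+ n)       ≡⟨ ^ℤ-suc x≢0 (a ℤ.+ ℤ.+ n) ⟩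
  x * x ^ℤ (a ℤ.+ ℤ.+ n)         ≡⟨ cong (x *_) (^ℤ-+ x≢0 a n) ⟩
  x * (x ^ℚ n * x ^ℤ a)          ≡⟨ ℚ.*-assoc x (x ^ℚ n) (x ^ℤ a) ⟨
  x * x ^ℚ n * x ^ℤ a            ∎
  where open ≡-Reasoning

^ℤ-* : ∀ {x} → x ≢ 0ℚ → ∀ a n → x ^ℤ (a ℤ.* ℤ.+ n) ≡ (x ^ℚ n) ^ℤ a
^ℤ-* {x} x≢0 a n = ^ℤ-unique (^ℚ-≢0 x≢0 n) (λ b → x ^ℤ (b ℤ.* ℤ.+ n)) refl
  (λ b → trans (cong (x ^ℤ_) (trans (ℤ.suc-* b (ℤ.+ n)) (ℤ.+-comm (ℤ.+ n) (b ℤ.* ℤ.+ n)))) (^ℤ-+ x≢0 (b ℤ.* ℤ.+ n) n)) a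

sgn-* : ∀ k → sgn k * sgn k ≡ 1ℚ
sgn-* zero    = refl
sgn-* (suc k) = trans (lemma (sgn k)) (sgn-* k)
  where
  lemma : ∀ s → (- 1ℚ * s) * (- 1ℚ * s) ≡ s * s
  lemma = solve-∀ ℚ-ring

sgn-+ : ∀ j k → sgn (j ℕ.+ k) ≡ sgn j * sgn k
sgn-+ j k = ^ℚ-+ (- 1ℚ) j k

½ ⅓ ¼ ⅕ : ℚ
½ = ℤ.1ℤ ℚ./ 2
⅓ = ℤ.1ℤ ℚ./ 3
¼ = ℤ.1ℤ ℚ./ 4
⅕ = ℤ.1ℤ ℚ./ 5

-- Generalised binomial coefficients C(a,i). The factor 1/i! is a product of ½, ⅓, ¼, ⅕ so that
-- `p`-integrality is read off factor by factor.
C₂ C₃ C₄ C₅ : ℚ → ℚ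
C₂ a = ½ * a * (a - 1ℚ)
C₃ a = ½ * ⅓ * a * (a - 1ℚ) * (a - ℕ→ℚ 2)
C₄ a = ½ * ⅓ * ¼ * a * (a - 1ℚ) * (a - ℕ→ℚ 2) * (a - ℕ→ℚ 3)
C₅ a = ½ * ⅓ * ¼ * ⅕ * a * (a - 1ℚ) * (a - ℕ→ℚ 2) * (a - ℕ→ℚ 3) * (a - ℕ→ℚ 4)

truncated₂ truncated₃ truncated₆ : ℚ → ℚ → ℚ
truncated₂ y a = 1ℚ + a * y
truncated₃ y a = 1ℚ + a * y + C₂ a * y * y
truncated₆ y a = 1ℚ + a * y + C₂ a * y * y + C₃ a * y * y * y + C₄ a * y * y * y * y + C₅ a * y * y * y * y * y

module Powers (m : ℕ) (p-prime : Prime (suc (m ℕ.+ m))) (5<p : 5 < suc (m ℕ.+ m)) where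
  open Harmonic m p-prime 5<p public

  ½-int : Integral ½
  ½-int = integral ℤ.1ℤ 2 p∤2 refl

  ⅓-int : Integral ⅓
  ⅓-int = integral ℤ.1ℤ 3 p∤3 refl

  ¼-int : Integral ¼
  ¼-int = integral ℤ.1ℤ 4 (p∤* {2} {2} p∤2 p∤2) refl

  ⅕-int : Integral ⅕
  ⅕-int = integral ℤ.1ℤ 5 p∤5 refl

  C₂-int : ∀ {a} → Integral a → Integral (C₂ a)
  C₂-int a = ½-int *ᴵ a *ᴵ (a -ᴵ ℕ-int 1)

  C₃-int : ∀ {a} → Integral a → Integral (C₃ a)
  C₃-int a = ½-int *ᴵ ⅓-int *ᴵ a *ᴵ (a -ᴵ ℕ-int 1) *ᴵ (a -ᴵ ℕ-int 2)

  C₄-int : ∀ {a} → Integral a → Integral (C₄ a)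
  C₄-int a = ½-int *ᴵ ⅓-int *ᴵ ¼-int *ᴵ a *ᴵ (a -ᴵ ℕ-int 1) *ᴵ (a -ᴵ ℕ-int 2) *ᴵ (a -ᴵ ℕ-int 3)

  C₅-int : ∀ {a} → Integral a → Integral (C₅ a)
  C₅-int a = ½-int *ᴵ ⅓-int *ᴵ ¼-int *ᴵ ⅕-int *ᴵ a *ᴵ (a -ᴵ ℕ-int 1) *ᴵ (a -ᴵ ℕ-int 2) *ᴵ (a -ᴵ ℕ-int 3) *ᴵ (a -ᴵ ℕ-int 4)

  unit⇒≢0 : ∀ {x} → Unit x → x ≢ 0ℚ
  unit⇒≢0 (unit y _ xy≡1) refl with () ← trans (sym (ℚ.*-zeroˡ y)) xy≡1

  1-unit : Unit 1ℚ
  1-unit = unit 1ℚ (ℕ-int 1) refl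

  1+∈-unit : ∀ {y} → y ∈𝔭^ 1 → Unit (1ℚ + y)
  1+∈-unit {y} y∈ = unit-≈ 1-unit (ℕ-int 1 +ᴵ ∈⇒int y∈) (∈⇒≈ (∈-resp (lemma y) y∈))
    where
    lemma : ∀ y → y ≡ (1ℚ + y) - 1ℚ
    lemma = solve-∀ ℚ-ring

  *-unit : ∀ {x y} → Unit x → Unit y → Unit (x * y)
  *-unit {x} {y} (unit u u-int xu≡1) (unit v v-int yv≡1) =
    unit (u * v) (u-int *ᴵ v-int) (trans (lemma x y u v) (cong₂ _*_ xu≡1 yv≡1))
    where
    lemma : ∀ x y u v → (x * y) * (u * v) ≡ (x * u) * (y * v)
    lemma = solve-∀ ℚ-ring

  unit-int : ∀ {x} → Unit x → Integral x → ∀ a → Integral (x ^ℤ a)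
  unit-int {x} x-unit@(unit y y-int xy≡1) x-int = ℤ-induction (λ a → Integral (x ^ℤ a)) (ℕ-int 1)
    (λ a i → subst Integral (sym (^ℤ-suc (unit⇒≢0 x-unit) a)) (x-int *ᴵ i))
    (λ a i → subst Integral (trans (cong (y *_) (^ℤ-suc (unit⇒≢0 x-unit) a)) (trans (lemma x y (x ^ℤ a)) (trans (cong (_* x ^ℤ a) xy≡1) (ℚ.*-identityˡ _)))) (y-int *ᴵ i))
    where
    lemma : ∀ x y z → y * (x * z) ≡ x * y * z
    lemma = solve-∀ ℚ-ring

  -- `B` is a candidate for a ↦ xᵃ modulo pᵉ. Its recursion is used forwards, and backwards after
  -- cancelling the unit `x`, so one polynomial identity covers all integer exponents.
  ^ℤ-≈ : ∀ {x e} (B : ℚ → ℚ) → Unit x → Integral x → 1ℚ ≡ B 0ℚ →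
    (∀ {a} → Integral a → x * B a ≈ B (a + 1ℚ) [ e ]) → ∀ a → x ^ℤ a ≈ B (ℤ→ℚ a) [ e ]
  ^ℤ-≈ {x} {e} B x-unit x-int B0 B-suc = ℤ-induction (λ a → x ^ℤ a ≈ B (ℤ→ℚ a) [ e ]) (≈-reflexive B0)
    (λ a eq → ≈-trans (≈-reflexive (^ℤ-suc x≢0 a)) (≈-trans (*-congˡ-≈ (int⇒∈ x-int) eq) (step a)))
    (λ a eq → ≈-cancel x-unit (≈-trans (≈-reflexive (sym (^ℤ-suc x≢0 a))) (≈-trans eq (≈-sym (step a)))))
    where
    x≢0 = unit⇒≢0 x-unit
    step : ∀ a → x * B (ℤ→ℚ a) ≈ B (ℤ→ℚ (ℤ.suc a)) [ e ]
    step a = ≈-trans (B-suc (ℤ-int a)) (≈-reflexive (cong B (sym (ℤ→ℚ-suc a))))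

  ^ℤ-truncated₂ : ∀ {y} → y ∈𝔭^ 1 → ∀ a → (1ℚ + y) ^ℤ a ≈ truncated₂ y (ℤ→ℚ a) [ 2 ]
  ^ℤ-truncated₂ {y} y∈ = ^ℤ-≈ (truncated₂ y) (1+∈-unit y∈) (ℕ-int 1 +ᴵ ∈⇒int y∈) (lemma₀ y)
    (λ {a} a-int → ∈⇒≈ (∈-resp (lemma y a) (a-int ·∈ (y∈ *∈ y∈))))
    where
    lemma₀ : ∀ y → 1ℚ ≡ 1ℚ + 0ℚ * y
    lemma₀ = solve-∀ ℚ-ring
    lemma : ∀ y a → a * (y * y) ≡ (1ℚ + y) * (1ℚ + a * y) - (1ℚ + (a + 1ℚ) * y)
    lemma = solve-∀ ℚ-ring

  ^ℤ-truncated₁ : ∀ {y} → y ∈𝔭^ 1 → ∀ a → (1ℚ + y) ^ℤ a ≈ 1ℚ [ 1 ]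
  ^ℤ-truncated₁ {y} y∈ a = ≈-trans (≈-weaken 1 1 (^ℤ-truncated₂ y∈ a)) (∈⇒≈ (∈-resp (lemma y (ℤ→ℚ a)) (ℤ-int a ·∈ y∈)))
    where
    lemma : ∀ y a → a * y ≡ (1ℚ + a * y) - 1ℚ
    lemma = solve-∀ ℚ-ring

  ^ℤ-truncated₃ : ∀ {y} → y ∈𝔭^ 1 → ∀ a → (1ℚ + y) ^ℤ a ≈ truncated₃ y (ℤ→ℚ a) [ 3 ]
  ^ℤ-truncated₃ {y} y∈ = ^ℤ-≈ (truncated₃ y) (1+∈-unit y∈) (ℕ-int 1 +ᴵ ∈⇒int y∈) (lemma₀ y)
    (λ {a} a-int → ∈⇒≈ (∈-resp (lemma y a) (C₂-int a-int ·∈ (y∈ *∈ (y∈ *∈ y∈)))))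
    where
    lemma₀ : ∀ y → 1ℚ ≡ 1ℚ + 0ℚ * y + ½ * 0ℚ * (0ℚ - 1ℚ) * y * y
    lemma₀ = solve-∀ ℚ-ring
    lemma : ∀ y a → ½ * a * (a - 1ℚ) * (y * (y * y))
      ≡ (1ℚ + y) * (1ℚ + a * y + ½ * a * (a - 1ℚ) * y * y) - (1ℚ + (a + 1ℚ) * y + ½ * (a + 1ℚ) * (a + 1ℚ - 1ℚ) * y * y)
    lemma = solve-∀ ℚ-ring

  -- By Pascal's rule for C(a,i), 1+y times the truncation for a is the truncation for a+1 plus the
  -- single overflow C(a,5) y⁶.
  ^ℤ-truncated₆ : ∀ {y} → y ∈𝔭^ 1 → ∀ a → (1ℚ + y) ^ℤ a ≈ truncated₆ y (ℤ→ℚ a) [ 6 ]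
  ^ℤ-truncated₆ {y} y∈ = ^ℤ-≈ (truncated₆ y) (1+∈-unit y∈) (ℕ-int 1 +ᴵ ∈⇒int y∈) (lemma₀ y)
    (λ {a} a-int → ∈⇒≈ (∈-resp (lemma y a) (C₅-int a-int ·∈ (y∈ *∈ (y∈ *∈ (y∈ *∈ (y∈ *∈ (y∈ *∈ y∈))))))))
    where
    lemma₀ : ∀ y → 1ℚ ≡ 1ℚ + 0ℚ * y + ½ * 0ℚ * (0ℚ - 1ℚ) * y * y
      + ½ * ⅓ * 0ℚ * (0ℚ - 1ℚ) * (0ℚ - ℕ→ℚ 2) * y * y * y
      + ½ * ⅓ * ¼ * 0ℚ * (0ℚ - 1ℚ) * (0ℚ - ℕ→ℚ 2) * (0ℚ - ℕ→ℚ 3) * y * y * y * y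
      + ½ * ⅓ * ¼ * ⅕ * 0ℚ * (0ℚ - 1ℚ) * (0ℚ - ℕ→ℚ 2) * (0ℚ - ℕ→ℚ 3) * (0ℚ - ℕ→ℚ 4) * y * y * y * y * y
    lemma₀ = solve-∀ ℚ-ring
    lemma : ∀ y a → ½ * ⅓ * ¼ * ⅕ * a * (a - 1ℚ) * (a - ℕ→ℚ 2) * (a - ℕ→ℚ 3) * (a - ℕ→ℚ 4) * (y * (y * (y * (y * (y * y)))))
      ≡ (1ℚ + y) * (1ℚ + a * y + ½ * a * (a - 1ℚ) * y * y
          + ½ * ⅓ * a * (a - 1ℚ) * (a - ℕ→ℚ 2) * y * y * y
          + ½ * ⅓ * ¼ * a * (a - 1ℚ) * (a - ℕ→ℚ 2) * (a - ℕ→ℚ 3) * y * y * y * y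
          + ½ * ⅓ * ¼ * ⅕ * a * (a - 1ℚ) * (a - ℕ→ℚ 2) * (a - ℕ→ℚ 3) * (a - ℕ→ℚ 4) * y * y * y * y * y)
        - (1ℚ + (a + 1ℚ) * y + ½ * (a + 1ℚ) * (a + 1ℚ - 1ℚ) * y * y
          + ½ * ⅓ * (a + 1ℚ) * (a + 1ℚ - 1ℚ) * (a + 1ℚ - ℕ→ℚ 2) * y * y * y
          + ½ * ⅓ * ¼ * (a + 1ℚ) * (a + 1ℚ - 1ℚ) * (a + 1ℚ - ℕ→ℚ 2) * (a + 1ℚ - ℕ→ℚ 3) * y * y * y * y
          + ½ * ⅓ * ¼ * ⅕ * (a + 1ℚ) * (a + 1ℚ - 1ℚ) * (a + 1ℚ - ℕ→ℚ 2) * (a + 1ℚ - ℕ→ℚ 3) * (a + 1ℚ - ℕ→ℚ 4) * y * y * y * y * y)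
    lemma = solve-∀ ℚ-ring

  u : ℕ → ℚ
  u zero    = 1ℚ
  u (suc k) = u k * (1ℚ + - (P * inv (suc k)))

  -Pi∈ : ∀ k → k ∈[1, q ] → - (P * inv k) ∈𝔭^ 1
  -Pi∈ k k∈ = -∈ (P∈ *∈ int⇒∈ (inv-int k k∈))

  u-1∈ : ∀ k → k ≤ q → u k - 1ℚ ∈𝔭^ 1
  u-1∈ zero    _   = ∈-resp (sym (ℚ.+-inverseʳ 1ℚ)) 0∈
  u-1∈ (suc k) k<q = ∈-resp (lemma (u k) (- (P * inv (suc k))))
    (u-1∈ k (ℕ.<⇒≤ k<q) +∈ ((∈⇒int (u-1∈ k (ℕ.<⇒≤ k<q)) +ᴵ ℕ-int 1) ·∈ -Pi∈ (suc k) (s≤s z≤n , k<q)))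
    where
    lemma : ∀ u t → (u - 1ℚ) + (u - 1ℚ + 1ℚ) * t ≡ u * (1ℚ + t) - 1ℚ
    lemma = solve-∀ ℚ-ring

  1+[u-1] : ∀ k → 1ℚ + (u k - 1ℚ) ≡ u k
  1+[u-1] k = lemma (u k)
    where
    lemma : ∀ u → 1ℚ + (u - 1ℚ) ≡ u
    lemma = solve-∀ ℚ-ring

  u-unit : ∀ k → k ≤ q → Unit (u k)
  u-unit k k≤q = subst Unit (1+[u-1] k) (1+∈-unit (u-1∈ k k≤q))

  u-int : ∀ k → k ≤ q → Integral (u k)
  u-int k k≤q = subst Integral (1+[u-1] k) (ℕ-int 1 +ᴵ ∈⇒int (u-1∈ k k≤q))

  -- A new factor gives C(q,k)(1 - p/(k+1)) = C(q,k) - C(p,k+1) = -C(q,k+1).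
  u≡sgn*C : ∀ k → u k ≡ sgn k * ℕ→ℚ (q C k)
  u≡sgn*C zero    = refl
  u≡sgn*C (suc k) = begin
    u k * (1ℚ + - (P * i))               ≡⟨ cong (_* (1ℚ + - (P * i))) (u≡sgn*C k) ⟩
    sgn k * c * (1ℚ + - (P * i))         ≡⟨ lemma (sgn k) P i c ⟩
    - 1ℚ * sgn k * (P * i * c - c)       ≡⟨ cong (λ x → - 1ℚ * sgn k * (x - c)) (ℕ→ℚ-absorb-inv q k) ⟨
    - 1ℚ * sgn k * (ℕ→ℚ (p C suc k) - c) ≡⟨ cong (λ x → - 1ℚ * sgn k * (x - c)) (ℕ→ℚ-pascal q k) ⟩
    - 1ℚ * sgn k * (c + c′ - c)          ≡⟨ lemma′ (- 1ℚ * sgn k) c c′ ⟩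
    - 1ℚ * sgn k * c′                    ∎
    where
    open ≡-Reasoning
    i = inv (suc k)
    c = ℕ→ℚ (q C k)
    c′ = ℕ→ℚ (q C suc k)
    lemma : ∀ s P i c → s * c * (1ℚ + - (P * i)) ≡ - 1ℚ * s * (P * i * c - c)
    lemma = solve-∀ ℚ-ring
    lemma′ : ∀ s c d → s * (c + d - c) ≡ s * d
    lemma′ = solve-∀ ℚ-ring

  sgn-q : sgn q ≡ 1ℚ
  sgn-q = trans (sgn-+ m m) (sgn-* m)

  -- Besides the symmetry of the binomial coefficients, this uses that q = 2m is even, so that the
  -- sign survives k ↦ q - k.
  u-mirror : ∀ k → k ≤ q → u (q ℕ.∸ k) ≡ u k
  u-mirror k k≤q = begin
    u (q ℕ.∸ k)                                 ≡⟨ u≡sgn*C (q ℕ.∸ k) ⟩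
    sgn (q ℕ.∸ k) * ℕ→ℚ (q C (q ℕ.∸ k))         ≡⟨ cong₂ (λ x y → x * ℕ→ℚ y) sgn-mirror (sym (nCk≡nC[n∸k] k≤q)) ⟩
    sgn k * ℕ→ℚ (q C k)                         ≡⟨ u≡sgn*C k ⟨
    u k                                         ∎
    where
    open ≡-Reasoning
    sgn-mirror : sgn (q ℕ.∸ k) ≡ sgn k
    sgn-mirror = begin
      sgn (q ℕ.∸ k)                      ≡⟨ ℚ.*-identityʳ _ ⟨
      sgn (q ℕ.∸ k) * 1ℚ                 ≡⟨ cong (sgn (q ℕ.∸ k) *_) (sgn-* k) ⟨
      sgn (q ℕ.∸ k) * (sgn k * sgn k)    ≡⟨ ℚ.*-assoc (sgn (q ℕ.∸ k)) (sgn k) (sgn k) ⟨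
      sgn (q ℕ.∸ k) * sgn k * sgn k      ≡⟨ cong (_* sgn k) (sgn-+ (q ℕ.∸ k) k) ⟨
      sgn (q ℕ.∸ k ℕ.+ k) * sgn k        ≡⟨ cong (λ x → sgn x * sgn k) (ℕ.m∸n+n≡m k≤q) ⟩
      sgn q * sgn k                      ≡⟨ cong (_* sgn k) sgn-q ⟩
      1ℚ * sgn k                         ≡⟨ ℚ.*-identityˡ (sgn k) ⟩
      sgn k                              ∎

-- The Abel summation

module Expansion (m : ℕ) (p-prime : Prime (suc (m ℕ.+ m))) (5<p : 5 < suc (m ℕ.+ m)) (a : ℤ) where
  open Powers m p-prime 5<p

  α : ℚ
  α = ℤ→ℚ a

  U : ℕ → ℚ
  U k = u k ^ℤ a

  W S₂ S₃ S₄ : ℚ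
  W  = Σ₁ q (λ k → U (ℕ.pred k))
  S₂ = Σ₁ q (λ k → U (ℕ.pred k) * inv² k)
  S₃ = Σ₁ q (λ k → U (ℕ.pred k) * inv³ k)
  S₄ = Σ₁ q (λ k → U (ℕ.pred k) * inv⁴ k)

  α-int : Integral α
  α-int = ℤ-int a

  pred≤q : ∀ k → k ∈[1, q ] → ℕ.pred k ≤ q
  pred≤q k (_ , k≤q) = ℕ.≤-trans (ℕ.pred[n]≤n) k≤q

  U-int : ∀ k → k ≤ q → Integral (U k)
  U-int k k≤q = unit-int (u-unit k k≤q) (u-int k k≤q) a

  U-suc : ∀ k → k ∈[1, q ] → U k ≡ U (ℕ.pred k) * (1ℚ + - (P * inv k)) ^ℤ a
  U-suc (suc k) k∈@(_ , k<q) = ^ℤ-distrib-* (unit⇒≢0 (u-unit k (ℕ.<⇒≤ k<q))) (unit⇒≢0 (1+∈-unit (-Pi∈ (suc k) k∈))) a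

  -- Under k ↦ p-k the weight U(k-1) becomes U(k), which differs from it by the factor (1 - p/k)ᵃ.
  U-mirror : ∀ k → k ∈[1, q ] → U (ℕ.pred (p ℕ.∸ k)) ≡ U k
  U-mirror k (_ , k≤q) = cong (_^ℤ a) (trans (cong u (trans (ℕ.pred[m∸n]≡m∸[1+n] p k) refl)) (u-mirror k k≤q))

  U0≡1 : U 0 ≡ 1ℚ
  U0≡1 = sym (^ℤ-unique (unit⇒≢0 1-unit) (λ _ → 1ℚ) refl (λ _ → refl) a)

  Uq≡1 : U q ≡ 1ℚ
  Uq≡1 = trans (cong (_^ℤ a) (u-mirror 0 z≤n)) U0≡1

  -- All weights are 1 modulo p, so S₄ ≡ Σ 1/k⁴.
  S₄∈ : S₄ ∈𝔭^ 1
  S₄∈ = ∈-≈ (Σ₁-≈ q λ k k∈ → ≈-trans (*-cong-≈ (U-int (ℕ.pred k) (pred≤q k k∈)) (inv⁴-int k k∈) (U≈1 (ℕ.pred k) (pred≤q k k∈)) ≈-refl)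
      (≈-reflexive (ℚ.*-identityˡ (inv⁴ k)))) H₄∈
    where
    inv⁴-int : ∀ k → k ∈[1, q ] → Integral (inv⁴ k)
    inv⁴-int k k∈ = let i = inv-int k k∈ in i *ᴵ i *ᴵ i *ᴵ i
    U≈1 : ∀ k → k ≤ q → U k ≈ 1ℚ [ 1 ]
    U≈1 k k≤q = ≈-trans (≈-reflexive (cong (_^ℤ a) (sym (1+[u-1] k)))) (^ℤ-truncated₁ (u-1∈ k k≤q) a)

  inv-mirror₂ : ∀ k → k ∈[1, q ] → inv (p ℕ.∸ k) ≈ - (inv k + P * inv k * inv k) [ 2 ]
  inv-mirror₂ k k∈ = ∈⇒≈ (∈-resp (sym (trans (lemma P i j) (trans (cong (λ x → (i + j - x) * (1ℚ + P * i) + P * (P * 1ℚ) * (i * i * j)) (sym (inv-mirror k k∈))) (lemma′ (i + j) _ _))))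
    (P^∈ 2 *∈ int⇒∈ (i-int *ᴵ i-int *ᴵ inv-int _ (mirror-index k k∈))))
    where
    i = inv k
    j = inv (p ℕ.∸ k)
    i-int = inv-int k k∈
    lemma′ : ∀ x y z → (x - x) * y + z ≡ z
    lemma′ = solve-∀ ℚ-ring
    lemma : ∀ P i j → j - - (i + P * i * i) ≡ (i + j - P * i * j) * (1ℚ + P * i) + P * (P * 1ℚ) * (i * i * j)
    lemma = solve-∀ ℚ-ring

  -- Modulo p², 1/(p-k)³ ≡ -(1 + 3p/k)/k³ and U(k) ≡ U(k-1)(1 - ap/k), so the terms at k and p-k add
  -- up to (a-3) p U(k-1)/k⁴. Hence 2S₃ ≡ (a-3) p S₄, and p divides S₄.
  S₃∈ : S₃ ∈𝔭^ 2
  S₃∈ = ∈-cancel (ℕ-unit p∤2) (∈-≈ (≈-trans (≈-reflexive doubled) (≈-trans (Σ₁-≈ q pair) (≈-reflexive (Σ₁-* q ((α - ℕ→ℚ 3) * P) _))))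
    (((α-int -ᴵ ℕ-int 3) ·∈ P∈) *∈ S₄∈))
    where
    g : ℕ → ℚ
    g k = U (ℕ.pred k) * inv³ k
    doubled : ℕ→ℚ 2 * S₃ ≡ Σ₁ q (λ k → g k + g (p ℕ.∸ k))
    doubled = trans (lemma S₃) (trans (cong (S₃ +_) (Σ₁-reverse q g)) (sym (Σ₁-+ q g _)))
      where
      lemma : ∀ x → ℕ→ℚ 2 * x ≡ x + x
      lemma = solve-∀ ℚ-ring
    pair : ∀ k → k ∈[1, q ] → g k + g (p ℕ.∸ k) ≈ (α - ℕ→ℚ 3) * P * (U (ℕ.pred k) * inv⁴ k) [ 2 ]
    pair k k∈ = ≈-trans
      (+-congˡ-≈ (g k) (*-cong-≈ (subst Integral (sym (U-mirror k k∈)) (U-int k (proj₂ k∈))) (j′-int *ᴵ j′-int *ᴵ j′-int)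
        (≈-trans (≈-reflexive (trans (U-mirror k k∈) (U-suc k k∈))) (*-congˡ-≈ (int⇒∈ w-int) (^ℤ-truncated₂ (-Pi∈ k k∈) a)))
        (*-cong-≈ (j-int *ᴵ j-int) j′-int (*-cong-≈ j-int j′-int (inv-mirror₂ k k∈) (inv-mirror₂ k k∈)) (inv-mirror₂ k k∈))))
      (∈⇒≈ (∈-resp (sym (lemma P α w i)) (P^∈ 2 *∈ int⇒∈ (-ᴵ (w-int *ᴵ i-int *ᴵ i-int *ᴵ i-int *ᴵ i-int *ᴵ i-int *ᴵ
        (ℕ-int 3 -ᴵ ℕ-int 3 *ᴵ α-int +ᴵ (ℕ-int 1 -ᴵ ℕ-int 3 *ᴵ α-int) *ᴵ (P-int *ᴵ i-int) -ᴵ α-int *ᴵ (P-int *ᴵ i-int) *ᴵ (P-int *ᴵ i-int)))))))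
      where
      i = inv k
      w = U (ℕ.pred k)
      i-int = inv-int k k∈
      j-int = inv-int _ (mirror-index k k∈)
      w-int = U-int (ℕ.pred k) (pred≤q k k∈)
      j′-int = -ᴵ (i-int +ᴵ P-int *ᴵ i-int *ᴵ i-int)
      lemma : ∀ P α w i →
        w * (i * i * i) + w * (1ℚ + α * - (P * i)) * (- (i + P * i * i) * - (i + P * i * i) * - (i + P * i * i))
          - (α - ℕ→ℚ 3) * P * (w * (i * i * i * i))
        ≡ P * (P * 1ℚ) * - (w * i * i * i * i * i *
            (ℕ→ℚ 3 - ℕ→ℚ 3 * α + (1ℚ - ℕ→ℚ 3 * α) * (P * i) - α * (P * i) * (P * i)))
      lemma = solve-∀ ℚ-ring

  -- `Dᵢ` is the coefficient of pⁱ⁺¹ U(k-1)/kⁱ in (k + shift)(U k - U(k-1)); `D₂` simplifies to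
  -- (a³-a)/12.
  D₂ D₃ D₄ : ℚ
  D₂ = - C₃ α + ½ * (α - 1ℚ) * C₂ α
  D₃ = C₄ α - ½ * (α - 1ℚ) * C₃ α
  D₄ = - C₅ α + ½ * (α - 1ℚ) * C₄ α

  -- The shift is chosen so that the terms of order p²/k cancel in the Abel summation.
  shift : ℚ
  shift = ½ * P * (α - 1ℚ)

  shift-int : Integral shift
  shift-int = ½-int *ᴵ P-int *ᴵ (α-int -ᴵ ℕ-int 1)

  private
    G : ℕ → ℚ
    G k = (ℕ→ℚ k + shift) * U k

    -- The summand is G(k) - G(k-1) - U(k-1). As U(0) = U(q) = 1, the boundary terms containing
    -- `shift` cancel, which leaves the shift free to choose.
    Abel : Σ₁ q (λ k → (ℕ→ℚ k + shift) * U k - (ℕ→ℚ k + shift) * U (ℕ.pred k)) ≡ ℕ→ℚ q - W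
    Abel = begin
      Σ₁ q (λ k → (ℕ→ℚ k + shift) * U k - (ℕ→ℚ k + shift) * U (ℕ.pred k))   ≡⟨ Σ₁-cong q split ⟩
      Σ₁ q (λ k → (G k - G (ℕ.pred k)) - U (ℕ.pred k))                       ≡⟨ Σ₁-- q (λ k → G k - G (ℕ.pred k)) _ ⟩
      Σ₁ q (λ k → G k - G (ℕ.pred k)) - W                                    ≡⟨ cong (_- W) (Σ₁-telescope q G) ⟩
      (ℕ→ℚ q + shift) * U q - (0ℚ + shift) * U 0 - W                         ≡⟨ cong₂ (λ x y → (ℕ→ℚ q + shift) * x - (0ℚ + shift) * y - W) Uq≡1 U0≡1 ⟩
      (ℕ→ℚ q + shift) * 1ℚ - (0ℚ + shift) * 1ℚ - W                           ≡⟨ lemma (ℕ→ℚ q) shift W ⟩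
      ℕ→ℚ q - W                                                              ∎
      where
      open ≡-Reasoning
      lemma : ∀ Q c W → (Q + c) * 1ℚ - (0ℚ + c) * 1ℚ - W ≡ Q - W
      lemma = solve-∀ ℚ-ring
      lemma′ : ∀ κ c x y → (κ + 1ℚ + c) * x - (κ + 1ℚ + c) * y ≡ (κ + 1ℚ + c) * x - (κ + c) * y - y
      lemma′ = solve-∀ ℚ-ring
      split : ∀ k → k ∈[1, q ] → (ℕ→ℚ k + shift) * U k - (ℕ→ℚ k + shift) * U (ℕ.pred k) ≡ (G k - G (ℕ.pred k)) - U (ℕ.pred k)
      split (suc k) _ = subst (λ κ → (κ + shift) * U (suc k) - (κ + shift) * U k ≡ (κ + shift) * U (suc k) - (ℕ→ℚ k + shift) * U k - U k)
        (sym (ℕ→ℚ-suc k)) (lemma′ (ℕ→ℚ k) shift (U (suc k)) (U k))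

    term : ∀ k → k ∈[1, q ] → (ℕ→ℚ k + shift) * U k - (ℕ→ℚ k + shift) * U (ℕ.pred k)
      ≈ - (α * P) * U (ℕ.pred k) + D₂ * (P * P * P) * (U (ℕ.pred k) * inv² k) + D₃ * (P * P * P * P) * (U (ℕ.pred k) * inv³ k)
        + D₄ * (P * P * P * P * P) * (U (ℕ.pred k) * inv⁴ k) [ 6 ]
    term k k∈ = ≈-trans
      (+-cong-≈ (*-congˡ-≈ (int⇒∈ (ℕ-int k +ᴵ shift-int)) (≈-trans (≈-reflexive (U-suc k k∈)) (*-congˡ-≈ (int⇒∈ w-int) (^ℤ-truncated₆ (-Pi∈ k k∈) a))))
        (≈-refl { - ((ℕ→ℚ k + shift) * w)}))
      (∈⇒≈ (∈-resp (sym (trans (lemma P α w i (ℕ→ℚ k) (C₃ α) (C₄ α) (C₅ α))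
          (trans (cong (λ x → E + (x - 1ℚ) * F) (inv-inverse k (proj₁ k∈))) (lemma′ E F))))
        (P^∈ 6 *∈ int⇒∈ (-ᴵ (½-int *ᴵ (α-int -ᴵ ℕ-int 1) *ᴵ C₅-int α-int *ᴵ w-int *ᴵ i-int *ᴵ i-int *ᴵ i-int *ᴵ i-int *ᴵ i-int)))))
      where
      i = inv k
      w = U (ℕ.pred k)
      i-int = inv-int k k∈
      w-int = U-int (ℕ.pred k) (pred≤q k k∈)
      -- `E` is the product of the shift with the fifth-order term, the only one to reach p⁶; `F` is
      -- the cofactor of k · (1/k) - 1, which is zero.
      E = P * (P * (P * (P * (P * (P * 1ℚ))))) * - (½ * (α - 1ℚ) * C₅ α * w * i * i * i * i * i)
      F = w * (- (α * P) + ½ * α * (α - 1ℚ) * P * P * i - C₃ α * P * P * P * i * i + C₄ α * P * P * P * P * i * i * i - C₅ α * P * P * P * P * P * i * i * i * i)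
      lemma′ : ∀ E F → E + (1ℚ - 1ℚ) * F ≡ E
      lemma′ = solve-∀ ℚ-ring
      lemma : ∀ P α w i κ c₃ c₄ c₅ →
        (κ + ½ * P * (α - 1ℚ)) * (w * (1ℚ + α * - (P * i) + ½ * α * (α - 1ℚ) * - (P * i) * - (P * i) + c₃ * - (P * i) * - (P * i) * - (P * i)
          + c₄ * - (P * i) * - (P * i) * - (P * i) * - (P * i) + c₅ * - (P * i) * - (P * i) * - (P * i) * - (P * i) * - (P * i)))
        + - ((κ + ½ * P * (α - 1ℚ)) * w)
        - (- (α * P) * w + (- c₃ + ½ * (α - 1ℚ) * (½ * α * (α - 1ℚ))) * (P * P * P) * (w * (i * i))
          + (c₄ - ½ * (α - 1ℚ) * c₃) * (P * P * P * P) * (w * (i * i * i))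
          + (- c₅ + ½ * (α - 1ℚ) * c₄) * (P * P * P * P * P) * (w * (i * i * i * i)))
        ≡ P * (P * (P * (P * (P * (P * 1ℚ))))) * - (½ * (α - 1ℚ) * c₅ * w * i * i * i * i * i)
          + (κ * i - 1ℚ) * (w * (- (α * P) + ½ * α * (α - 1ℚ) * P * P * i - c₃ * P * P * P * i * i + c₄ * P * P * P * P * i * i * i - c₅ * P * P * P * P * P * i * i * i * i))
      lemma = solve-∀ ℚ-ring

    D₃-int : Integral D₃
    D₃-int = C₄-int α-int -ᴵ ½-int *ᴵ (α-int -ᴵ ℕ-int 1) *ᴵ C₃-int α-int

    D₄-int : Integral D₄
    D₄-int = (-ᴵ C₅-int α-int) +ᴵ ½-int *ᴵ (α-int -ᴵ ℕ-int 1) *ᴵ C₄-int α-int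

  -- `1ℚ + W` is the full sum T, since `W` lacks only U(q) = 1. The terms in p⁴S₃ and p⁵S₄ are
  -- divisible by p⁶; substituting q = p - 1 and collecting T gives this form.
  expansion : (1ℚ - α * P) * (1ℚ + W) ≈ P * (1ℚ - α) - ⅓ * ¼ * α * (α - 1ℚ) * (α + 1ℚ) * (P * P * P) * S₂ [ 6 ]
  expansion = ∈⇒≈ (∈-resp (trans (lemma P α W S₂ S₃ S₄ (ℕ→ℚ q) D₃ D₄)
      (trans (cong (λ x → (1ℚ - α * P) * (1ℚ + W) - (P * (1ℚ - α) - ⅓ * ¼ * α * (α - 1ℚ) * (α + 1ℚ) * (P * P * P) * S₂) + (P - x)) (sym (ℕ→ℚ-suc q))) (lemma′ _ P)))
    (-∈ (≈⇒∈ summed +∈ D₃-int ·∈ (P^∈ 4 *∈ S₃∈) +∈ D₄-int ·∈ (P^∈ 5 *∈ S₄∈))))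
    where
    f : ℕ → ℚ
    f k = - (α * P) * U (ℕ.pred k) + D₂ * (P * P * P) * (U (ℕ.pred k) * inv² k) + D₃ * (P * P * P * P) * (U (ℕ.pred k) * inv³ k)
    summed : ℕ→ℚ q - W ≈ - (α * P) * W + D₂ * (P * P * P) * S₂ + D₃ * (P * P * P * P) * S₃ + D₄ * (P * P * P * P * P) * S₄ [ 6 ]
    summed = ≈-trans (≈-reflexive (sym Abel)) (≈-trans (Σ₁-≈ q term) (≈-reflexive
      (trans (Σ₁-+ q f _) (cong₂ _+_ (Σ₁-linear q (- (α * P)) (D₂ * (P * P * P)) (D₃ * (P * P * P * P)) _ _ _) (Σ₁-* q (D₄ * (P * P * P * P * P)) _)))))
    lemma′ : ∀ x y → x + (y - y) ≡ x
    lemma′ = solve-∀ ℚ-ring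
    lemma : ∀ P α W S₂ S₃ S₄ Q D₃ D₄ →
      - ((Q - W - (- (α * P) * W + (- (½ * ⅓ * α * (α - 1ℚ) * (α - ℕ→ℚ 2)) + ½ * (α - 1ℚ) * (½ * α * (α - 1ℚ))) * (P * P * P) * S₂ + D₃ * (P * P * P * P) * S₃ + D₄ * (P * P * P * P * P) * S₄))
      + D₃ * (P * (P * (P * (P * 1ℚ))) * S₃) + D₄ * (P * (P * (P * (P * (P * 1ℚ)))) * S₄))
      ≡ (1ℚ - α * P) * (1ℚ + W) - (P * (1ℚ - α) - ⅓ * ¼ * α * (α - 1ℚ) * (α + 1ℚ) * (P * P * P) * S₂) + (P - (Q + 1ℚ))
    lemma = solve-∀ ℚ-ring

-- The sum S₂ modulo p³

module SecondSum (m : ℕ) (p-prime : Prime (suc (m ℕ.+ m))) (5<p : 5 < suc (m ℕ.+ m)) where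
  open Powers m p-prime 5<p

  H₂ H₃ H₄ : ℚ
  H₂ = Σ₁ q inv²
  H₃ = Σ₁ q inv³
  H₄ = Σ₁ q inv⁴

  H₃∈ : H₃ ∈𝔭^ 2
  H₃∈ = ∈-resp (Σ₁-cong q λ k _ → ℚ.*-identityˡ (inv³ k)) (Expansion.S₃∈ m p-prime 5<p ℤ.0ℤ)

  -- The value of p S₂ at a = 0. Summing 1/k + 1/(p-k) gives 2H ≡ -pH₂ - p²H₃ - p³H₄, whose last two
  -- terms are divisible by p⁴.
  PH₂≈-2H : P * H₂ ≈ - (ℕ→ℚ 2 * H) [ 4 ]
  PH₂≈-2H = ∈⇒≈ (∈-resp (lemma P H H₂ H₃ H₄) (≈⇒∈ doubled -∈ P^∈ 2 *∈ H₃∈ -∈ P^∈ 3 *∈ H₄∈))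
    where
    doubled : ℕ→ℚ 2 * H ≈ - P * H₂ + - (P * P) * H₃ + - (P * P * P) * H₄ [ 4 ]
    doubled = ≈-trans (≈-reflexive (trans (double H) (trans (cong (H +_) (Σ₁-reverse q inv)) (sym (Σ₁-+ q inv _)))))
      (≈-trans (Σ₁-≈ q inv-mirror-expand) (≈-reflexive (Σ₁-linear q (- P) (- (P * P)) (- (P * P * P)) inv² inv³ inv⁴)))
      where
      double : ∀ x → ℕ→ℚ 2 * x ≡ x + x
      double = solve-∀ ℚ-ring
    lemma : ∀ P H H₂ H₃ H₄ →
      (ℕ→ℚ 2 * H - (- P * H₂ + - (P * P) * H₃ + - (P * P * P) * H₄)) - P * (P * 1ℚ) * H₃ - P * (P * (P * 1ℚ)) * H₄
      ≡ P * H₂ - - (ℕ→ℚ 2 * H)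
    lemma = solve-∀ ℚ-ring

  H₂∈ : H₂ ∈𝔭^ 1
  H₂∈ = ∈-cancelP (∈-≈ (≈-weaken 2 2 PH₂≈-2H) (-∈ (ℕ-int 2 ·∈ H∈)))

  Pu/k : ∀ k → k ∈[1, q ] → P * inv k * u (ℕ.pred k) ≡ sgn (ℕ.pred k) * ℕ→ℚ (p C k)
  Pu/k (suc k) _ = trans (cong (P * inv (suc k) *_) (u≡sgn*C k))
    (trans (lemma P (inv (suc k)) (sgn k) (ℕ→ℚ (q C k))) (cong (sgn k *_) (sym (ℕ→ℚ-absorb-inv q k))))
    where
    lemma : ∀ P i s c → P * i * (s * c) ≡ s * (P * i * c)
    lemma = solve-∀ ℚ-ring

  -- The value at a = 1, which is exact because p u(k-1)/k = (-1)ᵏ⁻¹ C(p,k).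
  PΣu/k²≡H : P * Σ₁ q (λ k → u (ℕ.pred k) * inv² k) ≡ H
  PΣu/k²≡H = begin
    P * Σ₁ q (λ k → u (ℕ.pred k) * inv² k)                         ≡⟨ Σ₁-* q P _ ⟨
    Σ₁ q (λ k → P * (u (ℕ.pred k) * inv² k))                       ≡⟨ Σ₁-cong q (λ k k∈ → trans (lemma P (u (ℕ.pred k)) (inv k)) (cong (_* inv k) (Pu/k k k∈))) ⟩
    -- The binomial identity for n = p has one more term, 1/p at k = p; it is supplied here and
    -- cancels against the last term of the harmonic sum up to p.
    Σ₁ q f                                                         ≡⟨ lemma′ (Σ₁ q f) (inv p) ⟩
    Σ₁ q f + 1ℚ * 1ℚ * inv p - inv p                               ≡⟨ cong₂ (λ x y → Σ₁ q f + x * ℕ→ℚ y * inv p - inv p) sgn-q (nCn≡1 p) ⟨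
    Σ₁ p f - inv p                                                 ≡⟨ cong (_- inv p) (Σ-alternating-binomial/k p) ⟩
    H + inv p - inv p                                              ≡⟨ lemma″ H (inv p) ⟩
    H                                                              ∎
    where
    open ≡-Reasoning
    f : ℕ → ℚ
    f k = sgn (ℕ.pred k) * ℕ→ℚ (p C k) * inv k
    lemma : ∀ P u i → P * (u * (i * i)) ≡ P * i * u * i
    lemma = solve-∀ ℚ-ring
    lemma′ : ∀ x y → x ≡ x + 1ℚ * 1ℚ * y - y
    lemma′ = solve-∀ ℚ-ring
    lemma″ : ∀ x y → x + y - y ≡ x
    lemma″ = solve-∀ ℚ-ring

  -- The companion product ∏ (1 + p/j) = C(p+n,n); it enters at n = q because C(2p,p) = 2 v(q).
  v : ℕ → ℚ
  v zero    = 1ℚ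
  v (suc k) = v k * (1ℚ + P * inv (suc k))

  v≡C : ∀ n → v n ≡ ℕ→ℚ ((p ℕ.+ n) C n)
  v≡C zero    = refl
  v≡C (suc n) = begin
    v n * (1ℚ + P * i)                                  ≡⟨ cong₂ (λ x y → x * (y + P * i)) (v≡C n) (sym (inv-inverse (suc n) (s≤s z≤n))) ⟩
    c * (ℕ→ℚ (suc n) * i + P * i)                       ≡⟨ lemma c (ℕ→ℚ (suc n)) i P ⟩
    (P + ℕ→ℚ (suc n)) * i * c                           ≡⟨ cong (λ x → x * i * c) (ℕ→ℚ-+ p (suc n)) ⟨
    ℕ→ℚ (p ℕ.+ suc n) * i * c                           ≡⟨ cong (λ x → ℕ→ℚ x * i * c) (ℕ.+-suc p n) ⟩
    ℕ→ℚ (suc (p ℕ.+ n)) * i * c                         ≡⟨ ℕ→ℚ-absorb-inv (p ℕ.+ n) n ⟨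
    ℕ→ℚ (suc (p ℕ.+ n) C suc n)                         ≡⟨ cong (λ x → ℕ→ℚ (x C suc n)) (ℕ.+-suc p n) ⟨
    ℕ→ℚ ((p ℕ.+ suc n) C suc n)                         ∎
    where
    open ≡-Reasoning
    i = inv (suc n)
    c = ℕ→ℚ ((p ℕ.+ n) C n)
    lemma : ∀ c ν i P → c * (ν * i + P * i) ≡ (P + ν) * i * c
    lemma = solve-∀ ℚ-ring

  -- The value at a = 2: (p u(k-1)/k)² = C(p,k)², and Σ C(p,k)² = C(2p,p). The subtracted 2 accounts
  -- for k = 0 and k = p.
  P²Σu²/k² : P * P * Σ₁ q (λ k → u (ℕ.pred k) * u (ℕ.pred k) * inv² k) ≡ ℕ→ℚ 2 * v q - ℕ→ℚ 2
  P²Σu²/k² = begin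
    P * P * Σ₁ q (λ k → u (ℕ.pred k) * u (ℕ.pred k) * inv² k)      ≡⟨ Σ₁-* q (P * P) _ ⟨
    Σ₁ q (λ k → P * P * (u (ℕ.pred k) * u (ℕ.pred k) * inv² k))    ≡⟨ Σ₁-cong q square ⟩
    Σ₁ q f                                                         ≡⟨ lemma (Σ₁ q f) ⟩
    1ℚ + (Σ₁ q f + 1ℚ * 1ℚ) - ℕ→ℚ 2                                ≡⟨ cong (λ x → 1ℚ + (Σ₁ q f + ℕ→ℚ x * ℕ→ℚ x) - ℕ→ℚ 2) (nCn≡1 p) ⟨
    1ℚ + Σ₁ p f - ℕ→ℚ 2                                            ≡⟨ cong (_- ℕ→ℚ 2) (vandermonde p 0 p) ⟩
    ℕ→ℚ ((p ℕ.+ p) C p) - ℕ→ℚ 2                                    ≡⟨ cong (_- ℕ→ℚ 2) (v≡C p) ⟨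
    v q * (1ℚ + P * inv p) - ℕ→ℚ 2                                 ≡⟨ cong (λ x → v q * (1ℚ + x) - ℕ→ℚ 2) (inv-inverse p (s≤s z≤n)) ⟩
    v q * (1ℚ + 1ℚ) - ℕ→ℚ 2                                        ≡⟨ cong (_- ℕ→ℚ 2) (ℚ.*-comm (v q) (1ℚ + 1ℚ)) ⟩
    ℕ→ℚ 2 * v q - ℕ→ℚ 2                                            ∎
    where
    open ≡-Reasoning
    f : ℕ → ℚ
    f k = ℕ→ℚ (p C k) * ℕ→ℚ (p C k)
    lemma : ∀ x → x ≡ 1ℚ + (x + 1ℚ * 1ℚ) - ℕ→ℚ 2
    lemma = solve-∀ ℚ-ring
    square : ∀ k → k ∈[1, q ] → P * P * (u (ℕ.pred k) * u (ℕ.pred k) * inv² k) ≡ f k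
    square k k∈ = begin
      P * P * (w * w * (i * i))            ≡⟨ lemma₁ P w i ⟩
      P * i * w * (P * i * w)              ≡⟨ cong₂ _*_ (Pu/k k k∈) (Pu/k k k∈) ⟩
      s * c * (s * c)                      ≡⟨ lemma₂ s c ⟩
      s * s * (c * c)                      ≡⟨ cong (_* (c * c)) (sgn-* (ℕ.pred k)) ⟩
      1ℚ * (c * c)                         ≡⟨ ℚ.*-identityˡ (c * c) ⟩
      c * c                                ∎
      where
      w = u (ℕ.pred k)
      i = inv k
      s = sgn (ℕ.pred k)
      c = ℕ→ℚ (p C k)
      lemma₁ : ∀ P w i → P * P * (w * w * (i * i)) ≡ P * i * w * (P * i * w)
      lemma₁ = solve-∀ ℚ-ring
      lemma₂ : ∀ s c → s * c * (s * c) ≡ s * s * (c * c)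
      lemma₂ = solve-∀ ℚ-ring

  -- Since u q = 1, the product v q of the 1 + p/k is the product of the 1 - p²/k².
  v≈ : v q ≈ 1ℚ + ℕ→ℚ 2 * (P * H) [ 5 ]
  v≈ = ≈-cancel (ℕ-unit p∤2) (∈⇒≈ (∈-resp (cong (λ x → ℕ→ℚ 2 * x - ℕ→ℚ 2 * (1ℚ + ℕ→ℚ 2 * (P * H))) vu≡v)
    (∈-resp (lemma (v q * u q) P H H₂ H₄) (∈-weaken 1 5 (≈⇒∈ (expand q ℕ.≤-refl))
      +∈ ∈-weaken 1 5 ((P^∈ 2 *∈ H₂∈) *∈ (P^∈ 2 *∈ H₂∈)) -∈ (P^∈ 4 *∈ H₄∈)
      -∈ ((ℕ-int 2 ·∈ P∈) *∈ ≈⇒∈ PH₂≈-2H)))))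
    where
    uq≡1 : u q ≡ 1ℚ
    uq≡1 = u-mirror 0 z≤n
    vu≡v : v q * u q ≡ v q
    vu≡v = trans (cong (v q *_) uq≡1) (ℚ.*-identityʳ (v q))
    lemma : ∀ x P H H₂ H₄ →
      (ℕ→ℚ 2 * x - (ℕ→ℚ 2 - ℕ→ℚ 2 * (P * P * H₂) + P * P * H₂ * (P * P * H₂) - P * P * P * P * H₄))
      + (P * (P * 1ℚ) * H₂) * (P * (P * 1ℚ) * H₂) - P * (P * (P * (P * 1ℚ))) * H₄ - ℕ→ℚ 2 * P * (P * H₂ - - (ℕ→ℚ 2 * H))
      ≡ ℕ→ℚ 2 * x - ℕ→ℚ 2 * (1ℚ + ℕ→ℚ 2 * (P * H))
    lemma = solve-∀ ℚ-ring
    -- Modulo p⁶ the product of the 1 - p²/k² is 1 - e₁p² + e₂p⁴ in the elementary symmetric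
    -- functions of the 1/k². Doubling allows 2e₂ = e₁² - Σ 1/k⁴ without a division.
    expand : ∀ n → n ≤ q → ℕ→ℚ 2 * (v n * u n)
      ≈ ℕ→ℚ 2 - ℕ→ℚ 2 * (P * P * Σ₁ n inv²) + P * P * Σ₁ n inv² * (P * P * Σ₁ n inv²) - P * P * P * P * Σ₁ n inv⁴ [ 6 ]
    expand zero    _   = ≈-reflexive (lemma₀ P)
      where
      lemma₀ : ∀ P → ℕ→ℚ 2 * (1ℚ * 1ℚ) ≡ ℕ→ℚ 2 - ℕ→ℚ 2 * (P * P * 0ℚ) + P * P * 0ℚ * (P * P * 0ℚ) - P * P * P * P * 0ℚ
      lemma₀ = solve-∀ ℚ-ring
    expand (suc n) n<q = ∈⇒≈ (∈-resp (lemma₁ P (v n) (u n) i s r)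
      (factor-int ·∈ ≈⇒∈ (expand n (ℕ.<⇒≤ n<q)) -∈ P^∈ 6 *∈ int⇒∈ ((s-int *ᴵ s-int -ᴵ r-int) *ᴵ i-int *ᴵ i-int)))
      where
      i = inv (suc n)
      s = Σ₁ n inv²
      r = Σ₁ n inv⁴
      int : ∀ k → k ∈[1, n ] → Integral (inv k)
      int k (1≤k , k≤n) = inv-int k (1≤k , ℕ.≤-trans k≤n (ℕ.<⇒≤ n<q))
      i-int = inv-int (suc n) (s≤s z≤n , n<q)
      s-int = Σ₁-int n λ k k∈ → int k k∈ *ᴵ int k k∈
      r-int = Σ₁-int n λ k k∈ → int k k∈ *ᴵ int k k∈ *ᴵ int k k∈ *ᴵ int k k∈
      factor-int = ℕ-int 1 -ᴵ (P-int *ᴵ i-int) *ᴵ (P-int *ᴵ i-int)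
      lemma₁ : ∀ P v u i s r →
        (1ℚ - P * i * (P * i)) * (ℕ→ℚ 2 * (v * u) - (ℕ→ℚ 2 - ℕ→ℚ 2 * (P * P * s) + P * P * s * (P * P * s) - P * P * P * P * r))
        - P * (P * (P * (P * (P * (P * 1ℚ))))) * ((s * s - r) * i * i)
        ≡ ℕ→ℚ 2 * (v * (1ℚ + P * i) * (u * (1ℚ + - (P * i))))
        - (ℕ→ℚ 2 - ℕ→ℚ 2 * (P * P * (s + i * i)) + P * P * (s + i * i) * (P * P * (s + i * i)) - P * P * P * P * (r + i * i * i * i))
      lemma₁ = solve-∀ ℚ-ring

  PΣu²/k²≈4H : P * Σ₁ q (λ k → u (ℕ.pred k) * u (ℕ.pred k) * inv² k) ≈ ℕ→ℚ 4 * H [ 4 ]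
  PΣu²/k²≈4H = ≈-cancelP (≈-trans (≈-reflexive (trans (sym (ℚ.*-assoc P P _)) P²Σu²/k²))
    (∈⇒≈ (∈-resp (lemma (v q) P H) (ℕ-int 2 ·∈ ≈⇒∈ v≈))))
    where
    lemma : ∀ v P H → ℕ→ℚ 2 * (v - (1ℚ + ℕ→ℚ 2 * (P * H))) ≡ (ℕ→ℚ 2 * v - ℕ→ℚ 2) - P * (ℕ→ℚ 4 * H)
    lemma = solve-∀ ℚ-ring

  -- Modulo p³, uᵃ equals its Lagrange interpolation in a at 0, 1, 2; `A`, `B`, `C` are the basis
  -- polynomials. The nodes give -2H, H, 4H, the values of (3a-2)H.
  PS₂≈ : ∀ a → P * Expansion.S₂ m p-prime 5<p a ≈ (ℕ→ℚ 3 * ℤ→ℚ a - ℕ→ℚ 2) * H [ 4 ]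
  PS₂≈ a = ≈-trans (*-congˡ-≈ P∈ (≈-trans (Σ₁-≈ q interpolate) (≈-reflexive (Σ₁-linear q (½ * (α - 1ℚ) * (α - ℕ→ℚ 2)) (- (α * (α - ℕ→ℚ 2))) (½ * α * (α - 1ℚ)) inv² _ _))))
    (∈⇒≈ (∈-resp (trans (lemma P α H₂ X Y H) (trans (cong (λ x → ((P * (A * H₂ + B * X + C * Y)) - (ℕ→ℚ 3 * α - ℕ→ℚ 2) * H) + B * (H - x)) PΣu/k²≡H) (lemma′ _ B H)))
      (((½-int *ᴵ (α-int -ᴵ ℕ-int 1) *ᴵ (α-int -ᴵ ℕ-int 2)) ·∈ ≈⇒∈ PH₂≈-2H) +∈ ((½-int *ᴵ α-int *ᴵ (α-int -ᴵ ℕ-int 1)) ·∈ ≈⇒∈ PΣu²/k²≈4H))))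
    where
    open Expansion m p-prime 5<p a using (α; α-int; U; pred≤q)
    X = Σ₁ q (λ k → u (ℕ.pred k) * inv² k)
    Y = Σ₁ q (λ k → u (ℕ.pred k) * u (ℕ.pred k) * inv² k)
    A = ½ * (α - 1ℚ) * (α - ℕ→ℚ 2)
    B = - (α * (α - ℕ→ℚ 2))
    C = ½ * α * (α - 1ℚ)
    lemma′ : ∀ x b h → x + b * (h - h) ≡ x
    lemma′ = solve-∀ ℚ-ring
    lemma : ∀ P α H₂ X Y H →
      ½ * (α - 1ℚ) * (α - ℕ→ℚ 2) * (P * H₂ - - (ℕ→ℚ 2 * H)) + ½ * α * (α - 1ℚ) * (P * Y - ℕ→ℚ 4 * H)
      ≡ ((P * (½ * (α - 1ℚ) * (α - ℕ→ℚ 2) * H₂ + - (α * (α - ℕ→ℚ 2)) * X + ½ * α * (α - 1ℚ) * Y)) - (ℕ→ℚ 3 * α - ℕ→ℚ 2) * H)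
        + - (α * (α - ℕ→ℚ 2)) * (H - P * X)
    lemma = solve-∀ ℚ-ring
    interpolate : ∀ k → k ∈[1, q ] → U (ℕ.pred k) * inv² k
      ≈ ½ * (α - 1ℚ) * (α - ℕ→ℚ 2) * inv² k + - (α * (α - ℕ→ℚ 2)) * (u (ℕ.pred k) * inv² k)
        + ½ * α * (α - 1ℚ) * (u (ℕ.pred k) * u (ℕ.pred k) * inv² k) [ 3 ]
    interpolate k k∈ = ≈-trans (≈-reflexive (ℚ.*-comm (U (ℕ.pred k)) (inv² k)))
      (≈-trans (*-congˡ-≈ (int⇒∈ (i-int *ᴵ i-int)) (≈-trans (≈-reflexive (cong (_^ℤ a) (sym (1+[u-1] (ℕ.pred k)))))
        (^ℤ-truncated₃ (u-1∈ (ℕ.pred k) (pred≤q k k∈)) a)))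
      (≈-reflexive (lemma₁ α (u (ℕ.pred k)) (inv² k))))
      where
      i-int = inv-int k k∈
      lemma₁ : ∀ α u i → i * (1ℚ + α * (u - 1ℚ) + ½ * α * (α - 1ℚ) * (u - 1ℚ) * (u - 1ℚ))
        ≡ ½ * (α - 1ℚ) * (α - ℕ→ℚ 2) * i + - (α * (α - ℕ→ℚ 2)) * (u * i) + ½ * α * (α - 1ℚ) * (u * u * i)
      lemma₁ = solve-∀ ℚ-ring

-- Bernoulli and Genocchi numbers

binomialTransform-linear : ∀ a b f g n →
  binomialTransform (λ k → a * f k + b * g k) n ≡ a * binomialTransform f n + b * binomialTransform g n
binomialTransform-linear a b f g n = begin
  a * f 0 + b * g 0 + Σ₁ n (λ k → ℕ→ℚ (n C k) * (a * f k + b * g k))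
    ≡⟨ cong (λ x → a * f 0 + b * g 0 + x) (Σ₁-cong n λ k _ → lemma (ℕ→ℚ (n C k)) a b (f k) (g k)) ⟩
  a * f 0 + b * g 0 + Σ₁ n (λ k → a * (ℕ→ℚ (n C k) * f k) + b * (ℕ→ℚ (n C k) * g k))
    ≡⟨ cong (λ x → a * f 0 + b * g 0 + x) (trans (Σ₁-+ n (λ k → a * (ℕ→ℚ (n C k) * f k)) _) (cong₂ _+_ (Σ₁-* n a _) (Σ₁-* n b _))) ⟩
  a * f 0 + b * g 0 + (a * Σ₁ n (λ k → ℕ→ℚ (n C k) * f k) + b * Σ₁ n (λ k → ℕ→ℚ (n C k) * g k))
    ≡⟨ lemma′ a b (f 0) (g 0) (Σ₁ n (λ k → ℕ→ℚ (n C k) * f k)) (Σ₁ n (λ k → ℕ→ℚ (n C k) * g k)) ⟩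
  a * (f 0 + Σ₁ n (λ k → ℕ→ℚ (n C k) * f k)) + b * (g 0 + Σ₁ n (λ k → ℕ→ℚ (n C k) * g k)) ∎
  where
  open ≡-Reasoning
  lemma : ∀ c a b f g → c * (a * f + b * g) ≡ a * (c * f) + b * (c * g)
  lemma = solve-∀ ℚ-ring
  lemma′ : ∀ a b f g x y → a * f + b * g + (a * x + b * y) ≡ a * (f + x) + b * (g + y)
  lemma′ = solve-∀ ℚ-ring

binomialTransform-power : ∀ x c n → binomialTransform (λ k → c * x ^ℚ k) n ≡ c * (1ℚ + x) ^ℚ n
binomialTransform-power x c zero    = ℚ.+-identityʳ _
binomialTransform-power x c (suc n) = begin
  binomialTransform (λ k → c * x ^ℚ k) (suc n)                  ≡⟨ binomialTransform-suc (λ k → c * x ^ℚ k) n ⟩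
  binomialTransform (λ k → c * x ^ℚ k) n + binomialTransform (λ k → c * (x * x ^ℚ k)) n
    ≡⟨ cong₂ _+_ (binomialTransform-power x c n) (trans (binomialTransform-cong n λ k → sym (ℚ.*-assoc c x (x ^ℚ k))) (binomialTransform-power x (c * x) n)) ⟩
  c * (1ℚ + x) ^ℚ n + c * x * (1ℚ + x) ^ℚ n                     ≡⟨ lemma c x ((1ℚ + x) ^ℚ n) ⟩
  c * ((1ℚ + x) * (1ℚ + x) ^ℚ n)                                ∎
  where
  open ≡-Reasoning
  lemma : ∀ c x y → c * y + c * x * y ≡ c * ((1ℚ + x) * y)
  lemma = solve-∀ ℚ-ring

-- That is, (e^t - 1) f = 0 forces f = 0: the coefficient of index n+1 is (n+1) f(n) plus terms in
-- earlier values, which vanish by induction.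
binomialTransform-fixed⇒0 : ∀ f → (∀ n → binomialTransform f n ≡ f n) → ∀ n → f n ≡ 0ℚ
binomialTransform-fixed⇒0 f fixed n = below (suc n) n ℕ.≤-refl
  where
  next : ∀ n → (∀ k → k < n → f k ≡ 0ℚ) → f n ≡ 0ℚ
  next zero f≡0 = trans (lemma (f 0) (f 1)) (trans (cong (_- f 1) (fixed 1)) (ℚ.+-inverseʳ (f 1)))
    where
    lemma : ∀ x y → x ≡ x + (0ℚ + 1ℚ * y) - y
    lemma = solve-∀ ℚ-ring
  next (suc n) f≡0 = *-cancelˡ-≢0 (ℕ→ℚ-suc≢0 (suc n)) (begin
    ℕ→ℚ (suc (suc n)) * f (suc n)                 ≡⟨ lemma (ℕ→ℚ (suc (suc n)) * f (suc n)) (f (suc (suc n))) ⟩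
    0ℚ + (0ℚ + ℕ→ℚ (suc (suc n)) * f (suc n) + 1ℚ * f (suc (suc n))) - f (suc (suc n))
      ≡⟨ cong₂ (λ x y → 0ℚ + (0ℚ + ℕ→ℚ x * f (suc n) + ℕ→ℚ y * f (suc (suc n))) - f (suc (suc n))) ([1+n]Cn≡1+n (suc n)) (nCn≡1 (suc (suc n))) ⟨
    0ℚ + (0ℚ + c (suc n) * f (suc n) + c (suc (suc n)) * f (suc (suc n))) - f (suc (suc n))
      ≡⟨ cong₂ (λ x y → x + (y + c (suc n) * f (suc n) + c (suc (suc n)) * f (suc (suc n))) - f (suc (suc n)))
           (f≡0 0 (s≤s z≤n)) (Σ₁-zero n λ { k (_ , k≤n) → trans (cong (c k *_) (f≡0 k (s≤s k≤n))) (ℚ.*-zeroʳ (c k)) }) ⟨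
    binomialTransform f (suc (suc n)) - f (suc (suc n)) ≡⟨ cong (_- f (suc (suc n))) (fixed (suc (suc n))) ⟩
    f (suc (suc n)) - f (suc (suc n))             ≡⟨ ℚ.+-inverseʳ (f (suc (suc n))) ⟩
    0ℚ                                            ≡⟨ ℚ.*-zeroʳ (ℕ→ℚ (suc (suc n))) ⟨
    ℕ→ℚ (suc (suc n)) * 0ℚ                        ∎)
    where
    open ≡-Reasoning
    c = λ k → ℕ→ℚ (suc (suc n) C k)
    lemma : ∀ x y → x ≡ 0ℚ + (0ℚ + x + 1ℚ * y) - y
    lemma = solve-∀ ℚ-ring
  below : ∀ n k → k < n → f k ≡ 0ℚ
  below (suc n) k (s≤s k≤n) = next k (λ j j<k → below n j (ℕ.<-≤-trans j<k k≤n))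

-- On exponential generating functions, iterate N is multiplication by e^{Nt}.
iterate : ℕ → (ℕ → ℚ) → ℕ → ℚ
iterate zero    f = f
iterate (suc N) f = binomialTransform (iterate N f)

iterate-linear : ∀ N a b f g n → iterate N (λ k → a * f k + b * g k) n ≡ a * iterate N f n + b * iterate N g n
iterate-linear zero    a b f g n = refl
iterate-linear (suc N) a b f g n = trans (binomialTransform-cong n (iterate-linear N a b f g)) (binomialTransform-linear a b (iterate N f) (iterate N g) n)

iterate-cong : ∀ N {f g} n → (∀ k → f k ≡ g k) → iterate N f n ≡ iterate N g n
iterate-cong zero    n f≡g = f≡g n
iterate-cong (suc N) n f≡g = binomialTransform-cong n (λ k → iterate-cong N k f≡g)

iterate-0 : ∀ N f → iterate N f 0 ≡ f 0
iterate-0 zero    f = refl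
iterate-0 (suc N) f = trans (ℚ.+-identityʳ (iterate N f 0)) (iterate-0 N f)

iterate-comm : ∀ N f n → iterate N (binomialTransform f) n ≡ iterate (suc N) f n
iterate-comm zero    f n = refl
iterate-comm (suc N) f n = binomialTransform-cong n (iterate-comm N f)

-- Coefficientwise, (e^(Nt) f)′ = N e^(Nt) f + e^(Nt) f′.
iterate-suc : ∀ N f n → iterate N f (suc n) ≡ ℕ→ℚ N * iterate N f n + iterate N (f ∘ suc) n
iterate-suc zero    f n = lemma (f n) (f (suc n))
  where
  lemma : ∀ x y → y ≡ 0ℚ * x + y
  lemma = solve-∀ ℚ-ring
iterate-suc (suc N) f n = begin
  binomialTransform (iterate N f) (suc n)
    ≡⟨ binomialTransform-suc (iterate N f) n ⟩
  x + binomialTransform (iterate N f ∘ suc) n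
    ≡⟨ cong (λ z → x + z) (binomialTransform-cong n λ k → trans (iterate-suc N f k) (cong (λ z → ℕ→ℚ N * iterate N f k + z) (sym (ℚ.*-identityˡ (iterate N (f ∘ suc) k))))) ⟩
  x + binomialTransform (λ k → ℕ→ℚ N * iterate N f k + 1ℚ * iterate N (f ∘ suc) k) n
    ≡⟨ cong (λ z → x + z) (binomialTransform-linear (ℕ→ℚ N) 1ℚ (iterate N f) (iterate N (f ∘ suc)) n) ⟩
  x + (ℕ→ℚ N * x + 1ℚ * y)
    ≡⟨ lemma (ℕ→ℚ N) x y ⟩
  (ℕ→ℚ N + 1ℚ) * x + y
    ≡⟨ cong (λ z → z * x + y) (ℕ→ℚ-suc N) ⟨
  ℕ→ℚ (suc N) * x + y ∎
  where
  open ≡-Reasoning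
  x = binomialTransform (iterate N f) n
  y = binomialTransform (iterate N (f ∘ suc)) n
  lemma : ∀ N x y → x + (N * x + 1ℚ * y) ≡ (N + 1ℚ) * x + y
  lemma = solve-∀ ℚ-ring

-- The numbers 2ᵏ f(k) belong to f(2t), and e^(2t) f(2t) is e^t f(t) evaluated at 2t.
iterate-scaled : ∀ f n → iterate 2 (λ k → ℕ→ℚ 2 ^ℚ k * f k) n ≡ ℕ→ℚ 2 ^ℚ n * binomialTransform f n
iterate-scaled f zero    = lemma (f 0)
  where
  lemma : ∀ x → 1ℚ * x + 0ℚ + 0ℚ ≡ 1ℚ * (x + 0ℚ)
  lemma = solve-∀ ℚ-ring
iterate-scaled f (suc n) = begin
  iterate 2 g (suc n)                                                      ≡⟨ iterate-suc 2 g n ⟩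
  ℕ→ℚ 2 * iterate 2 g n + iterate 2 (g ∘ suc) n                            ≡⟨ cong (λ z → ℕ→ℚ 2 * iterate 2 g n + z) (trans (iterate-cong 2 n (λ k → lemma (ℕ→ℚ 2 ^ℚ k) (f (suc k)))) (iterate-linear 2 (ℕ→ℚ 2) 0ℚ h h n)) ⟩
  ℕ→ℚ 2 * iterate 2 g n + (ℕ→ℚ 2 * iterate 2 h n + 0ℚ * iterate 2 h n)
    ≡⟨ cong₂ (λ x y → ℕ→ℚ 2 * x + (ℕ→ℚ 2 * y + 0ℚ * iterate 2 h n)) (iterate-scaled f n) (iterate-scaled (f ∘ suc) n) ⟩
  ℕ→ℚ 2 * (t * x) + (ℕ→ℚ 2 * (t * y) + 0ℚ * iterate 2 h n)                 ≡⟨ lemma′ t x y (iterate 2 h n) ⟩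
  ℕ→ℚ 2 * t * (x + y)                                                      ≡⟨ cong (ℕ→ℚ 2 * t *_) (binomialTransform-suc f n) ⟨
  ℕ→ℚ 2 * t * binomialTransform f (suc n)                                  ∎
  where
  open ≡-Reasoning
  g = λ k → ℕ→ℚ 2 ^ℚ k * f k
  h = λ k → ℕ→ℚ 2 ^ℚ k * f (suc k)
  t = ℕ→ℚ 2 ^ℚ n
  x = binomialTransform f n
  y = binomialTransform (f ∘ suc) n
  lemma : ∀ s y → ℕ→ℚ 2 * s * y ≡ ℕ→ℚ 2 * (s * y) + 0ℚ * (s * y)
  lemma = solve-∀ ℚ-ring
  lemma′ : ∀ t x y z → ℕ→ℚ 2 * (t * x) + (ℕ→ℚ 2 * (t * y) + 0ℚ * z) ≡ ℕ→ℚ 2 * t * (x + y)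
  lemma′ = solve-∀ ℚ-ring

-- Coefficients of the generating functions 1 and t.
δ₀ δ₁ : ℕ → ℚ
δ₀ zero    = 1ℚ
δ₀ (suc _) = 0ℚ
δ₁ zero    = 0ℚ
δ₁ (suc n) = δ₀ n

iterate-zero : ∀ N n → iterate N (λ _ → 0ℚ) n ≡ 0ℚ
iterate-zero zero    n = refl
iterate-zero (suc N) n = trans (binomialTransform-cong n (iterate-zero N))
  (trans (cong (0ℚ +_) (Σ₁-zero n λ k _ → ℚ.*-zeroʳ (ℕ→ℚ (n C k)))) refl)

iterate-δ₀ : ∀ N n → iterate N δ₀ n ≡ ℕ→ℚ N ^ℚ n
iterate-δ₀ N zero    = iterate-0 N δ₀
iterate-δ₀ N (suc n) = trans (iterate-suc N δ₀ n) (trans (cong₂ _+_ (cong (ℕ→ℚ N *_) (iterate-δ₀ N n)) (iterate-zero N n)) (ℚ.+-identityʳ _))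

iterate-δ₁ : ∀ N n → iterate N δ₁ (suc n) ≡ ℕ→ℚ (suc n) * ℕ→ℚ N ^ℚ n
iterate-δ₁ N zero    = trans (iterate-suc N δ₁ 0) (trans (cong₂ (λ x y → ℕ→ℚ N * x + y) (iterate-0 N δ₁) (iterate-0 N δ₀)) (lemma (ℕ→ℚ N)))
  where
  lemma : ∀ x → x * 0ℚ + 1ℚ ≡ 1ℚ
  lemma = solve-∀ ℚ-ring
iterate-δ₁ N (suc n) = trans (iterate-suc N δ₁ (suc n)) (trans (cong₂ (λ x y → ℕ→ℚ N * x + y) (iterate-δ₁ N n) (iterate-δ₀ N (suc n)))
  (trans (lemma (ℕ→ℚ N) (ℕ→ℚ (suc n)) (ℕ→ℚ N ^ℚ n)) (cong (_* (ℕ→ℚ N * ℕ→ℚ N ^ℚ n)) (sym (ℕ→ℚ-suc (suc n))))))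
  where
  lemma : ∀ N n x → N * (n * x) + N * x ≡ (n + 1ℚ) * (N * x)
  lemma = solve-∀ ℚ-ring

nth-++ˡ : ∀ xs ys {k} → k < length xs → nth (xs ++ ys) k ≡ nth xs k
nth-++ˡ (x ∷ xs) ys {zero}  _         = refl
nth-++ˡ (x ∷ xs) ys {suc k} (s≤s k<n) = nth-++ˡ xs ys k<n

nth-++-length : ∀ xs y → nth (xs ++ y ∷ []) (length xs) ≡ y
nth-++-length []       y = refl
nth-++-length (x ∷ xs) y = nth-++-length xs y

length-bernList : ∀ n → length (bernList n) ≡ suc n
length-bernList zero    = refl
length-bernList (suc n) = trans (List.length-++ (bernList n)) (trans (cong (ℕ._+ 1) (length-bernList n)) (ℕ.+-comm (suc n) 1))

nth-bernList : ∀ n k → k ≤ n → nth (bernList n) k ≡ bernoulli k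
nth-bernList zero    zero z≤n = refl
nth-bernList (suc n) k k≤1+n with k ℕ.≟ suc n
... | yes refl = refl
... | no k≢1+n = trans (nth-++ˡ (bernList n) _ (subst (k <_) (sym (length-bernList n)) k<1+n)) (nth-bernList n k (ℕ.≤-pred k<1+n))
  where k<1+n = ℕ.≤∧≢⇒< k≤1+n k≢1+n

bernoulli-recurrence : ∀ n → ℕ→ℚ (suc (suc n)) * bernoulli (suc n) ≡ - (1ℚ + Σ₁ n (λ k → ℕ→ℚ (suc (suc n) C k) * bernoulli k))
bernoulli-recurrence n = begin
  ν * bernoulli (suc n)                  ≡⟨ cong (ν *_) (trans (cong (nth (bernList (suc n))) (sym (length-bernList n))) (nth-++-length (bernList n) _)) ⟩
  ν * - (s ÷' ν)                         ≡⟨ ℚ.neg-distribʳ-* ν (s ÷' ν) ⟨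
  - (ν * (s ÷' ν))                       ≡⟨ cong -_ (÷'-cancel s (ℕ→ℚ-suc≢0 (suc n))) ⟩
  - s                                    ≡⟨ cong -_ (trans (Σ<≡Σ₁ n (λ k → ℕ→ℚ (suc (suc n) C k) * nth (bernList n) k)) (cong₂ _+_ (cong (1ℚ *_) (nth-bernList n 0 z≤n))
                                              (Σ₁-cong n λ { k (_ , k≤n) → cong (ℕ→ℚ (suc (suc n) C k) *_) (nth-bernList n k k≤n) }))) ⟩
  - (1ℚ + Σ₁ n (λ k → ℕ→ℚ (suc (suc n) C k) * bernoulli k)) ∎
  where
  open ≡-Reasoning
  ν = ℕ→ℚ (suc (suc n))
  s = Σ< (suc n) (λ k → ℕ→ℚ (suc (suc n) C k) * nth (bernList n) k)

-- The Bernoulli recurrence in the form (e^t - 1) B(t) = t.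
binomialTransform-bernoulli : ∀ n → binomialTransform bernoulli n ≡ bernoulli n + δ₁ n
binomialTransform-bernoulli zero    = refl
binomialTransform-bernoulli (suc zero) = refl
binomialTransform-bernoulli (suc (suc n)) = begin
  1ℚ + (s + ℕ→ℚ (suc (suc n) C suc n) * bernoulli (suc n) + ℕ→ℚ (suc (suc n) C suc (suc n)) * b)
    ≡⟨ cong₂ (λ x y → 1ℚ + (s + ℕ→ℚ x * bernoulli (suc n) + ℕ→ℚ y * b)) ([1+n]Cn≡1+n (suc n)) (nCn≡1 (suc (suc n))) ⟩
  1ℚ + (s + ℕ→ℚ (suc (suc n)) * bernoulli (suc n) + 1ℚ * b)
    ≡⟨ cong (λ x → 1ℚ + (s + x + 1ℚ * b)) (bernoulli-recurrence n) ⟩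
  1ℚ + (s + - (1ℚ + s) + 1ℚ * b)
    ≡⟨ lemma s b ⟩
  b + 0ℚ ∎
  where
  open ≡-Reasoning
  s = Σ₁ n (λ k → ℕ→ℚ (suc (suc n) C k) * bernoulli k)
  b = bernoulli (suc (suc n))
  lemma : ∀ s b → 1ℚ + (s + - (1ℚ + s) + 1ℚ * b) ≡ b + 0ℚ
  lemma = solve-∀ ℚ-ring

genocchi : ℕ → ℚ
genocchi n = ℕ→ℚ 2 * bernoulli n + - ℕ→ℚ 2 * (ℕ→ℚ 2 ^ℚ n * bernoulli n)

-- Genocchi numbers have generating function 2t/(eᵗ+1). Multiplying both sides by eᵗ-1 reduces the claim
-- to the generating function t/(eᵗ-1) of the Bernoulli numbers at t and at 2t.
binomialTransform-genocchi : ∀ n → binomialTransform genocchi n + genocchi n ≡ ℕ→ℚ 2 * δ₁ n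
binomialTransform-genocchi n = x-y≡0⇒x≡y (trans (unfold (binomialTransform genocchi n) (genocchi n) (δ₁ n)) (binomialTransform-fixed⇒0 E fixed n))
  where
  open ≡-Reasoning
  -- `E` has generating function (e^t + 1) G(t) - 2t, and `fixed` says that e^t - 1 annihilates it.
  E₁ E : ℕ → ℚ
  E₁ n = 1ℚ * binomialTransform genocchi n + 1ℚ * genocchi n
  E n = 1ℚ * E₁ n + - ℕ→ℚ 2 * δ₁ n
  unfold : ∀ x y d → x + y - ℕ→ℚ 2 * d ≡ 1ℚ * (1ℚ * x + 1ℚ * y) + - ℕ→ℚ 2 * d
  unfold = solve-∀ ℚ-ring
  2^n*δ₁ : ∀ n → ℕ→ℚ 2 ^ℚ n * δ₁ n ≡ ℕ→ℚ 2 * δ₁ n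
  2^n*δ₁ zero          = refl
  2^n*δ₁ (suc zero)    = refl
  2^n*δ₁ (suc (suc n)) = trans (ℚ.*-zeroʳ (ℕ→ℚ 2 ^ℚ suc (suc n))) (sym (ℚ.*-zeroʳ (ℕ→ℚ 2)))
  T²B : ∀ n → iterate 2 bernoulli n ≡ bernoulli n + δ₁ n + binomialTransform δ₁ n
  T²B n = begin
    iterate 2 bernoulli n                                                ≡⟨ binomialTransform-cong n (λ k → trans (binomialTransform-bernoulli k) (one (bernoulli k) (δ₁ k))) ⟩
    binomialTransform (λ k → 1ℚ * bernoulli k + 1ℚ * δ₁ k) n             ≡⟨ binomialTransform-linear 1ℚ 1ℚ bernoulli δ₁ n ⟩
    1ℚ * binomialTransform bernoulli n + 1ℚ * binomialTransform δ₁ n     ≡⟨ one (binomialTransform bernoulli n) (binomialTransform δ₁ n) ⟨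
    binomialTransform bernoulli n + binomialTransform δ₁ n               ≡⟨ cong (_+ binomialTransform δ₁ n) (binomialTransform-bernoulli n) ⟩
    bernoulli n + δ₁ n + binomialTransform δ₁ n                          ∎
    where
    one : ∀ x y → x + y ≡ 1ℚ * x + 1ℚ * y
    one = solve-∀ ℚ-ring
  T²G : ∀ n → iterate 2 genocchi n ≡ genocchi n + ℕ→ℚ 2 * binomialTransform δ₁ n - ℕ→ℚ 2 * δ₁ n
  T²G n = begin
    iterate 2 genocchi n
      ≡⟨ iterate-linear 2 (ℕ→ℚ 2) (- ℕ→ℚ 2) bernoulli (λ k → ℕ→ℚ 2 ^ℚ k * bernoulli k) n ⟩
    ℕ→ℚ 2 * iterate 2 bernoulli n + - ℕ→ℚ 2 * iterate 2 (λ k → ℕ→ℚ 2 ^ℚ k * bernoulli k) n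
      ≡⟨ cong₂ (λ x y → ℕ→ℚ 2 * x + - ℕ→ℚ 2 * y) (T²B n) (trans (iterate-scaled bernoulli n) (cong (ℕ→ℚ 2 ^ℚ n *_) (binomialTransform-bernoulli n))) ⟩
    ℕ→ℚ 2 * (bernoulli n + δ₁ n + binomialTransform δ₁ n) + - ℕ→ℚ 2 * (ℕ→ℚ 2 ^ℚ n * (bernoulli n + δ₁ n))
      ≡⟨ lemma (bernoulli n) (δ₁ n) (binomialTransform δ₁ n) (ℕ→ℚ 2 ^ℚ n) ⟩
    genocchi n + ℕ→ℚ 2 * binomialTransform δ₁ n - ℕ→ℚ 2 * (ℕ→ℚ 2 ^ℚ n * δ₁ n - δ₁ n)
      ≡⟨ cong (λ x → genocchi n + ℕ→ℚ 2 * binomialTransform δ₁ n - ℕ→ℚ 2 * (x - δ₁ n)) (2^n*δ₁ n) ⟩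
    genocchi n + ℕ→ℚ 2 * binomialTransform δ₁ n - ℕ→ℚ 2 * (ℕ→ℚ 2 * δ₁ n - δ₁ n)
      ≡⟨ lemma′ (genocchi n) (binomialTransform δ₁ n) (δ₁ n) ⟩
    genocchi n + ℕ→ℚ 2 * binomialTransform δ₁ n - ℕ→ℚ 2 * δ₁ n ∎
    where
    lemma : ∀ b d t x → ℕ→ℚ 2 * (b + d + t) + - ℕ→ℚ 2 * (x * (b + d)) ≡ (ℕ→ℚ 2 * b + - ℕ→ℚ 2 * (x * b)) + ℕ→ℚ 2 * t - ℕ→ℚ 2 * (x * d - d)
    lemma = solve-∀ ℚ-ring
    lemma′ : ∀ g t d → g + ℕ→ℚ 2 * t - ℕ→ℚ 2 * (ℕ→ℚ 2 * d - d) ≡ g + ℕ→ℚ 2 * t - ℕ→ℚ 2 * d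
    lemma′ = solve-∀ ℚ-ring
  fixed : ∀ n → binomialTransform E n ≡ E n
  fixed n = begin
    binomialTransform E n
      ≡⟨ binomialTransform-linear 1ℚ (- ℕ→ℚ 2) E₁ δ₁ n ⟩
    1ℚ * binomialTransform E₁ n + - ℕ→ℚ 2 * binomialTransform δ₁ n
      ≡⟨ cong (λ x → 1ℚ * x + - ℕ→ℚ 2 * binomialTransform δ₁ n) (binomialTransform-linear 1ℚ 1ℚ (binomialTransform genocchi) genocchi n) ⟩
    1ℚ * (1ℚ * iterate 2 genocchi n + 1ℚ * binomialTransform genocchi n) + - ℕ→ℚ 2 * binomialTransform δ₁ n
      ≡⟨ cong (λ x → 1ℚ * (1ℚ * x + 1ℚ * binomialTransform genocchi n) + - ℕ→ℚ 2 * binomialTransform δ₁ n) (T²G n) ⟩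
    1ℚ * (1ℚ * (genocchi n + ℕ→ℚ 2 * binomialTransform δ₁ n - ℕ→ℚ 2 * δ₁ n) + 1ℚ * binomialTransform genocchi n) + - ℕ→ℚ 2 * binomialTransform δ₁ n
      ≡⟨ lemma (genocchi n) (binomialTransform δ₁ n) (δ₁ n) (binomialTransform genocchi n) ⟩
    E n ∎
    where
    lemma : ∀ g t d x → 1ℚ * (1ℚ * (g + ℕ→ℚ 2 * t - ℕ→ℚ 2 * d) + 1ℚ * x) + - ℕ→ℚ 2 * t ≡ 1ℚ * (1ℚ * x + 1ℚ * g) + - ℕ→ℚ 2 * d
    lemma = solve-∀ ℚ-ring

-- Alternating power sums, a Kummer congruence, and H modulo p⁴

module BernoulliSide (m : ℕ) (p-prime : Prime (suc (m ℕ.+ m))) (5<p : 5 < suc (m ℕ.+ m)) where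
  open Powers m p-prime 5<p
  open SecondSum m p-prime 5<p using (H₃∈)

  -- Induction on k by the binomial theorem: for 0 < j < p, C(p,j) = (p/j) C(q,j-1) is divisible by
  -- p.
  fermat-p : ∀ k → ℕ→ℚ k ^ℚ p ≈ ℕ→ℚ k [ 1 ]
  fermat-p zero    = ≈-reflexive (ℚ.*-zeroˡ (0ℚ ^ℚ q))
  fermat-p (suc k) = ≈-trans (≈-reflexive (trans (cong (_^ℚ p) (ℕ→ℚ-+ 1 k))
      (trans (sym (ℚ.*-identityˡ _)) (sym (binomialTransform-power (ℕ→ℚ k) 1ℚ p)))))
    (≈-trans (+-congˡ-≈ 1ℚ (+-cong-≈ (∈⇒≈0 middle) (≈-trans (≈-reflexive last) (fermat-p k))))
      (≈-reflexive (trans (lemma (ℕ→ℚ k)) (sym (ℕ→ℚ-suc k)))))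
    where
    lemma : ∀ x → 1ℚ + (0ℚ + x) ≡ x + 1ℚ
    lemma = solve-∀ ℚ-ring
    last : ℕ→ℚ (p C p) * (1ℚ * ℕ→ℚ k ^ℚ p) ≡ ℕ→ℚ k ^ℚ p
    last = trans (cong (λ x → ℕ→ℚ x * (1ℚ * ℕ→ℚ k ^ℚ p)) (nCn≡1 p)) (trans (ℚ.*-identityˡ _) (ℚ.*-identityˡ _))
    middle : Σ₁ q (λ j → ℕ→ℚ (p C j) * (1ℚ * ℕ→ℚ k ^ℚ j)) ∈𝔭^ 1
    middle = ∈-Σ₁ q λ { (suc j) j∈ → ∈-resp (cong (_* (1ℚ * ℕ→ℚ k ^ℚ suc j)) (sym (ℕ→ℚ-absorb-inv q j)))
      (((P∈ *∈ int⇒∈ (inv-int (suc j) j∈)) *∈ int⇒∈ (ℕ-int (q C j))) *∈ int⇒∈ (ℕ-int 1 *ᴵ ^-int (suc j) (ℕ-int k))) }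

  fermat : ∀ k → k ∈[1, q ] → ℕ→ℚ k ^ℚ q ≈ 1ℚ [ 1 ]
  fermat k k∈ = ≈-cancel (ℕ-unit (p∤index k k∈)) (≈-trans (fermat-p k) (≈-reflexive (sym (ℚ.*-identityʳ (ℕ→ℚ k)))))

  -- `binomialTransform-genocchi` expresses 2 G(n) by earlier values, so only 2 enters the
  -- denominators.
  genocchi-int : ∀ n → Integral (genocchi n)
  genocchi-int n = below (suc n) n ℕ.≤-refl
    where
    δ₁-int : ∀ n → Integral (δ₁ n)
    δ₁-int zero          = ℕ-int 0
    δ₁-int (suc zero)    = ℕ-int 1
    δ₁-int (suc (suc n)) = ℕ-int 0
    next : ∀ n → (∀ k → k < n → Integral (genocchi k)) → Integral (genocchi n)
    next zero    g-int = ℕ-int 0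
    next (suc n) g-int = subst Integral (begin
      δ₁ (suc n) - ½ * s                                             ≡⟨ lemma (δ₁ (suc n)) s ⟩
      ½ * (ℕ→ℚ 2 * δ₁ (suc n)) - ½ * s                               ≡⟨ cong (λ x → ½ * x - ½ * s) (binomialTransform-genocchi (suc n)) ⟨
      ½ * (0ℚ + (s + ℕ→ℚ (suc n C suc n) * g) + g) - ½ * s           ≡⟨ cong (λ x → ½ * (0ℚ + (s + ℕ→ℚ x * g) + g) - ½ * s) (nCn≡1 (suc n)) ⟩
      ½ * (0ℚ + (s + 1ℚ * g) + g) - ½ * s                            ≡⟨ lemma′ s g ⟩
      g                                                              ∎)
      (δ₁-int (suc n) -ᴵ ½-int *ᴵ Σ₁-int n λ { k (_ , k≤n) → ℕ-int (suc n C k) *ᴵ g-int k (s≤s k≤n) })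
      where
      open ≡-Reasoning
      s = Σ₁ n (λ k → ℕ→ℚ (suc n C k) * genocchi k)
      g = genocchi (suc n)
      lemma : ∀ d s → d - ½ * s ≡ ½ * (ℕ→ℚ 2 * d) - ½ * s
      lemma = solve-∀ ℚ-ring
      lemma′ : ∀ s g → ½ * (0ℚ + (s + 1ℚ * g) + g) - ½ * s ≡ g
      lemma′ = solve-∀ ℚ-ring
    below : ∀ n k → k < n → Integral (genocchi k)
    below (suc n) k (s≤s k≤n) = next k (λ j j<k → below n j (ℕ.<-≤-trans j<k k≤n))

  iterate-p-≈₁ : ∀ f → (∀ n → Integral (f n)) → ∀ n → iterate p f n ≈ f n [ 1 ]
  iterate-p-≈₁ f f-int zero    = ≈-reflexive (iterate-0 p f)
  iterate-p-≈₁ f f-int (suc n) = ≈-trans (≈-reflexive (iterate-suc p f n))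
    (≈-trans (+-cong-≈ (∈⇒≈0 (P∈ *∈ int⇒∈ (∈⇒int (∈-≈ (≈-weaken 1 0 (iterate-p-≈₁ f f-int n)) (int⇒∈ (f-int n)))))) (iterate-p-≈₁ (f ∘ suc) (f-int ∘ suc) n))
      (≈-reflexive (ℚ.+-identityˡ (f (suc n)))))

  -- Here e^(pt) ≡ 1 + pt (mod p²), and multiplication by t turns f(n) into n f(n-1). At n = 0 the
  -- value of `ℕ.pred` is harmless under the factor n.
  iterate-p-≈₂ : ∀ f → (∀ n → Integral (f n)) → ∀ n → iterate p f n ≈ f n + ℕ→ℚ n * P * f (ℕ.pred n) [ 2 ]
  iterate-p-≈₂ f f-int zero    = ≈-reflexive (trans (iterate-0 p f) (lemma (f 0) P))
    where
    lemma : ∀ x P → x ≡ x + 0ℚ * P * x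
    lemma = solve-∀ ℚ-ring
  iterate-p-≈₂ f f-int (suc n) = ≈-trans (≈-reflexive (iterate-suc p f n))
    (≈-trans (+-cong-≈ (*-congˡ-≈ P∈ (iterate-p-≈₁ f f-int n)) (iterate-p-≈₂ (f ∘ suc) (f-int ∘ suc) n))
      (≈-reflexive (trans (cong (λ x → P * f n + (f (suc n) + x)) (shifted n)) (trans (lemma P (f n) (f (suc n)) (ℕ→ℚ n)) (cong (λ x → f (suc n) + x * P * f n) (sym (ℕ→ℚ-suc n)))))))
    where
    shifted : ∀ n → ℕ→ℚ n * P * f (suc (ℕ.pred n)) ≡ ℕ→ℚ n * P * f n
    shifted zero    = lemma₀ P (f 1) (f 0)
      where
      lemma₀ : ∀ P x y → 0ℚ * P * x ≡ 0ℚ * P * y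
      lemma₀ = solve-∀ ℚ-ring
    shifted (suc n) = refl
    lemma : ∀ P x y ν → P * x + (y + ν * P * x) ≡ y + (ν + 1ℚ) * P * x
    lemma = solve-∀ ℚ-ring

  alternating : ℕ → ℚ
  alternating e = Σ₁ q (λ k → sgn k * ℕ→ℚ k ^ℚ suc e)

  -- The sum of (-1)ᵏ e^(kt) (e^t + 1) G telescopes, and equals that of (-1)ᵏ 2t e^(kt), with n-th
  -- coefficients (-1)ᵏ 2n kⁿ⁻¹. The lower end e^t G has coefficient -G(n), because δ₁ vanishes for
  -- n ≥ 2.
  alternating-genocchi : ∀ e → ℕ→ℚ 2 * ℕ→ℚ (suc (suc e)) * alternating e ≡ iterate p genocchi (suc (suc e)) + genocchi (suc (suc e))
  alternating-genocchi e = begin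
    ℕ→ℚ 2 * ℕ→ℚ n * alternating e                                       ≡⟨ Σ₁-* q (ℕ→ℚ 2 * ℕ→ℚ n) _ ⟨
    Σ₁ q (λ k → ℕ→ℚ 2 * ℕ→ℚ n * (sgn k * ℕ→ℚ k ^ℚ suc e))               ≡⟨ Σ₁-cong q difference ⟩
    Σ₁ q (λ k → g k - g (ℕ.pred k))                                     ≡⟨ Σ₁-telescope q g ⟩
    sgn q * iterate p genocchi n - 1ℚ * binomialTransform genocchi n     ≡⟨ cong (λ x → x * iterate p genocchi n - 1ℚ * binomialTransform genocchi n) sgn-q ⟩
    1ℚ * iterate p genocchi n - 1ℚ * binomialTransform genocchi n        ≡⟨ lemma (iterate p genocchi n) (binomialTransform genocchi n) (genocchi n) ⟩
    iterate p genocchi n + genocchi n - (binomialTransform genocchi n + genocchi n)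
      ≡⟨ cong (λ x → iterate p genocchi n + genocchi n - x) (binomialTransform-genocchi n) ⟩
    iterate p genocchi n + genocchi n - ℕ→ℚ 2 * 0ℚ                       ≡⟨ lemma′ (iterate p genocchi n + genocchi n) ⟩
    iterate p genocchi n + genocchi n                                    ∎
    where
    open ≡-Reasoning
    n = suc (suc e)
    g : ℕ → ℚ
    g k = sgn k * iterate (suc k) genocchi n
    lemma : ∀ x y z → 1ℚ * x - 1ℚ * y ≡ x + z - (y + z)
    lemma = solve-∀ ℚ-ring
    lemma′ : ∀ x → x - ℕ→ℚ 2 * 0ℚ ≡ x
    lemma′ = solve-∀ ℚ-ring
    functional : ∀ N → iterate (suc N) genocchi n + iterate N genocchi n ≡ ℕ→ℚ 2 * (ℕ→ℚ n * ℕ→ℚ N ^ℚ suc e)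
    functional N = begin
      iterate (suc N) genocchi n + iterate N genocchi n
        ≡⟨ cong (_+ iterate N genocchi n) (iterate-comm N genocchi n) ⟨
      iterate N (binomialTransform genocchi) n + iterate N genocchi n
        ≡⟨ one (iterate N (binomialTransform genocchi) n) (iterate N genocchi n) ⟩
      1ℚ * iterate N (binomialTransform genocchi) n + 1ℚ * iterate N genocchi n
        ≡⟨ iterate-linear N 1ℚ 1ℚ (binomialTransform genocchi) genocchi n ⟨
      iterate N (λ k → 1ℚ * binomialTransform genocchi k + 1ℚ * genocchi k) n
        ≡⟨ iterate-cong N n (λ k → trans (sym (one (binomialTransform genocchi k) (genocchi k))) (trans (binomialTransform-genocchi k) (two (δ₁ k)))) ⟩
      iterate N (λ k → ℕ→ℚ 2 * δ₁ k + 0ℚ * δ₁ k) n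
        ≡⟨ iterate-linear N (ℕ→ℚ 2) 0ℚ δ₁ δ₁ n ⟩
      ℕ→ℚ 2 * iterate N δ₁ n + 0ℚ * iterate N δ₁ n
        ≡⟨ two (iterate N δ₁ n) ⟨
      ℕ→ℚ 2 * iterate N δ₁ n
        ≡⟨ cong (ℕ→ℚ 2 *_) (iterate-δ₁ N (suc e)) ⟩
      ℕ→ℚ 2 * (ℕ→ℚ n * ℕ→ℚ N ^ℚ suc e) ∎
      where
      one : ∀ x y → x + y ≡ 1ℚ * x + 1ℚ * y
      one = solve-∀ ℚ-ring
      two : ∀ x → ℕ→ℚ 2 * x ≡ ℕ→ℚ 2 * x + 0ℚ * x
      two = solve-∀ ℚ-ring
    difference : ∀ k → k ∈[1, q ] → ℕ→ℚ 2 * ℕ→ℚ n * (sgn k * ℕ→ℚ k ^ℚ suc e) ≡ g k - g (ℕ.pred k)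
    difference (suc k) _ = begin
      ℕ→ℚ 2 * ℕ→ℚ n * (sgn (suc k) * ℕ→ℚ (suc k) ^ℚ suc e)     ≡⟨ rearrange (ℕ→ℚ n) (sgn (suc k)) (ℕ→ℚ (suc k) ^ℚ suc e) ⟩
      sgn (suc k) * (ℕ→ℚ 2 * (ℕ→ℚ n * ℕ→ℚ (suc k) ^ℚ suc e))   ≡⟨ cong (sgn (suc k) *_) (functional (suc k)) ⟨
      - 1ℚ * sgn k * (iterate (suc (suc k)) genocchi n + iterate (suc k) genocchi n) ≡⟨ expand (sgn k) (iterate (suc (suc k)) genocchi n) (iterate (suc k) genocchi n) ⟩
      - 1ℚ * sgn k * iterate (suc (suc k)) genocchi n - sgn k * iterate (suc k) genocchi n ∎
      where
      rearrange : ∀ n s x → ℕ→ℚ 2 * n * (s * x) ≡ s * (ℕ→ℚ 2 * (n * x))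
      rearrange = solve-∀ ℚ-ring
      expand : ∀ s x y → - 1ℚ * s * (x + y) ≡ - 1ℚ * s * x - s * y
      expand = solve-∀ ℚ-ring

  sgn-mirror-p : ∀ k → k ∈[1, q ] → sgn (p ℕ.∸ k) ≡ - sgn k
  sgn-mirror-p k (_ , k≤q) = begin
    sgn k′                        ≡⟨ ℚ.*-identityʳ (sgn k′) ⟨
    sgn k′ * 1ℚ                   ≡⟨ cong (sgn k′ *_) (sgn-* k) ⟨
    sgn k′ * (sgn k * sgn k)      ≡⟨ ℚ.*-assoc (sgn k′) (sgn k) (sgn k) ⟨
    sgn k′ * sgn k * sgn k        ≡⟨ cong (_* sgn k) (trans (sym (sgn-+ k′ k)) (trans (cong sgn (ℕ.m∸n+n≡m (ℕ.m≤n⇒m≤1+n k≤q))) (cong (- 1ℚ *_) sgn-q))) ⟩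
    - 1ℚ * sgn k                  ≡⟨ ℚ.neg-distribˡ-* 1ℚ (sgn k) ⟨
    - (1ℚ * sgn k)                ≡⟨ cong -_ (ℚ.*-identityˡ (sgn k)) ⟩
    - sgn k                       ∎
    where
    open ≡-Reasoning
    k′ = p ℕ.∸ k

  sgn-int : ∀ k → Integral (sgn k)
  sgn-int k = ^-int k (ℤ-int -[1+ 0 ])

  -- As p is odd, the sign flips under k ↦ p-k, while an even power is unchanged modulo p: the terms
  -- cancel in pairs.
  alternating-even∈ : ∀ e → sgn (suc e) ≡ 1ℚ → alternating e ∈𝔭^ 1
  alternating-even∈ e even = ∈-cancel (ℕ-unit p∤2) (∈-resp (sym doubled) (∈-≈ (Σ₁-≈ q pair) (∈-resp (sym (Σ₁-zero q λ _ _ → refl)) 0∈)))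
    where
    g : ℕ → ℚ
    g k = sgn k * ℕ→ℚ k ^ℚ suc e
    doubled : ℕ→ℚ 2 * alternating e ≡ Σ₁ q (λ k → g k + g (p ℕ.∸ k))
    doubled = trans (lemma (alternating e)) (trans (cong (alternating e +_) (Σ₁-reverse q g)) (sym (Σ₁-+ q g _)))
      where
      lemma : ∀ x → ℕ→ℚ 2 * x ≡ x + x
      lemma = solve-∀ ℚ-ring
    pair : ∀ k → k ∈[1, q ] → g k + g (p ℕ.∸ k) ≈ 0ℚ [ 1 ]
    pair k k∈ = ≈-trans (+-congˡ-≈ (g k) (≈-trans (≈-reflexive (cong (_* ℕ→ℚ (p ℕ.∸ k) ^ℚ suc e) (sgn-mirror-p k k∈)))
        (*-congˡ-≈ (int⇒∈ (-ᴵ sgn-int k)) (≈-trans (^-cong-≈ (suc e) (ℕ-int (p ℕ.∸ k)) (ℤ-int -[1+ 0 ] *ᴵ ℕ-int k) mirrored)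
          (≈-reflexive (trans (^ℚ-* (- 1ℚ) (ℕ→ℚ k) (suc e)) (cong (_* ℕ→ℚ k ^ℚ suc e) even)))))))
      (≈-reflexive (lemma (sgn k) (ℕ→ℚ k ^ℚ suc e)))
      where
      lemma : ∀ s x → s * x + - s * (1ℚ * x) ≡ 0ℚ
      lemma = solve-∀ ℚ-ring
      lemma′ : ∀ x y → x + y ≡ x - - 1ℚ * y
      lemma′ = solve-∀ ℚ-ring
      mirrored : ℕ→ℚ (p ℕ.∸ k) ≈ - 1ℚ * ℕ→ℚ k [ 1 ]
      mirrored = ∈⇒≈ (∈-resp (trans (cong ℕ→ℚ (sym (ℕ.m∸n+n≡m (ℕ.m≤n⇒m≤1+n (proj₂ k∈))))) (trans (ℕ→ℚ-+ (p ℕ.∸ k) k) (lemma′ (ℕ→ℚ (p ℕ.∸ k)) (ℕ→ℚ k)))) P∈)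

  -- Modulo p, `alternating-genocchi` reads 2n A ≡ 2G(n), with A ≡ 0 here. This disposes of the term
  -- n p G(n-1) modulo p² for even n.
  genocchi-odd∈ : ∀ e → sgn (suc e) ≡ 1ℚ → genocchi (suc (suc e)) ∈𝔭^ 1
  genocchi-odd∈ e even = ∈-cancel (ℕ-unit p∤2) (∈-resp (lemma g)
    (∈-≈ (≈-sym (≈-trans (≈-reflexive (alternating-genocchi e)) (+-cong-≈ (iterate-p-≈₁ genocchi genocchi-int (suc (suc e))) (≈-refl {g}))))
      ((ℕ-int 2 *ᴵ ℕ-int (suc (suc e))) ·∈ alternating-even∈ e even)))
    where
    g = genocchi (suc (suc e))
    lemma : ∀ g → g + g ≡ ℕ→ℚ 2 * g
    lemma = solve-∀ ℚ-ring

  bernoulli/n : ℕ → ℚ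
  bernoulli/n n = bernoulli n ÷' ℕ→ℚ n

  -- For even n, 2n A ≡ 2G(n) + n p G(n-1) ≡ 2G(n) (mod p²), where G(n) = 2(1 - 2ⁿ) n · B(n)/n; then
  -- 2n is cancelled.
  alternating≈bernoulli : ∀ e → sgn (suc e) ≡ 1ℚ → ¬ (p ∣ suc (suc (suc e))) →
    alternating (suc e) ≈ ℕ→ℚ 2 * (1ℚ - ℕ→ℚ 2 ^ℚ suc (suc (suc e))) * bernoulli/n (suc (suc (suc e))) [ 2 ]
  alternating≈bernoulli e even p∤n = ≈-cancel (ℕ-unit p∤n) (≈-cancel (ℕ-unit p∤2)
    (≈-trans (≈-reflexive (trans (sym (ℚ.*-assoc (ℕ→ℚ 2) ν (alternating (suc e)))) (alternating-genocchi (suc e))))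
    (≈-trans (+-cong-≈ (≈-trans (iterate-p-≈₂ genocchi genocchi-int n) (+-congˡ-≈ g (∈⇒≈0 ((ℕ-int n ·∈ P∈) *∈ genocchi-odd∈ e even)))) (≈-refl {g}))
      (≈-reflexive (trans (cong (λ x → ℕ→ℚ 2 * x + - ℕ→ℚ 2 * (t * x) + 0ℚ + (ℕ→ℚ 2 * x + - ℕ→ℚ 2 * (t * x))) (sym (÷'-cancel (bernoulli n) (ℕ→ℚ-suc≢0 (suc (suc e)))))) (lemma ν t (bernoulli/n n)))))))
    where
    n = suc (suc (suc e))
    ν = ℕ→ℚ n
    g = genocchi n
    t = ℕ→ℚ 2 ^ℚ n
    lemma : ∀ ν t b → ℕ→ℚ 2 * (ν * b) + - ℕ→ℚ 2 * (t * (ν * b)) + 0ℚ + (ℕ→ℚ 2 * (ν * b) + - ℕ→ℚ 2 * (t * (ν * b))) ≡ ℕ→ℚ 2 * (ν * (ℕ→ℚ 2 * (1ℚ - t) * b))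
    lemma = solve-∀ ℚ-ring

  -- Adding Σ 1/k³ ≡ 0 (mod p²) doubles the even terms and removes the odd ones, and 4 · 2/(2k)³ =
  -- 1/k³.
  Σ-alternating-inv³≈h₃ : ℕ→ℚ 4 * Σ₁ q (λ k → sgn k * inv³ k) ≈ h₃ [ 2 ]
  Σ-alternating-inv³≈h₃ = ∈⇒≈ (∈-resp (trans (lemma A₃ H₃′) (cong (λ x → ℕ→ℚ 4 * A₃ - x) folded)) (-∈ (ℕ-int 4 ·∈ H₃∈)))
    where
    A₃ = Σ₁ q (λ k → sgn k * inv³ k)
    H₃′ = Σ₁ q inv³
    lemma : ∀ A H → - (ℕ→ℚ 4 * H) ≡ ℕ→ℚ 4 * A - ℕ→ℚ 4 * (A + H)
    lemma = solve-∀ ℚ-ring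
    f : ℕ → ℚ
    f k = sgn k * inv³ k + inv³ k
    even : ∀ k → k ∈[1, m ] → ℕ→ℚ 4 * (f (k ℕ.+ k) + f (ℕ.pred (k ℕ.+ k))) ≡ inv³ k
    even k@(suc j) (1≤k , _) = begin
      ℕ→ℚ 4 * (sgn (k ℕ.+ k) * inv³ (k ℕ.+ k) + inv³ (k ℕ.+ k) + (sgn (j ℕ.+ suc j) * x + x))
        ≡⟨ cong₂ (λ y z → ℕ→ℚ 4 * (y * inv³ (k ℕ.+ k) + inv³ (k ℕ.+ k) + (z * x + x))) (trans (sgn-+ k k) (sgn-* k)) (trans (sgn-+ j (suc j)) (trans (lemma₁ (sgn j)) (cong -_ (sgn-* j)))) ⟩
      ℕ→ℚ 4 * (1ℚ * inv³ (k ℕ.+ k) + inv³ (k ℕ.+ k) + (- 1ℚ * x + x))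
        ≡⟨ lemma₂ (inv (k ℕ.+ k)) x ⟩
      ℕ→ℚ 2 * i * (ℕ→ℚ 2 * i) * (ℕ→ℚ 2 * i)
        ≡⟨ cong (λ y → y * y * y) (inv-double k 1≤k) ⟨
      inv³ k ∎
      where
      open ≡-Reasoning
      i = inv (k ℕ.+ k)
      x = inv³ (j ℕ.+ suc j)
      lemma₁ : ∀ s → s * (- 1ℚ * s) ≡ - (s * s)
      lemma₁ = solve-∀ ℚ-ring
      lemma₂ : ∀ i x → ℕ→ℚ 4 * (1ℚ * (i * i * i) + i * i * i + (- 1ℚ * x + x)) ≡ ℕ→ℚ 2 * i * (ℕ→ℚ 2 * i) * (ℕ→ℚ 2 * i)
      lemma₂ = solve-∀ ℚ-ring
    folded : ℕ→ℚ 4 * (A₃ + H₃′) ≡ h₃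
    folded = trans (cong (ℕ→ℚ 4 *_) (trans (sym (Σ₁-+ q (λ k → sgn k * inv³ k) inv³)) (Σ₁-even-odd m f)))
      (trans (sym (Σ₁-* m (ℕ→ℚ 4) _)) (Σ₁-cong m even))

  module _ (s : ℕ) (q≡ : 5 ℕ.+ s ≡ q) where

    -- With s = p - 6, these are p - 3 and 2p - 4, written without truncated subtraction.
    n₁ n₂ : ℕ
    n₁ = 3 ℕ.+ s
    n₂ = 3 ℕ.+ (q ℕ.+ s)

    b₁ b₂ f : ℚ
    b₁ = bernoulli/n n₁
    b₂ = bernoulli/n n₂
    f = ℕ→ℚ 2 ^ℚ q

    f≈1 : f ≈ 1ℚ [ 1 ]
    f≈1 = fermat 2 (s≤s z≤n , subst (2 ≤_) q≡ (s≤s (s≤s z≤n)))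

    f-int : Integral f
    f-int = ^-int q (ℕ-int 2)

    sgn-s : sgn (suc s) ≡ 1ℚ
    sgn-s = trans (lemma (sgn s)) (trans (cong sgn q≡) sgn-q)
      where
      lemma : ∀ x → - 1ℚ * x ≡ - 1ℚ * (- 1ℚ * (- 1ℚ * (- 1ℚ * (- 1ℚ * x))))
      lemma = solve-∀ ℚ-ring

    sgn-q+s : sgn (suc (q ℕ.+ s)) ≡ 1ℚ
    sgn-q+s = trans (cong (- 1ℚ *_) (trans (sgn-+ q s) (trans (cong (_* sgn s) sgn-q) (ℚ.*-identityˡ (sgn s))))) sgn-s

    p∤n₁ : ¬ (p ∣ n₁)
    p∤n₁ = p∤index n₁ (s≤s z≤n , subst (n₁ ≤_) q≡ (ℕ.+-monoˡ-≤ s (ℕ.≤ᵇ⇒≤ 3 5 _)))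

    n₂+4≡p+p : n₂ ℕ.+ 4 ≡ p ℕ.+ p
    n₂+4≡p+p = trans (lemma q s) (cong (λ x → suc q ℕ.+ suc x) q≡)
      where
      lemma : ∀ q s → 3 ℕ.+ (q ℕ.+ s) ℕ.+ 4 ≡ suc q ℕ.+ suc (5 ℕ.+ s)
      lemma = solveℕ-∀

    p∤n₂ : ¬ (p ∣ n₂)
    p∤n₂ p∣n₂ = p∤small 4 (ℕ.≤ᵇ⇒≤ 4 5 _) (ℕ∣.∣m+n∣m⇒∣n (subst (p ∣_) (sym n₂+4≡p+p) (ℕ∣.∣m∣n⇒∣m+n ℕ∣.∣-refl ℕ∣.∣-refl)) p∣n₂)

    2^n₁ : ℕ→ℚ 4 * ℕ→ℚ 2 ^ℚ n₁ ≡ f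
    2^n₁ = trans (lemma (ℕ→ℚ 2 ^ℚ n₁)) (cong (ℕ→ℚ 2 ^ℚ_) q≡)
      where
      lemma : ∀ x → ℕ→ℚ 4 * x ≡ ℕ→ℚ 2 * (ℕ→ℚ 2 * x)
      lemma = solve-∀ ℚ-ring

    2^n₂ : ℕ→ℚ 4 * ℕ→ℚ 2 ^ℚ n₂ ≡ f * f
    2^n₂ = trans (cong (λ x → ℕ→ℚ 4 * ℕ→ℚ 2 ^ℚ x) (lemma q s)) (trans (cong (ℕ→ℚ 4 *_) (^ℚ-+ (ℕ→ℚ 2) q n₁)) (trans (lemma′ f (ℕ→ℚ 2 ^ℚ n₁)) (cong (f *_) 2^n₁)))
      where
      lemma : ∀ q s → 3 ℕ.+ (q ℕ.+ s) ≡ q ℕ.+ (3 ℕ.+ s)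
      lemma = solveℕ-∀
      lemma′ : ∀ f x → ℕ→ℚ 4 * (f * x) ≡ f * (ℕ→ℚ 4 * x)
      lemma′ = solve-∀ ℚ-ring

    -- The exponents are p - 4 and 2p - 5, one below the Bernoulli indices.
    A₁ A₂ : ℚ
    A₁ = alternating (suc s)
    A₂ = alternating (suc (q ℕ.+ s))

    A-int : ∀ e → Integral (alternating e)
    A-int e = Σ₁-int q λ k _ → sgn-int k *ᴵ ^-int (suc e) (ℕ-int k)

    -- The factor 4 turns 1 - 2^(p-3) into 4 - `f`, with `f` = 2^(p-1) ≡ 1 (mod p).
    A₁≈ : ℕ→ℚ 4 * A₁ ≈ ℕ→ℚ 2 * (ℕ→ℚ 4 - f) * b₁ [ 2 ]
    A₁≈ = ≈-trans (*-congˡ-≈ (int⇒∈ (ℕ-int 4)) (alternating≈bernoulli s sgn-s p∤n₁))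
      (≈-reflexive (trans (lemma (ℕ→ℚ 2 ^ℚ n₁) b₁) (cong (λ x → ℕ→ℚ 2 * (ℕ→ℚ 4 - x) * b₁) 2^n₁)))
      where
      lemma : ∀ t b → ℕ→ℚ 4 * (ℕ→ℚ 2 * (1ℚ - t) * b) ≡ ℕ→ℚ 2 * (ℕ→ℚ 4 - ℕ→ℚ 4 * t) * b
      lemma = solve-∀ ℚ-ring

    A₂≈ : ℕ→ℚ 4 * A₂ ≈ ℕ→ℚ 2 * (ℕ→ℚ 4 - f * f) * b₂ [ 2 ]
    A₂≈ = ≈-trans (*-congˡ-≈ (int⇒∈ (ℕ-int 4)) (alternating≈bernoulli (q ℕ.+ s) sgn-q+s p∤n₂))
      (≈-reflexive (trans (lemma (ℕ→ℚ 2 ^ℚ n₂) b₂) (cong (λ x → ℕ→ℚ 2 * (ℕ→ℚ 4 - x) * b₂) 2^n₂)))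
      where
      lemma : ∀ t b → ℕ→ℚ 4 * (ℕ→ℚ 2 * (1ℚ - t) * b) ≡ ℕ→ℚ 2 * (ℕ→ℚ 4 - ℕ→ℚ 4 * t) * b
      lemma = solve-∀ ℚ-ring

    power-shift : ∀ k → ℕ→ℚ k ^ℚ suc (suc (q ℕ.+ s)) ≡ ℕ→ℚ k ^ℚ q * ℕ→ℚ k ^ℚ (2 ℕ.+ s)
    power-shift k = trans (cong (ℕ→ℚ k ^ℚ_) (lemma q s)) (^ℚ-+ (ℕ→ℚ k) q (2 ℕ.+ s))
      where
      lemma : ∀ q s → 2 ℕ.+ (q ℕ.+ s) ≡ q ℕ.+ (2 ℕ.+ s)
      lemma = solveℕ-∀

    A₁≈A₂ : A₁ ≈ A₂ [ 1 ]
    A₁≈A₂ = Σ₁-≈ q λ k k∈ → *-congˡ-≈ (int⇒∈ (sgn-int k)) (≈-sym (≈-trans (≈-reflexive (power-shift k))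
      (≈-trans (*-cong-≈ (^-int q (ℕ-int k)) (^-int (2 ℕ.+ s) (ℕ-int k)) (fermat k k∈) ≈-refl) (≈-reflexive (ℚ.*-identityˡ _)))))

    4-f-unit : Unit (ℕ→ℚ 4 - f)
    4-f-unit = unit-≈ (ℕ-unit p∤3) (ℕ-int 4 -ᴵ f-int) (+-congˡ-≈ (ℕ→ℚ 4) (-‿cong-≈ f≈1))

    4-f²-unit : Unit (ℕ→ℚ 4 - f * f)
    4-f²-unit = unit-≈ (ℕ-unit p∤3) (ℕ-int 4 -ᴵ f-int *ᴵ f-int) (+-congˡ-≈ (ℕ→ℚ 4) (-‿cong-≈ (*-cong-≈ f-int (ℕ-int 1) f≈1 f≈1)))

    -- A₁ is integral and 2(4 - f) ≡ 6 (mod p) is a unit, so the integrality of B_(p-3)/(p-3) is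
    -- read off from `A₁≈`.
    b₁-int : Integral b₁
    b₁-int = ∈⇒int (∈-cancel (*-unit (ℕ-unit p∤2) 4-f-unit) (∈-≈ (≈-sym (≈-weaken 2 0 A₁≈)) (int⇒∈ (ℕ-int 4 *ᴵ A-int (suc s)))))

    b₂-int : Integral b₂
    b₂-int = ∈⇒int (∈-cancel (*-unit (ℕ-unit p∤2) 4-f²-unit) (∈-≈ (≈-sym (≈-weaken 2 0 A₂≈)) (int⇒∈ (ℕ-int 4 *ᴵ A-int (suc (q ℕ.+ s))))))

    -- Kummer's congruence for these indices: A₁ ≡ A₂ by Fermat, and f ≡ 1 gives 4A₁ ≡ 6b₁ and 4A₂ ≡
    -- 6b₂ (mod p).
    b₁≈b₂ : b₁ ≈ b₂ [ 1 ]
    b₁≈b₂ = ≈-cancel (ℕ-unit p∤6) (∈⇒≈ (∈-resp (lemma A₁ A₂ f b₁ b₂)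
      ((ℕ-int 4 ·∈ ≈⇒∈ A₁≈A₂ -∈ (≈⇒∈ (≈-weaken 1 1 A₁≈) -∈ ≈⇒∈ (≈-weaken 1 1 A₂≈)))
        +∈ (ℕ-int 2 *ᴵ b₁-int) ·∈ ≈⇒∈ f≈1 -∈ (ℕ-int 2 *ᴵ b₂-int *ᴵ (f-int +ᴵ ℕ-int 1)) ·∈ ≈⇒∈ f≈1)))
      where
      lemma : ∀ A A′ f b b′ → ℕ→ℚ 4 * (A - A′) - ((ℕ→ℚ 4 * A - ℕ→ℚ 2 * (ℕ→ℚ 4 - f) * b) - (ℕ→ℚ 4 * A′ - ℕ→ℚ 2 * (ℕ→ℚ 4 - f * f) * b′))
          + ℕ→ℚ 2 * b * (f - 1ℚ) - ℕ→ℚ 2 * b′ * (f + 1ℚ) * (f - 1ℚ) ≡ ℕ→ℚ 6 * b - ℕ→ℚ 6 * b′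
      lemma = solve-∀ ℚ-ring

    -- With φ = k^(p-1), (φ - 1)² ≡ 0 (mod p²) gives 1 ≡ 2φ - φ²; dividing by k³ yields the
    -- exponents p - 4 and 2p - 5.
    A₃≈ : Σ₁ q (λ k → sgn k * inv³ k) ≈ ℕ→ℚ 2 * A₁ - A₂ [ 2 ]
    A₃≈ = ≈-trans (Σ₁-≈ q term) (≈-reflexive (trans (Σ₁-- q (λ k → ℕ→ℚ 2 * (sgn k * ℕ→ℚ k ^ℚ (2 ℕ.+ s))) _) (cong (_- A₂) (Σ₁-* q (ℕ→ℚ 2) _))))
      where
      term : ∀ k → k ∈[1, q ] → sgn k * inv³ k ≈ ℕ→ℚ 2 * (sgn k * ℕ→ℚ k ^ℚ (2 ℕ.+ s)) - sgn k * ℕ→ℚ k ^ℚ suc (suc (q ℕ.+ s)) [ 2 ]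
      term k k∈@(1≤k , _) = ∈⇒≈ (∈-resp (trans (lemma (sgn k) i φ)
          (cong₂ (λ x y → sgn k * inv³ k - (ℕ→ℚ 2 * (sgn k * x) - sgn k * y)) φi³ (trans (cong (φ *_) φi³) (sym (power-shift k)))))
        ((sgn-int k *ᴵ i-int *ᴵ i-int *ᴵ i-int) ·∈ (≈⇒∈ (fermat k k∈) *∈ ≈⇒∈ (fermat k k∈))))
        where
        i = inv k
        κ = ℕ→ℚ k
        φ = ℕ→ℚ k ^ℚ q
        i-int = inv-int k k∈
        lemma : ∀ s i φ → s * i * i * i * ((φ - 1ℚ) * (φ - 1ℚ)) ≡ s * (i * i * i) - (ℕ→ℚ 2 * (s * (φ * (i * i * i))) - s * (φ * (φ * (i * i * i))))
        lemma = solve-∀ ℚ-ring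
        lemma′ : ∀ κ x i → κ * (κ * (κ * x)) * (i * i * i) ≡ κ * i * (κ * i) * (κ * i) * x
        lemma′ = solve-∀ ℚ-ring
        φi³ : φ * (i * i * i) ≡ κ ^ℚ (2 ℕ.+ s)
        φi³ = trans (cong (λ x → κ ^ℚ x * (i * i * i)) (sym q≡)) (trans (lemma′ κ (κ ^ℚ (2 ℕ.+ s)) i)
          (trans (cong (λ x → x * x * x * κ ^ℚ (2 ℕ.+ s)) (inv-inverse k 1≤k)) (ℚ.*-identityˡ _)))

    -- Put f = 1 + ε. Then h₃ ≡ 8A₁ - 4A₂ ≡ 4(3 - ε) b₁ - 2(3 - 2ε - ε²) b₂. The excess over 12b₁ -
    -- 6b₂ is -4ε(b₁ - b₂) + 2ε²b₂, which is 0 modulo p² because p divides ε and b₁ - b₂.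
    h₃≈ : h₃ ≈ ℕ→ℚ 12 * b₁ - ℕ→ℚ 6 * b₂ [ 2 ]
    h₃≈ = ∈⇒≈ (∈-resp (lemma h₃ (Σ₁ q (λ k → sgn k * inv³ k)) A₁ A₂ f b₁ b₂)
      (-∈ ≈⇒∈ Σ-alternating-inv³≈h₃ +∈ ℕ-int 4 ·∈ ≈⇒∈ A₃≈ +∈ ℕ-int 2 ·∈ ≈⇒∈ A₁≈ -∈ ≈⇒∈ A₂≈
        -∈ ≈⇒∈ f≈1 *∈ (ℕ-int 4 ·∈ ≈⇒∈ b₁≈b₂ -∈ (ℕ-int 2 *ᴵ b₂-int) ·∈ ≈⇒∈ f≈1)))
      where
      lemma : ∀ h A₃ A A′ f b b′ →
        - (ℕ→ℚ 4 * A₃ - h) + ℕ→ℚ 4 * (A₃ - (ℕ→ℚ 2 * A - A′)) + ℕ→ℚ 2 * (ℕ→ℚ 4 * A - ℕ→ℚ 2 * (ℕ→ℚ 4 - f) * b)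
          - (ℕ→ℚ 4 * A′ - ℕ→ℚ 2 * (ℕ→ℚ 4 - f * f) * b′) - (f - 1ℚ) * (ℕ→ℚ 4 * (b - b′) - ℕ→ℚ 2 * b′ * (f - 1ℚ))
        ≡ h - (ℕ→ℚ 12 * b - ℕ→ℚ 6 * b′)
      lemma = solve-∀ ℚ-ring

    -- 4p - 8 is twice 2p - 4, so the second term of X_p is b₂/2.
    Xp≡ : ℕ→ℚ 12 * Xp p ≡ ℕ→ℚ 12 * b₁ - ℕ→ℚ 6 * b₂
    Xp≡ = trans (cong₂ (λ x y → ℕ→ℚ 12 * ((bernoulli x ÷' ℕ→ℚ x) - (bernoulli y ÷' ℕ→ℚ (4 ℕ.* p ℕ.∸ 8)))) index₁ index₂)
      (trans (cong (λ x → ℕ→ℚ 12 * (b₁ - (bernoulli n₂ ÷' ℕ→ℚ x))) index₃)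
      (trans (cong (λ x → ℕ→ℚ 12 * (b₁ - x)) halve) (lemma b₁ b₂)))
      where
      lemma : ∀ b b′ → ℕ→ℚ 12 * (b - ½ * b′) ≡ ℕ→ℚ 12 * b - ℕ→ℚ 6 * b′
      lemma = solve-∀ ℚ-ring
      index₁ : p ℕ.∸ 3 ≡ n₁
      index₁ = cong (ℕ._∸ 2) (sym q≡)
      index₂ : 2 ℕ.* p ℕ.∸ 4 ≡ n₂
      index₂ = trans (cong (ℕ._∸ 4) (trans (cong (p ℕ.+_) (ℕ.+-identityʳ p)) (sym n₂+4≡p+p))) (ℕ.m+n∸n≡m n₂ 4)
      index₃ : 4 ℕ.* p ℕ.∸ 8 ≡ n₂ ℕ.+ n₂
      index₃ = trans (cong (ℕ._∸ 8) (trans (four p) (trans (cong₂ ℕ._+_ (sym n₂+4≡p+p) (sym n₂+4≡p+p)) (regroup n₂)))) (ℕ.m+n∸n≡m (n₂ ℕ.+ n₂) 8)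
        where
        four : ∀ p → 4 ℕ.* p ≡ (p ℕ.+ p) ℕ.+ (p ℕ.+ p)
        four = solveℕ-∀
        regroup : ∀ n → (n ℕ.+ 4) ℕ.+ (n ℕ.+ 4) ≡ (n ℕ.+ n) ℕ.+ 8
        regroup = solveℕ-∀
      n₂+n₂≢0 : ℕ→ℚ (n₂ ℕ.+ n₂) ≢ 0ℚ
      n₂+n₂≢0 = ℕ→ℚ-suc≢0 (2 ℕ.+ (q ℕ.+ s) ℕ.+ n₂)
      halve : bernoulli n₂ ÷' ℕ→ℚ (n₂ ℕ.+ n₂) ≡ ½ * b₂
      halve = *-cancelˡ-≢0 n₂+n₂≢0 (trans (÷'-cancel (bernoulli n₂) n₂+n₂≢0)
        (trans (sym (÷'-cancel (bernoulli n₂) (ℕ→ℚ-suc≢0 (2 ℕ.+ (q ℕ.+ s)))))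
          (trans (lemma″ (ℕ→ℚ n₂) b₂) (cong (_* (½ * b₂)) (sym (ℕ→ℚ-+ n₂ n₂))))))
        where
        lemma″ : ∀ n b → n * b ≡ (n + n) * (½ * b)
        lemma″ = solve-∀ ℚ-ring

    H≈2P²Xp-5+s : H ≈ ℕ→ℚ 2 * (P * P * Xp p) [ 4 ]
    H≈2P²Xp-5+s = ≈-cancel (ℕ-unit p∤6)
      (≈-trans 6H≈P²h₃ (≈-trans (∈⇒≈ (∈-resp (lemma P h₃ (ℕ→ℚ 12 * b₁ - ℕ→ℚ 6 * b₂)) (P^∈ 2 *∈ ≈⇒∈ (h₃≈))))
        (≈-reflexive (trans (cong (P * P *_) (sym (Xp≡))) (lemma′ P (Xp p))))))
      where
      lemma : ∀ P x y → P * (P * 1ℚ) * (x - y) ≡ P * P * x - P * P * y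
      lemma = solve-∀ ℚ-ring
      lemma′ : ∀ P x → P * P * (ℕ→ℚ 12 * x) ≡ ℕ→ℚ 6 * (ℕ→ℚ 2 * (P * P * x))
      lemma′ = solve-∀ ℚ-ring

  H≈2P²Xp : H ≈ ℕ→ℚ 2 * (P * P * Xp p) [ 4 ]
  H≈2P²Xp = H≈2P²Xp-5+s (proj₁ s) (proj₂ s)
    where s = ℕ.m≤n⇒∃[o]m+o≡n (ℕ.≤-pred 5<p)

-- Assembling the congruence for p = 2m + 1

module Main (m : ℕ) (p-prime : Prime (suc (m ℕ.+ m))) (5<p : 5 < suc (m ℕ.+ m)) (a : ℤ) where
  open Powers m p-prime 5<p
  open Expansion m p-prime 5<p a
  open SecondSum m p-prime 5<p using (PS₂≈)
  open BernoulliSide m p-prime 5<p using (H≈2P²Xp)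

  -- `W` is the sum of the U(k) over 1, ..., q shifted by one place; the difference telescopes to
  -- U(q) - U(0) = 0.
  lhsSum≡1+W : lhsSum p a ≡ 1ℚ + W
  lhsSum≡1+W = begin
    lhsSum p a                                       ≡⟨ Σ<≡Σ₁ q F ⟩
    F 0 + Σ₁ q F                                     ≡⟨ cong₂ _+_ (term 0 z≤n) (Σ₁-cong q λ { k (_ , k≤q) → term k k≤q }) ⟩
    U 0 + Σ₁ q U                                     ≡⟨ rearrange (U 0) (Σ₁ q U) W ⟩
    U 0 + (W + (Σ₁ q U - W))                         ≡⟨ cong (λ x → U 0 + (W + x)) (trans (sym (Σ₁-- q U _)) (Σ₁-telescope q U)) ⟩
    U 0 + (W + (U q - U 0))                          ≡⟨ cong₂ (λ x y → x + (W + (y - x))) U0≡1 Uq≡1 ⟩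
    1ℚ + (W + (1ℚ - 1ℚ))                             ≡⟨ cong (λ x → 1ℚ + x) (ℚ.+-identityʳ W) ⟩
    1ℚ + W                                           ∎
    where
    open ≡-Reasoning
    F : ℕ → ℚ
    F k = ((- 1ℚ) ^ℤ (a ℤ.* ℤ.+ k)) * (ℕ→ℚ (q C k) ^ℤ a)
    rearrange : ∀ x y w → x + y ≡ x + (w + (y - w))
    rearrange = solve-∀ ℚ-ring
    -1≢0 : - 1ℚ ≢ 0ℚ
    -1≢0 ()
    term : ∀ k → k ≤ q → F k ≡ U k
    term k k≤q = begin
      ((- 1ℚ) ^ℤ (a ℤ.* ℤ.+ k)) * (ℕ→ℚ (q C k) ^ℤ a)    ≡⟨ cong (_* (ℕ→ℚ (q C k) ^ℤ a)) (^ℤ-* -1≢0 a k) ⟩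
      (sgn k ^ℤ a) * (ℕ→ℚ (q C k) ^ℤ a)                 ≡⟨ ^ℤ-distrib-* (^ℚ-≢0 -1≢0 k) C≢0 a ⟨
      (sgn k * ℕ→ℚ (q C k)) ^ℤ a                        ≡⟨ cong (_^ℤ a) (u≡sgn*C k) ⟨
      U k                                               ∎
      where
      C≢0 : ℕ→ℚ (q C k) ≢ 0ℚ
      C≢0 C≡0 = unit⇒≢0 (u-unit k k≤q) (trans (u≡sgn*C k) (trans (cong (sgn k *_) C≡0) (ℚ.*-zeroʳ (sgn k))))

  D N E X : ℚ
  D = ℤ→ℚ (a ℤ.* ℤ.+ p ℤ.- ℤ.+ 1)
  N = ℤ→ℚ ((a ℤ.- ℤ.+ 1) ℤ.* ℤ.+ p)
  E = ℤ→ℚ (a ℤ.* (a ℤ.+ ℤ.+ 1) ℤ.* (ℤ.+ 3 ℤ.* a ℤ.- ℤ.+ 2)) ÷' ℕ→ℚ 6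
  X = Xp p

  D≡ : D ≡ α * P - 1ℚ
  D≡ = trans (ℤ→ℚ-- (a ℤ.* ℤ.+ p) (ℤ.+ 1)) (cong (_- 1ℚ) (ℤ→ℚ-* a (ℤ.+ p)))

  N≡ : N ≡ (α - 1ℚ) * P
  N≡ = trans (ℤ→ℚ-* (a ℤ.- ℤ.+ 1) (ℤ.+ p)) (cong (_* P) (ℤ→ℚ-- a (ℤ.+ 1)))

  6E≡ : ℕ→ℚ 6 * E ≡ α * (α + 1ℚ) * (ℕ→ℚ 3 * α - ℕ→ℚ 2)
  6E≡ = trans (÷'-cancel (ℤ→ℚ (a ℤ.* (a ℤ.+ ℤ.+ 1) ℤ.* (ℤ.+ 3 ℤ.* a ℤ.- ℤ.+ 2))) (ℕ→ℚ-suc≢0 5))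
    (trans (ℤ→ℚ-* (a ℤ.* (a ℤ.+ ℤ.+ 1)) (ℤ.+ 3 ℤ.* a ℤ.- ℤ.+ 2))
      (cong₂ _*_ (trans (ℤ→ℚ-* a (a ℤ.+ ℤ.+ 1)) (cong (α *_) (ℤ→ℚ-+ a (ℤ.+ 1))))
        (trans (ℤ→ℚ-- (ℤ.+ 3 ℤ.* a) (ℤ.+ 2)) (cong (_- ℕ→ℚ 2) (ℤ→ℚ-* (ℤ.+ 3) a)))))

  D-unit : Unit D
  D-unit = unit-≈ (ℤ-unit { -[1+ 0 ]} p∤1) (ℤ-int (a ℤ.* ℤ.+ p ℤ.- ℤ.+ 1))
    (∈⇒≈ (∈-resp (trans (lemma (α * P)) (cong (_- - 1ℚ) (sym D≡))) (α-int ·∈ P∈)))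
    where
    lemma : ∀ x → x ≡ (x - 1ℚ) - - 1ℚ
    lemma = solve-∀ ℚ-ring

  -- Modulo p⁶, p³S₂ = p² · p S₂ ≡ (3a-2) p²H ≡ 2(3a-2) p⁴X_p; with (a³-a)/12 in front this is
  -- (a-1)p · a(a+1)(3a-2)/6 · p³X_p.
  multiplied : D * (1ℚ + W) ≈ N * (1ℚ + E * P ^ℚ 3 * X) [ 6 ]
  multiplied = ≈-trans (≈-reflexive (cong (_* (1ℚ + W)) D≡)) (≈-trans
    (∈⇒≈ (∈-resp (lemma α P W S₂ H X)
      (-∈ (≈⇒∈ expansion) +∈ D₂-int ·∈ (P^∈ 2 *∈ ≈⇒∈ (PS₂≈ a)) +∈ (D₂-int *ᴵ (ℕ-int 3 *ᴵ α-int -ᴵ ℕ-int 2)) ·∈ (P^∈ 2 *∈ ≈⇒∈ H≈2P²Xp))))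
    (≈-reflexive (trans (cong (λ x → (α - 1ℚ) * P * (1ℚ + ½ * ⅓ * x * (P * (P * (P * 1ℚ))) * X)) (sym 6E≡))
      (trans (lemma′ ((α - 1ℚ) * P) E (P ^ℚ 3) X) (cong (_* (1ℚ + E * P ^ℚ 3 * X)) (sym N≡))))))
    where
    D₂-int : Integral (⅓ * ¼ * α * (α - 1ℚ) * (α + 1ℚ))
    D₂-int = ⅓-int *ᴵ ¼-int *ᴵ α-int *ᴵ (α-int -ᴵ ℕ-int 1) *ᴵ (α-int +ᴵ ℕ-int 1)
    lemma : ∀ α P W S₂ H X →
      - ((1ℚ - α * P) * (1ℚ + W) - (P * (1ℚ - α) - ⅓ * ¼ * α * (α - 1ℚ) * (α + 1ℚ) * (P * P * P) * S₂))
      + ⅓ * ¼ * α * (α - 1ℚ) * (α + 1ℚ) * (P * (P * 1ℚ) * (P * S₂ - (ℕ→ℚ 3 * α - ℕ→ℚ 2) * H))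
      + ⅓ * ¼ * α * (α - 1ℚ) * (α + 1ℚ) * (ℕ→ℚ 3 * α - ℕ→ℚ 2) * (P * (P * 1ℚ) * (H - ℕ→ℚ 2 * (P * P * X)))
      ≡ (α * P - 1ℚ) * (1ℚ + W) - (α - 1ℚ) * P * (1ℚ + ½ * ⅓ * (α * (α + 1ℚ) * (ℕ→ℚ 3 * α - ℕ→ℚ 2)) * (P * (P * (P * 1ℚ))) * X)
    lemma = solve-∀ ℚ-ring
    lemma′ : ∀ n e t x → n * (1ℚ + ½ * ⅓ * (ℕ→ℚ 6 * e) * t * x) ≡ n * (1ℚ + e * t * x)
    lemma′ = solve-∀ ℚ-ring

  -- `D` = ap - 1 is -1 modulo p, hence a unit; in particular it is nonzero, so `÷'` is true
  -- division by it.
  congruence : lhsSum p a ≈ rhsExpr p a [ 6 ]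
  congruence = ≈-trans (≈-reflexive lhsSum≡1+W) (≈-cancel D-unit (≈-trans multiplied
    (≈-reflexive (trans (cong (_* (1ℚ + E * P ^ℚ 3 * X)) (sym (÷'-cancel N (unit⇒≢0 D-unit)))) (ℚ.*-assoc D (N ÷' D) (1ℚ + E * P ^ℚ 3 * X))))))

-- Writing the prime as 2m + 1 and returning to the congruence of the statement

parity : ∀ n → ∃ λ m → n ≡ m ℕ.+ m ⊎ n ≡ suc (m ℕ.+ m)
parity zero = 0 , inj₁ refl
parity (suc n) with parity n
... | m , inj₁ refl = m , inj₂ refl
... | m , inj₂ refl = suc m , inj₁ (cong suc (sym (ℕ.+-suc m m)))

odd-prime : ∀ {p} → Prime p → 5 < p → ∃ λ m → p ≡ suc (m ℕ.+ m)
odd-prime {p} p-prime 5<p with parity p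
... | m , inj₂ p≡ = m , p≡
... | m , inj₁ p≡ with ℕ.prime⇒irreducible p-prime {2} (divides m (trans p≡ (trans (cong (m ℕ.+_) (sym (ℕ.+-identityʳ m))) (ℕ.*-comm 2 m))))
...   | inj₂ 2≡p = contradiction (subst (5 <_) (sym 2≡p) 5<p) λ { (s≤s (s≤s ())) }

-- With the equation as an argument, `refl` replaces `p` by the form that the modules take as
-- parameter.
odd-congruence : ∀ {p} m → p ≡ suc (m ℕ.+ m) → (p-prime : Prime p) → 5 < p → ∀ a →
  Localization._≈_[_] p p-prime (lhsSum p a) (rhsExpr p a) 6
odd-congruence m refl p-prime 5<p a = Main.congruence m p-prime 5<p a

theorem1p1 : (p : ℕ) → Prime p → 5 < p → (a : ℤ) →
    lhsSum p a ≡ rhsExpr p a [modℚ p ^ 6 ]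
theorem1p1 p p-prime 5<p a = Localization.≈⇒modℚ p p-prime (lhsSum p a) (rhsExpr p a) 6
  (odd-congruence (proj₁ odd) (proj₂ odd) p-prime 5<p a)
  where odd = odd-prime p-prime 5<p
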